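{- Let $k\ge2$ be a constant and let $n=\Omega(\omega^{(k-1)/k}M)$. The algorithm $\textsf{Asym-Alg}$ (defined in the context) computes the $k$-d grid computation structure of size $n$ with (sequential) asymmetric cache complexity $$\Theta\left(\frac{n^k\,\omega^{1/k}}{M^{1/(k-1)}B}\right).$$
   Context: Cost model. The memory consists of an unbounded main memory and a cache of size $O(M)$; data are transferred between them in cache lines of $B$ consecutive entries, and all computation occurs on data in the cache. An optimal (offline) cache replacement policy is assumed. For a write/read cost ratio $\omega\ge 1$, the asymmetric cache complexity is the number of cache-line reads from main memory plus $\omega$ times the number of cache-line writes to main memory. It is assumed that $n^{k-1}$ is much larger than $M$, so that the cost of writing the output once ($\Theta(\omega n^{k-1}/B)$) is ignored in the asymptotics. $k$-d grid. A $k$-d grid computation structure of size $n_1\times\cdots\times n_k$ ($k$ a constant greater than 1) has $k-1$ input arrays $I_1,\dots,I_{k-1}$ and one output array $O$, each $(k-1)$-dimensional. For each cell $(i_1,\dots,i_k)$ with $1\le i_j\le n_j$, a unit-cost function $g$ is applied to the $k-1$ input entries, where the entry taken from $I_j$ is the one indexed by $(i_1,\dots,i_k)$ with $i_j$ removed ($1\le j\le k-1$), together with the indices and a constant amount of data associated with the indices; the resulting value is accumulated, with an associative operation $\oplus$, into the entry of $O$ indexed by $(i_1,\dots,i_{k-1})$. The input and output entries of a cell must be in the cache when the cell is computed. "Size $n$" means $n_1=\cdots=n_k=n$. Algorithm $\textsf{Asym-Alg}(I_1,\dots,I_{k-1},O)$ on a grid of size $n_1\times\cdots\times n_k$: if the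 arrays are of small enough (constant) size, solve directly. Otherwise let $i=\arg\max_{1\le i\le k}\{n_ix_i\}$ where $x_k=\omega^{ -(k-1)/k}$ and $x_j=1$ for $1\le j<k$. Split dimension $i$ into two equal halves and recurse sequentially on the two half-grids: if $i=k$, all input arrays $I_1,\dots,I_{k-1}$ are split in half along the $k$-th dimension and both recursive calls use the same output $O$; if $i<k$, all arrays other than $I_i$ (including $O$) are split in half along dimension $i$, and both calls use the same $I_i$. Partitioning is only by passing index ranges. The algorithm is unaware of $M$ and $B$.
   Formalization: The cost ratio ω is rational instead of real; the arrays, whose storage order is left open, are stored in the recursive order given by the algorithm's splitting rule, and the argmax is taken over dimensions of size at least 2. -}

module Defs where

open import Algebra.Bundles using (Semigroup)
open import Data.Bool.Base using (Bool; true; false; if_then_else_; _∨_)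
open import Data.Fin.Base using (Fin; fromℕ; inject₁; punchIn)
import Data.Fin.Properties as Fin
open import Data.Integer.Base using (+_)
open import Data.List.Base using (List; []; _∷_; _++_; map; concatMap; filter; foldl; length; upTo; allFin)
open import Data.List.Membership.Propositional using (_∈_; _∉_)
open import Data.List.Relation.Unary.All using (All)
open import Data.List.Relation.Unary.Any using (_─_)
open import Data.Maybe.Base using (Maybe; just; nothing; maybe)
open import Data.Nat.Base as ℕ using (ℕ; zero; suc; NonZero; ⌊_/2⌋; ⌈_/2⌉)
import Data.Nat.Properties as ℕ
open import Data.Product.Base using (_×_; _,_; proj₁; proj₂; ∃₂)
open import Data.Product.Properties using (≡-dec)
open import Data.Rational.Base as ℚ using (ℚ)
open import Data.Vec.Base as Vec using (Vec; []; _∷_; _∷ʳ_; lookup; removeAt; updateAt)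
import Data.Vec.Properties as Vec
open import Level using (Level; _⊔_)
open import Relation.Binary.Definitions using (DecidableEquality)
open import Relation.Binary.PropositionalEquality using (_≡_)
open import Relation.Nullary.Decidable using (⌊_⌋; yes; no)

open import Algebra.Definitions.RawSemiring ℚ.+-*-rawSemiring using (_^_)

-- Throughout d = k - 1, so a grid has suc d dimensions and suc d arrays, each of
-- dimension d.  Dimensions, arrays and entries are numbered from 0, and array j is
-- indexed by the cell index with coordinate j removed: arrays inject₁ j are the
-- inputs, array fromℕ d is the output.

Index : ℕ → Set
Index m = Vec ℕ m

ι : ℕ → ℚ
ι n = (+ n) ℚ./ 1

module _ {m : ℕ} where

  -- An index range (start , length) in every dimension.
  Box : Set
  Box = Vec (ℕ × ℕ) m

  lengths : Box → Vec ℕ m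
  lengths = Vec.map proj₂

  lowerHalf upperHalf : Fin m → Box → Box
  lowerHalf i box = updateAt box i (λ (s , l) → s , ⌊ l /2⌋)
  upperHalf i box = updateAt box i (λ (s , l) → s ℕ.+ ⌊ l /2⌋ , ⌈ l /2⌉)

wholeBox : ∀ {m} → Vec ℕ m → Box
wholeBox = Vec.map (0 ,_)

-- Lexicographic order, the last coordinate varying fastest.
points : ∀ {m} → Box {m} → List (Index m)
points []              = [] ∷ []
points ((s , l) ∷ box) = concatMap (λ i → map (i ∷_) (points box)) (map (s ℕ.+_) (upTo l))

-- Ties go to the earliest element.
argmaxFrom : ∀ {A : Set} → (A → ℚ) → A → List A → A
argmaxFrom f best []       = best
argmaxFrom f best (y ∷ ys) = if f y ℚ.≤ᵇ f best then argmaxFrom f best ys else argmaxFrom f y ys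

argmax : ∀ {A : Set} → (A → ℚ) → List A → Maybe A
argmax f []       = nothing
argmax f (x ∷ xs) = just (argmaxFrom f x xs)

-- The dimension i of largest priority f i nᵢ among those that can be halved (nᵢ ≥ 2).
splitDimension : ∀ {m} → (Fin m → ℕ → ℚ) → Vec ℕ m → Maybe (Fin m)
splitDimension {m} f ns =
  argmax (λ i → f i (lookup ns i)) (filter (λ i → 2 ℕ.≤? lookup ns i) (allFin m))

-- Divide and conquer on a box: solve directly if `small`, otherwise halve the
-- dimension chosen by `splitDimension` and treat the two halves one after the other.
-- The result lists the points in the order of treatment.
divideFuel : ∀ {m} → (Fin m → ℕ → ℚ) → (Vec ℕ m → Bool) → ℕ → Box {m} → List (Index m)
divideFuel f small zero       box = []
divideFuel f small (suc fuel) box =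
  if small (lengths box)
  then points box
  else maybe (λ i → divideFuel f small fuel (lowerHalf i box)
                    ++ divideFuel f small fuel (upperHalf i box))
             (points box)
             (splitDimension f (lengths box))

-- Every halving decreases the sum of the lengths, so for m ≥ 1 this recursion depth is
-- never exhausted on a box without empty dimensions.
divide : ∀ {m} → (Fin m → ℕ → ℚ) → (Vec ℕ m → Bool) → Box {m} → List (Index m)
divide f small box = divideFuel f small (Vec.sum (lengths box)) box

module Grid (d : ℕ) where

  k : ℕ
  k = suc d

  Cell : Set
  Cell = Index k

  out : Fin k
  out = fromℕ d

  -- (nᵢ xᵢ)ᵏ multiplied by the common factor ω^(k-1), where x_k = ω^(-(k-1)/k) and
  -- xᵢ = 1 otherwise.  This is rational and orders the dimensions as nᵢ xᵢ does.
  priority : ℚ → Fin k → ℕ → ℚ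
  priority ω i nᵢ with i Fin.≟ out
  ... | yes _ = ι nᵢ ^ k
  ... | no  _ = ι nᵢ ^ k ℚ.* ω ^ d

  -- All arrays of the (sub)grid have at most b entries.
  smallArrays : ℕ → Vec ℕ k → Bool
  smallArrays b ns = ⌊ Fin.all? (λ j → Vec.foldr′ ℕ._*_ 1 (removeAt ns j) ℕ.≤? b) ⌋

  -- The cells in the order in which the algorithm computes them; b is the constant
  -- size at which it stops recursing.
  asymAlg : (ω : ℚ) (b : ℕ) → Vec ℕ k → List Cell
  asymAlg ω b ns = divide (priority ω) (smallArrays b) (wholeBox ns)

  module Semantics {a c ℓ : Level} (S : Semigroup c ℓ) (A : Fin d → Set a)
                   (g : Cell → (∀ j → A j) → Semigroup.Carrier S)
                   (I : ∀ j → Index d → A j) where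
    open Semigroup S

    value : Cell → Carrier
    value p = g p (λ j → I j (removeAt p (inject₁ j)))

    step : (Index d → Carrier) → Cell → (Index d → Carrier)
    step O p e with Vec.≡-dec ℕ._≟_ e (removeAt p out)
    ... | yes _ = O e ∙ value p
    ... | no  _ = O e

    execute : List Cell → (Index d → Carrier) → (Index d → Carrier)
    execute t O = foldl step O t

  -- Executing the cells in the order t accumulates in every output entry e the values
  -- of the cells (e , i), 0 ≤ i < n_k.  As g receives the indices, it can also use
  -- data associated with them.
  ComputesGrid : (a c ℓ : Level) → Vec ℕ k → List Cell → Set (Level.suc (a ⊔ c ⊔ ℓ))
  ComputesGrid a c ℓ ns t =
    (S : Semigroup c ℓ) (A : Fin d → Set a) →
    let open Semigroup S in
    (g : Cell → (∀ j → A j) → Carrier) (I : ∀ j → Index d → A j) (O : Index d → Carrier) →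
    let open Semantics S A g I in
    (e : Index d) → (∀ i → lookup e i ℕ.< lookup ns (inject₁ i)) →
    execute t O e ≈ foldl (λ acc i → acc ∙ value (e ∷ʳ i)) (O e) (upTo (lookup ns out))

  -- Storage.  Array j is stored in main memory in the recursive layout in which the
  -- splitting rule of the algorithm, restricted to the dimensions of the array,
  -- enumerates its entries, so that the subarrays of recursive calls are contiguous.
  -- It depends, like the algorithm, on neither M nor B.  (With row-major order, moving a
  -- subarray of x entries in O(x / B + 1) transfers would need a tall-cache assumption.)
  layout : (ω : ℚ) → Vec ℕ k → Fin k → List (Index d)
  layout ω ns j = divide (λ i → priority ω (punchIn j i)) (λ _ → false) (wholeBox (removeAt ns j))

  position : Index d → List (Index d) → ℕ
  position e []       = 0
  position e (x ∷ xs) = if ⌊ Vec.≡-dec ℕ._≟_ e x ⌋ then 0 else suc (position e xs)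

  -- An array and the number of one of its blocks of B consecutive entries.
  Line : Set
  Line = Fin k × ℕ

  _≟ᴸ_ : DecidableEquality Line
  _≟ᴸ_ = ≡-dec Fin._≟_ ℕ._≟_

  -- The cache lines held, each with a flag telling whether it has been modified since
  -- it was read.
  Cache : Set
  Cache = List (Line × Bool)

  held : Cache → List Line
  held = map proj₁

  modify : Line → Cache → Cache
  modify x = map (λ (y , dirty) → y , ⌊ x ≟ᴸ y ⌋ ∨ dirty)

  module Machine (ω : ℚ) (ns : Vec ℕ k) (B : ℕ) .{{_ : NonZero B}} (capacity : ℕ) where

    line : Fin k → Cell → Line
    line j p = j , position (removeAt p j) (layout ω ns j) ℕ./ B

    -- Run C t r w: starting with cache contents C, the cells t are computed in this
    -- order with r reads and w writes of cache lines, leaving no modified line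
    -- unwritten.  Reads and evictions are unconstrained, apart from the number of
    -- lines held, so the runs range over all offline replacement policies.
    data Run : Cache → List Cell → ℕ → ℕ → Set where
      finish    : ∀ {C} → All (λ (_ , dirty) → dirty ≡ false) C → Run C [] 0 0
      read      : ∀ {C t r w} (x : Line) → x ∉ held C → length C ℕ.< capacity →
                  Run ((x , false) ∷ C) t r w → Run C t (suc r) w
      discard   : ∀ {C t r w} {x : Line} (x∈C : (x , false) ∈ C) →
                  Run (C ─ x∈C) t r w → Run C t r w
      writeBack : ∀ {C t r w} {x : Line} (x∈C : (x , true) ∈ C) →
                  Run (C ─ x∈C) t r w → Run C t r (suc w)
      compute   : ∀ {C p t r w} → (∀ j → line j p ∈ held C) →
                  Run (modify (line out p) C) t r w → Run C (p ∷ t) r w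

  cost : ℚ → ℕ → ℕ → ℚ
  cost ω r w = ι r ℚ.+ ω ℚ.* ι w

  -- Comparison of x with T = nᵏ ω^(1/k) / (M^(1/(k-1)) B) up to a constant.  Both sides
  -- are raised to the power k (k-1), which makes all exponents integral, and the
  -- denominators are cleared.
  module Target (n M B : ℕ) (ω : ℚ) where

    -- x ≤ C T
    _≤_·T : ℚ → ℕ → Set
    x ≤ C ·T = (x ℚ.* ι B) ^ (k ℕ.* d) ℚ.* ι M ^ k
               ℚ.≤ ι C ^ (k ℕ.* d) ℚ.* (ι n ^ (k ℕ.* (k ℕ.* d)) ℚ.* ω ^ d)

    -- T ≤ C x
    T≤_·_ : ℕ → ℚ → Set
    T≤ C · x = ι n ^ (k ℕ.* (k ℕ.* d)) ℚ.* ω ^ d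
               ℚ.≤ ι C ^ (k ℕ.* d) ℚ.* ((x ℚ.* ι B) ^ (k ℕ.* d) ℚ.* ι M ^ k)

  -- ω^((k-1)/k) M ≤ a n, raised to the power k.
  LargeSize : (a n M : ℕ) → ℚ → Set
  LargeSize a n M ω = ω ^ d ℚ.* ι M ^ k ℚ.≤ (ι a ℚ.* ι n) ^ k

  -- The asymmetric cache complexity of computing t, i.e. the minimum over all runs from
  -- the empty cache, lies in [T / C₁ , C₂ T].
  CacheComplexityΘ : (C₁ C₂ : ℕ) (ω : ℚ) (n M B : ℕ) .{{_ : NonZero B}} (capacity : ℕ) →
                     List Cell → Set
  CacheComplexityΘ C₁ C₂ ω n M B capacity t =
    (∀ r w → Run [] t r w → T≤ C₁ · cost ω r w)
    × (∃₂ λ r w → Run [] t r w × cost ω r w ≤ C₂ ·T)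
    where
    open Machine ω (Vec.replicate k n) B capacity
    open Target n M B ω

{-# OPTIONS --safe #-}
module Submission where

-- All nodes of the recursion tree have nearly equal dimensions n₁, …, n_{k-1}, and n_k is at most about
-- ω^((k-1)/k) times these, with equality up to a constant once dimension k has been halved and while they exceed 1.
--
-- Lower bound: only the writes matter.  Consider the first boxes of the recursion whose output has at most
-- θ = 6 α M entries.  Each of them touches at least twice as many output lines as fit into the cache, so at least
-- half of these lines are written while it is processed (if the whole output is smaller, it is written at the end).
-- Such a box has depth n_k = O(ω^((k-1)/k) M^(1/(k-1))), and a constant fraction of volume / depth entries is written.
--
-- Upper bound: inputs and output are cached at different scales.  With θ = Θ(M), the output lines of the first boxes
-- with at most θ output entries are held throughout the box, and the input lines only throughout the first boxes
-- inside it all of whose arrays have at most θ entries.  The former have depth Ω(ω^((k-1)/k) M^(1/(k-1))), which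
-- bounds the writes; the latter have other dimensions Ω(M^(1/(k-1)) ω^(-1/k)), which bounds the reads.
--
-- As roots are irrational, these bounds are expressed by the extremal natural number satisfying the corresponding
-- inequality between powers, and ω = p / q is cleared of its denominator.

-- Why two scales: in a balanced tree, the first boxes all of whose arrays fit have side about
-- M^(1/(k-1)) ω^(-1/k) and depth only about M^(1/(k-1)) ω^((k-2)/k). Writing the output anew for
-- each of them would cost ω n^k / (depth B), too much by the factor ω^(1/k). Up to a constant the
-- output is the smallest array, so it already fits in larger and deeper boxes; keeping its lines
-- from there on removes this factor.
--
-- Transfers are charged to the volume, which is additive over halves. The array without dimension j
-- has volume / n_j entries, so its number of transfers is governed by the length of the dimension
-- that it lacks.
--
-- The recursive layout turns every subarray into an interval of positions, so S entries meet at
-- most S / B + 2 lines. The 2 is absorbed since B ≤ M and the charged boxes have arrays of order M: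
-- each is a half of a box with an array above θ, or it is the whole grid, for which the size
-- hypothesis gives M ≤ a n.

open import Algebra.Bundles using (Semigroup; CommutativeRing)
import Algebra.Properties.CommutativeSemigroup as CommutativeSemigroupProperties
import Algebra.Properties.CommutativeSemiring.Exp as CommutativeSemiringExp
open import Data.Bool.Base using (Bool; true; false; _∨_; T)
open import Data.Bool.Properties using (∨-zeroʳ)
open import Data.Empty using (⊥-elim)
open import Data.Fin.Base as Fin using (Fin; zero; suc; fromℕ; inject₁; punchIn; punchOut)
import Data.Fin.Properties as Fin
import Data.Integer.Base as ℤ
import Data.Integer.Properties as ℤ
open import Data.List.Base as List using (List; []; _∷_; _++_; map; concatMap; filter; foldl; length; upTo; applyUpTo; allFin)
import Data.List.Properties as List
open import Data.List.Membership.Propositional using (_∈_; _∉_; find; lose)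
open import Data.List.Membership.Propositional.Properties
  using (∈-++⁺ˡ; ∈-++⁺ʳ; ∈-++⁻; ∈-map⁺; ∈-map⁻; ∈-concatMap⁺; ∈-concatMap⁻; ∈-filter⁺; ∈-filter⁻; ∈-allFin; ∈-upTo⁺; ∈-upTo⁻; ∈-cartesianProductWith⁺; ∈-cartesianProductWith⁻)
open import Data.List.Relation.Unary.All as All using (All; []; _∷_)
import Data.List.Relation.Unary.All.Properties as All
open import Data.List.Relation.Unary.AllPairs using (AllPairs; []; _∷_)
import Data.List.Relation.Unary.AllPairs.Properties as AllPairs
open import Data.List.Relation.Unary.Any using (here; there; _─_)
open import Data.List.Relation.Unary.Unique.Propositional using (Unique)
import Data.List.Relation.Unary.Unique.Propositional.Properties as Unique
open import Data.Maybe.Base using (just; nothing)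
open import Data.Maybe.Properties using (just-injective)
open import Data.Nat.Base
  using (ℕ; zero; suc; NonZero; _+_; _*_; _∸_; _^_; _/_; _%_; pred; _≤_; _<_; z≤n; s≤s; ⌊_/2⌋; ⌈_/2⌉; >-nonZero; >-nonZero⁻¹)
import Data.Nat.Coprimality as Coprimality
open import Data.Nat.DivMod
open import Data.Nat.Properties
open import Data.Nat.Solver using (module +-*-Solver)
open import Data.Product.Base using (_×_; _,_; proj₁; proj₂; ∃; ∃₂)
open import Data.Rational.Base as ℚ using (ℚ; 1ℚ)
import Data.Rational.Properties as ℚ
import Data.Rational.Unnormalised.Base as ℚᵘ
open import Data.Sum.Base using (_⊎_; inj₁; inj₂; [_,_]′)
open import Data.Vec.Base as Vec using (Vec; []; _∷_; _∷ʳ_; lookup; removeAt; updateAt; insertAt; replicate)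
import Data.Vec.Properties as Vec
open import Function.Base using (_∘_; id; case_of_)
open import Level using (Level)
open import Relation.Binary.Definitions using (tri<; tri≈; tri>)
open import Relation.Binary.PropositionalEquality
open import Relation.Nullary.Decidable using (Dec; yes; no; ⌊_⌋; toWitness)
open import Relation.Nullary.Negation using (¬_; contradiction)
open import Relation.Unary using (Decidable)
open import Defs

open import Algebra.Definitions.RawSemiring ℚ.+-*-rawSemiring using () renaming (_^_ to _^ᵠ_)

-- Products of vectors, powers and halvings

variable
  m : ℕ

product : Vec ℕ m → ℕ
product = Vec.foldr′ _*_ 1

module _ {a} {A : Set a} where

  lookup-removeAt : ∀ (xs : Vec A (suc m)) j i → lookup (removeAt xs j) i ≡ lookup xs (punchIn j i)
  lookup-removeAt (x ∷ xs)       zero    i       = refl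
  lookup-removeAt (x ∷ _ ∷ _)    (suc j) zero    = refl
  lookup-removeAt (x ∷ y ∷ ys)   (suc j) (suc i) = lookup-removeAt (y ∷ ys) j i

  removeAt-updateAt : ∀ (xs : Vec A (suc m)) j {f} → removeAt (updateAt xs j f) j ≡ removeAt xs j
  removeAt-updateAt (x ∷ xs)         zero          = refl
  removeAt-updateAt (x ∷ y ∷ ys)     (suc zero)    = refl
  removeAt-updateAt (x ∷ y ∷ z ∷ ys) (suc (suc j)) {f} = cong (x ∷_) (removeAt-updateAt (y ∷ z ∷ ys) (suc j) {f})

  removeAt-updateAt-punchIn : ∀ (xs : Vec A (suc m)) j i {f} →
    removeAt (updateAt xs (punchIn j i) f) j ≡ updateAt (removeAt xs j) i f
  removeAt-updateAt-punchIn (x ∷ xs)     zero    i       = refl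
  removeAt-updateAt-punchIn (x ∷ y ∷ ys) (suc j) zero    = refl
  removeAt-updateAt-punchIn (x ∷ y ∷ z ∷ ys) (suc zero) (suc i) = refl
  removeAt-updateAt-punchIn (x ∷ y ∷ z ∷ ys) (suc (suc j)) (suc zero) {f} =
    cong (x ∷_) (removeAt-updateAt-punchIn (y ∷ z ∷ ys) (suc j) zero {f})
  removeAt-updateAt-punchIn (x ∷ y ∷ z ∷ ys) (suc (suc j)) (suc (suc i)) {f} =
    cong (x ∷_) (removeAt-updateAt-punchIn (y ∷ z ∷ ys) (suc j) (suc i) {f})

map-removeAt : ∀ {a b} {A : Set a} {B : Set b} (f : A → B) (xs : Vec A (suc m)) j →
  Vec.map f (removeAt xs j) ≡ removeAt (Vec.map f xs) j
map-removeAt f (x ∷ xs)     zero    = refl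
map-removeAt f (x ∷ y ∷ ys) (suc j) = cong (f x ∷_) (map-removeAt f (y ∷ ys) j)

product-removeAt : ∀ (xs : Vec ℕ (suc m)) j → lookup xs j * product (removeAt xs j) ≡ product xs
product-removeAt (x ∷ xs)     zero    = refl
product-removeAt (x ∷ y ∷ ys) (suc j) = begin
  l * (x * P)          ≡⟨ *-assoc l x P ⟨
  l * x * P            ≡⟨ cong (_* P) (*-comm l x) ⟩
  x * l * P            ≡⟨ *-assoc x l P ⟩
  x * (l * P)          ≡⟨ cong (x *_) (product-removeAt (y ∷ ys) j) ⟩
  x * product (y ∷ ys) ∎
  where
  open ≡-Reasoning
  l = lookup (y ∷ ys) j
  P = product (removeAt (y ∷ ys) j)

product-updateAt-+ : ∀ {f g : ℕ → ℕ} → (∀ x → f x + g x ≡ x) → ∀ (xs : Vec ℕ m) i →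
  product (updateAt xs i f) + product (updateAt xs i g) ≡ product xs
product-updateAt-+ {f = f} {g} f+g≗id (x ∷ xs) zero =
  trans (sym (*-distribʳ-+ (product xs) (f x) (g x))) (cong (_* product xs) (f+g≗id x))
product-updateAt-+ f+g≗id (x ∷ xs) (suc i) =
  trans (sym (*-distribˡ-+ x _ _)) (cong (x *_) (product-updateAt-+ f+g≗id xs i))

product-updateAt-≤ : ∀ {c} {f : ℕ → ℕ} (xs : Vec ℕ m) i → lookup xs i ≤ c * f (lookup xs i) →
  product xs ≤ c * product (updateAt xs i f)
product-updateAt-≤ {c = c} {f} (x ∷ xs) zero x≤cfx =
  ≤-trans (*-monoˡ-≤ (product xs) x≤cfx) (≤-reflexive (*-assoc c (f x) (product xs)))
product-updateAt-≤ {c = c} {f} (x ∷ xs) (suc i) x≤cfx = ≤-trans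
  (*-monoʳ-≤ x (product-updateAt-≤ {c = c} xs i x≤cfx))
  (≤-reflexive (solve 3 (λ x c y → x :* (c :* y) := c :* (x :* y)) refl x c (product (updateAt xs i f))))
  where
  open +-*-Solver

product-pos : ∀ (xs : Vec ℕ m) → (∀ i → 1 ≤ lookup xs i) → 1 ≤ product xs
product-pos []       1≤xs = ≤-refl
product-pos (x ∷ xs) 1≤xs = *-mono-≤ (1≤xs zero) (product-pos xs (1≤xs ∘ suc))

^-distribʳ-* : ∀ m n o → (m * n) ^ o ≡ m ^ o * n ^ o
^-distribʳ-* m n zero    = refl
^-distribʳ-* m n (suc o) = begin
  m * n * (m * n) ^ o     ≡⟨ cong (m * n *_) (^-distribʳ-* m n o) ⟩
  m * n * (m ^ o * n ^ o) ≡⟨ solve 4 (λ a b x y → a :* b :* (x :* y) := a :* x :* (b :* y)) refl m n (m ^ o) (n ^ o) ⟩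
  m * m ^ o * (n * n ^ o) ∎
  where
  open ≡-Reasoning
  open +-*-Solver

^-swap : ∀ m n o → (m ^ n) ^ o ≡ (m ^ o) ^ n
^-swap m n o = trans (^-*-assoc m n o) (trans (cong (m ^_) (*-comm n o)) (sym (^-*-assoc m o n)))

-- Multiplication of m inequalities. The exponent `k` stays on the factors because x / c need not
-- have an integral k-th root; bounds with real exponents are kept in this form throughout.
x^m≤product : ∀ x c k (ys : Vec ℕ m) → (∀ i → x ≤ c * lookup ys i ^ k) → x ^ m ≤ c ^ m * product ys ^ k
x^m≤product x c k []       x≤ = ≤-reflexive (sym (trans (+-identityʳ _) (^-zeroˡ k)))
x^m≤product {suc m} x c k (y ∷ ys) x≤ = begin
  x * x ^ m                                  ≤⟨ *-mono-≤ (x≤ zero) (x^m≤product x c k ys (x≤ ∘ suc)) ⟩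
  c * y ^ k * (c ^ m * product ys ^ k)
    ≡⟨ solve 4 (λ a b x y → a :* b :* (x :* y) := a :* x :* (b :* y)) refl c (y ^ k) (c ^ m) (product ys ^ k) ⟩
  c * c ^ m * (y ^ k * product ys ^ k)       ≡⟨ cong (c * c ^ m *_) (^-distribʳ-* y (product ys) k) ⟨
  c * c ^ m * (y * product ys) ^ k           ∎
  where
  open ≤-Reasoning
  open +-*-Solver

product≤x^m : ∀ x c k (ys : Vec ℕ m) → (∀ i → c * lookup ys i ^ k ≤ x) → c ^ m * product ys ^ k ≤ x ^ m
product≤x^m x c k []       ≤x = ≤-reflexive (trans (+-identityʳ _) (^-zeroˡ k))
product≤x^m {suc m} x c k (y ∷ ys) ≤x = begin
  c * c ^ m * (y * product ys) ^ k           ≡⟨ cong (c * c ^ m *_) (^-distribʳ-* y (product ys) k) ⟩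
  c * c ^ m * (y ^ k * product ys ^ k)
    ≡⟨ solve 4 (λ a b x y → a :* b :* (x :* y) := a :* x :* (b :* y)) refl c (c ^ m) (y ^ k) (product ys ^ k) ⟩
  c * y ^ k * (c ^ m * product ys ^ k)       ≤⟨ *-mono-≤ (≤x zero) (product≤x^m x c k ys (≤x ∘ suc)) ⟩
  x * x ^ m                                  ∎
  where
  open ≤-Reasoning
  open +-*-Solver

product≤^ : ∀ x (ys : Vec ℕ m) → (∀ i → lookup ys i ≤ x) → product ys ≤ x ^ m
product≤^ x []       ≤x = ≤-refl
product≤^ x (y ∷ ys) ≤x = *-mono-≤ (≤x zero) (product≤^ x ys (≤x ∘ suc))

product-replicate : ∀ m n → product (replicate m n) ≡ n ^ m
product-replicate zero    n = refl
product-replicate (suc m) n = cong (n *_) (product-replicate m n)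

-- Abstracts from which half is taken. The 3 is the worst ratio, reached by the lower half of length
-- 3; the factors 3, 9 and 27 of the later bounds stem from it.
record Halving (h : ℕ → ℕ) : Set where
  field
    ≤3h  : ∀ {x} → 2 ≤ x → x ≤ 3 * h x
    h<   : ∀ {x} → 2 ≤ x → h x < x
    pos  : ∀ {x} → 2 ≤ x → 1 ≤ h x

  h≤ : ∀ {x} → 2 ≤ x → h x ≤ x
  h≤ = <⇒≤ ∘ h<

n≤3⌊n/2⌋ : ∀ n → 2 ≤ n → n ≤ 3 * ⌊ n /2⌋
n≤3⌊n/2⌋ 1 (s≤s ())
n≤3⌊n/2⌋ 2 _ = s≤s (s≤s z≤n)
n≤3⌊n/2⌋ 3 _ = ≤-refl
n≤3⌊n/2⌋ (suc (suc n@(suc (suc _)))) _ = begin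
  2 + n               ≤⟨ +-monoʳ-≤ 2 (n≤3⌊n/2⌋ n (s≤s (s≤s z≤n))) ⟩
  2 + 3 * ⌊ n /2⌋     ≤⟨ n≤1+n _ ⟩
  3 + 3 * ⌊ n /2⌋     ≡⟨ *-distribˡ-+ 3 1 ⌊ n /2⌋ ⟨
  3 * (1 + ⌊ n /2⌋)   ∎
  where
  open ≤-Reasoning

⌈n/2⌉<n′ : ∀ {n} → 2 ≤ n → ⌈ n /2⌉ < n
⌈n/2⌉<n′ {suc (suc n)} _ = ⌈n/2⌉<n n
⌈n/2⌉<n′ {1} (s≤s ())

⌊/2⌋-halving : Halving ⌊_/2⌋
⌊/2⌋-halving = record
  { ≤3h = n≤3⌊n/2⌋ _
  ; h<  = λ {x} 2≤x → ≤-<-trans (⌊n/2⌋≤⌈n/2⌉ x) (⌈n/2⌉<n′ 2≤x)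
  ; pos = ⌊n/2⌋-mono
  }

⌈/2⌉-halving : Halving ⌈_/2⌉
⌈/2⌉-halving = record
  { ≤3h = λ {x} 2≤x → ≤-trans (n≤3⌊n/2⌋ x 2≤x) (*-monoʳ-≤ 3 (⌊n/2⌋≤⌈n/2⌉ x))
  ; h<  = ⌈n/2⌉<n′
  ; pos = ⌈n/2⌉-mono
  }

maximalBelow : ∀ {p} {P : ℕ → Set p} → Decidable P → ∀ n → P 0 →
  ∃ λ N → P N × (∀ x → x ≤ n → P x → x ≤ N)
maximalBelow P? zero    P0 = 0 , P0 , λ x x≤0 _ → x≤0
maximalBelow P? (suc n) P0 with P? (suc n)
... | yes Pn = suc n , Pn , λ x x≤n _ → x≤n
... | no ¬Pn =
  let (N , PN , max) = maximalBelow P? n P0 in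
  N , PN , λ x x≤1+n Px → max x (m<1+n⇒m≤n (≤∧≢⇒< x≤1+n λ where refl → ¬Pn Px)) Px

minimal : ∀ {p} {P : ℕ → Set p} → Decidable P → ∀ n → P n → ∃ λ N → P N × (∀ x → P x → N ≤ x)
minimal P? n Pn with P? 0
minimal P? n       Pn | yes P0 = 0 , P0 , λ _ _ → z≤n
minimal P? zero    P0 | no ¬P0 = contradiction P0 ¬P0
minimal P? (suc n) Pn | no ¬P0 =
  let (N , PN , min) = minimal (P? ∘ suc) n Pn in
  suc N , PN , λ where
    zero    P0 → contradiction P0 ¬P0
    (suc x) Px → s≤s (min x Px)

-- The splitting rule and its recursion tree

module _ {A : Set} {_≺_ : A → A → Set} (≺-irrefl : ∀ {x} → ¬ (x ≺ x)) (≺-trans : ∀ {x y z} → x ≺ y → y ≺ z → x ≺ z)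
         (f : A → ℚ) where

  -- The strict part records that ties go to the earliest element. It makes the maximum unique, so
  -- that the choices from two different lists of candidates can be compared in
  -- `splitDimension-removeAt`.
  argmaxFrom-spec : ∀ x ys → AllPairs _≺_ (x ∷ ys) → let r = argmaxFrom f x ys in
    r ∈ x ∷ ys × (∀ {y} → y ∈ x ∷ ys → f y ℚ.≤ f r × (y ≺ r → f y ℚ.< f r))
  argmaxFrom-spec x [] _ = here refl , λ where
    (here refl) → ℚ.≤-refl , λ x≺x → contradiction x≺x ≺-irrefl
  argmaxFrom-spec x (y ∷ ys) ((x≺y ∷ x≺ys) ∷ y≺ys ∷ ≺ys) with f y ℚ.≤ᵇ f x in eq
  ... | true =
    let r∈ , max = argmaxFrom-spec x ys (x≺ys ∷ ≺ys)
        fy≤fx = ℚ.≤ᵇ⇒≤ (subst T (sym eq) _)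
        r = argmaxFrom f x ys
        fy<fr : ∀ {r} → r ∈ x ∷ ys → (x ≺ r → f x ℚ.< f r) → y ≺ r → f y ℚ.< f r
        fy<fr = λ where
          (here refl) _ y≺x → contradiction (≺-trans x≺y y≺x) ≺-irrefl
          (there r∈ys) fx<fr _ → ℚ.≤-<-trans fy≤fx (fx<fr (All.lookup x≺ys r∈ys))
    in
    (case r∈ of λ where
      (here r≡x)   → here r≡x
      (there r∈ys) → there (there r∈ys)) ,
    λ where
      (here refl)         → max (here refl)
      (there (here refl)) →
        ℚ.≤-trans fy≤fx (proj₁ (max (here refl))) , fy<fr r∈ (proj₂ (max (here refl)))
      (there (there z∈ys)) → max (there z∈ys)
  ... | false =
    let r∈ , max = argmaxFrom-spec y ys (y≺ys ∷ ≺ys)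
        fx<fy = ℚ.≰⇒> (λ fy≤fx → subst T eq (ℚ.≤⇒≤ᵇ fy≤fx))
        fx<fr = ℚ.<-≤-trans fx<fy (proj₁ (max (here refl)))
    in
    there r∈ , λ where
      (here refl) → ℚ.<⇒≤ fx<fr , λ _ → fx<fr
      (there z∈)  → max z∈

module _ {m} (f : Fin m → ℕ → ℚ) (ns : Vec ℕ m) where

  record IsSplitDimension (i : Fin m) : Set where
    constructor isSplit
    private
      value : Fin m → ℚ
      value l = f l (lookup ns l)
    field
      2≤     : 2 ≤ lookup ns i
      max    : ∀ l → 2 ≤ lookup ns l → value l ℚ.≤ value i
      first  : ∀ l → 2 ≤ lookup ns l → l Fin.< i → value l ℚ.< value i

  private
    splittable : List (Fin m)
    splittable = filter (λ i → 2 ≤? lookup ns i) (allFin m)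

    ∈-splittable : ∀ {l} → 2 ≤ lookup ns l → l ∈ splittable
    ∈-splittable = ∈-filter⁺ (λ i → 2 ≤? lookup ns i) (∈-allFin _)

    splittable⇒2≤ : ∀ {l} → l ∈ splittable → 2 ≤ lookup ns l
    splittable⇒2≤ = proj₂ ∘ ∈-filter⁻ (λ i → 2 ≤? lookup ns i) {xs = allFin m}

    splittable-sorted : AllPairs Fin._<_ splittable
    splittable-sorted = AllPairs.filter⁺ (λ i → 2 ≤? lookup ns i) (AllPairs.tabulate⁺-< id)

  splitDimension-just : ∀ {i} → splitDimension f ns ≡ just i → IsSplitDimension i
  splitDimension-just eq
    with splittable | (λ {l} → ∈-splittable {l}) | (λ {l} → splittable⇒2≤ {l}) | splittable-sorted
  splitDimension-just refl | x ∷ xs | ∈xs | 2≤ | sorted =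
    let r∈ , max = argmaxFrom-spec (Fin.<-irrefl refl) Fin.<-trans (λ i → f i (lookup ns i)) x xs sorted in
    isSplit (2≤ r∈) (λ l 2≤l → proj₁ (max (∈xs 2≤l))) (λ l 2≤l → proj₂ (max (∈xs 2≤l)))

  splitDimension-nothing : splitDimension f ns ≡ nothing → ∀ l → lookup ns l ≤ 1
  splitDimension-nothing eq l with splittable | (λ {l} → ∈-splittable {l})
  ... | [] | ∈[] = m<1+n⇒m≤n (≰⇒> λ 2≤l → case ∈[] 2≤l of λ ())

  splitDimension-unique : ∀ {i} → IsSplitDimension i → splitDimension f ns ≡ just i
  splitDimension-unique {i} i-split with splitDimension f ns in eq
  ... | nothing = contradiction (splitDimension-nothing eq i) (<⇒≱ (IsSplitDimension.2≤ i-split))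
  ... | just i′ with splitDimension-just eq | Fin.<-cmp i i′
  ...   | i′-split | tri< i<i′ _ _ = ⊥-elim (ℚ.<-irrefl refl (ℚ.<-≤-trans
    (IsSplitDimension.first i′-split i (IsSplitDimension.2≤ i-split) i<i′)
    (IsSplitDimension.max i-split i′ (IsSplitDimension.2≤ i′-split))))
  ...   | i′-split | tri≈ _ refl _ = refl
  ...   | i′-split | tri> _ _ i′<i = ⊥-elim (ℚ.<-irrefl refl (ℚ.<-≤-trans
    (IsSplitDimension.first i-split i′ (IsSplitDimension.2≤ i′-split) i′<i)
    (IsSplitDimension.max i′-split i (IsSplitDimension.2≤ i-split))))

punchIn-mono-< : ∀ (j : Fin (suc m)) {i l : Fin m} → i Fin.< l → punchIn j i Fin.< punchIn j l
punchIn-mono-< j {i} {l} i<l =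
  Fin.≤∧≢⇒< (Fin.punchIn-mono-≤ j i l (<⇒≤ i<l)) (Fin.<⇒≢ i<l ∘ Fin.punchIn-injective j i l)

-- A maximum stays maximal among fewer candidates, and `punchIn` preserves the order, so ties are
-- broken alike. Hence the layout of array j, which follows the restricted rule, is divided exactly
-- where the algorithm halves the array.
splitDimension-removeAt : ∀ (f : Fin (suc m) → ℕ → ℚ) ns j {i} →
  splitDimension f ns ≡ just (punchIn j i) →
  splitDimension (λ l → f (punchIn j l)) (removeAt ns j) ≡ just i
splitDimension-removeAt f ns j {i} eq with splitDimension-just f ns eq
... | isSplit 2≤ max first = splitDimension-unique (λ l → f (punchIn j l)) (removeAt ns j) (isSplit
  (subst (2 ≤_) (sym (at i)) 2≤)
  (λ l 2≤l → subst₂ (λ x y → f (punchIn j l) x ℚ.≤ f (punchIn j i) y) (sym (at l)) (sym (at i))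
    (max (punchIn j l) (subst (2 ≤_) (at l) 2≤l)))
  (λ l 2≤l l<i → subst₂ (λ x y → f (punchIn j l) x ℚ.< f (punchIn j i) y) (sym (at l)) (sym (at i))
    (first (punchIn j l) (subst (2 ≤_) (at l) 2≤l) (punchIn-mono-< j l<i))))
  where
  at : ∀ l → lookup (removeAt ns j) l ≡ lookup ns (punchIn j l)
  at = lookup-removeAt ns j

lengths-lowerHalf : ∀ (box : Box {m}) i → lengths (lowerHalf i box) ≡ updateAt (lengths box) i ⌊_/2⌋
lengths-lowerHalf box i = Vec.map-updateAt box i refl

lengths-upperHalf : ∀ (box : Box {m}) i → lengths (upperHalf i box) ≡ updateAt (lengths box) i ⌈_/2⌉
lengths-upperHalf box i = Vec.map-updateAt box i refl

lengths-wholeBox : ∀ (ns : Vec ℕ m) → lengths (wholeBox ns) ≡ ns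
lengths-wholeBox ns = trans (sym (Vec.map-∘ proj₂ (0 ,_) ns)) (Vec.map-id ns)

Positive : Vec ℕ m → Set
Positive ns = ∀ i → 1 ≤ lookup ns i

updateAt-positive : ∀ {h} → Halving h → ∀ (ns : Vec ℕ m) {i} → 2 ≤ lookup ns i → Positive ns → Positive (updateAt ns i h)
updateAt-positive halving ns {i} 2≤ ns-pos l with l Fin.≟ i
... | yes refl = subst (1 ≤_) (sym (Vec.lookup∘updateAt l ns)) (Halving.pos halving 2≤)
... | no  l≢i  = subst (1 ≤_) (sym (Vec.lookup∘updateAt′ l i l≢i ns)) (ns-pos l)

sum-updateAt-< : ∀ {h : ℕ → ℕ} (ns : Vec ℕ m) i → h (lookup ns i) < lookup ns i → Vec.sum (updateAt ns i h) < Vec.sum ns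
sum-updateAt-< (x ∷ ns) zero    h< = +-monoˡ-< (Vec.sum ns) h<
sum-updateAt-< (x ∷ ns) (suc i) h< = +-monoʳ-< x (sum-updateAt-< ns i h<)

module _ {m} (f : Fin m → ℕ → ℚ) (small : Vec ℕ m → Bool) where

  -- The recursion tree freed from the fuel, as the object of all later inductions. A small box and
  -- a box without a dimension to halve are both listed by `points`, so one constructor serves for
  -- them.
  data Division : Box {m} → List (Index m) → Set where
    stop  : ∀ {box} → small (lengths box) ≡ true ⊎ splitDimension f (lengths box) ≡ nothing →
            Division box (points box)
    halve : ∀ {box t₁ t₂} i → splitDimension f (lengths box) ≡ just i →
            Division (lowerHalf i box) t₁ → Division (upperHalf i box) t₂ →
            Division box (t₁ ++ t₂)

divideFuel-Division : ∀ (f : Fin (suc m) → ℕ → ℚ) small fuel box → Positive (lengths box) →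
  Vec.sum (lengths box) ≤ fuel → Division f small box (divideFuel f small fuel box)
divideFuel-Division f small zero ((s , l) ∷ box) box-pos sum≤0 =
  contradiction (≤-trans (≤-trans (box-pos zero) (m≤m+n l _)) sum≤0) λ ()
divideFuel-Division f small (suc fuel) box box-pos sum≤ with small (lengths box) in small≡
... | true = stop (inj₁ small≡)
... | false with splitDimension f (lengths box) in split≡
...   | nothing = stop (inj₂ split≡)
...   | just i = halve i split≡
  (half (lowerHalf i box) ⌊/2⌋-halving (lengths-lowerHalf box i))
  (half (upperHalf i box) ⌈/2⌉-halving (lengths-upperHalf box i))
  where
  2≤ : 2 ≤ lookup (lengths box) i
  2≤ = IsSplitDimension.2≤ (splitDimension-just f (lengths box) split≡)

  half : ∀ {h} box′ → Halving h → lengths box′ ≡ updateAt (lengths box) i h →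
         Division f small box′ (divideFuel f small fuel box′)
  half {h} box′ halving eq = divideFuel-Division f small fuel box′
    (subst Positive (sym eq) (updateAt-positive halving (lengths box) 2≤ box-pos))
    (m<1+n⇒m≤n (<-≤-trans
      (subst (λ ns → Vec.sum ns < Vec.sum (lengths box)) (sym eq)
        (sum-updateAt-< (lengths box) i (Halving.h< halving 2≤)))
      sum≤))

divide-Division : ∀ (f : Fin (suc m) → ℕ → ℚ) small box → Positive (lengths box) →
  Division f small box (divide f small box)
divide-Division f small box box-pos = divideFuel-Division f small _ box box-pos ≤-refl

-- Boxes and the lists of their points

InRange : ℕ → ℕ × ℕ → Set
InRange x (s , l) = s ≤ x × x < s + l

record InBox {m} (p : Index m) (box : Box {m}) : Set where
  constructor inBox
  field
    coord : ∀ i → InRange (lookup p i) (lookup box i)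

open InBox public

module _ {m} {g : ℕ × ℕ → ℕ × ℕ} {p : Index m} {box : Box {m}} {i : Fin m} where

  InBox-updateAt⁺ : InBox p box → InRange (lookup p i) (g (lookup box i)) → InBox p (updateAt box i g)
  InBox-updateAt⁺ p∈ pᵢ∈ .coord l with l Fin.≟ i
  ... | yes refl = subst (InRange (lookup p l)) (sym (Vec.lookup∘updateAt l box)) pᵢ∈
  ... | no  l≢i  = subst (InRange (lookup p l)) (sym (Vec.lookup∘updateAt′ l i l≢i box)) (coord p∈ l)

  InBox-updateAt-at : InBox p (updateAt box i g) → InRange (lookup p i) (g (lookup box i))
  InBox-updateAt-at p∈ = subst (InRange (lookup p i)) (Vec.lookup∘updateAt i box) (coord p∈ i)

  InBox-updateAt⁻ : (∀ {x} → InRange x (g (lookup box i)) → InRange x (lookup box i)) →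
                    InBox p (updateAt box i g) → InBox p box
  InBox-updateAt⁻ g⊆ p∈ .coord l with l Fin.≟ i
  ... | yes refl = g⊆ (InBox-updateAt-at p∈)
  ... | no  l≢i  = subst (InRange (lookup p l)) (Vec.lookup∘updateAt′ l i l≢i box) (coord p∈ l)

s+⌊l/2⌋+⌈l/2⌉≡s+l : ∀ s l → s + ⌊ l /2⌋ + ⌈ l /2⌉ ≡ s + l
s+⌊l/2⌋+⌈l/2⌉≡s+l s l = trans (+-assoc s ⌊ l /2⌋ ⌈ l /2⌉) (cong (s +_) (⌊n/2⌋+⌈n/2⌉≡n l))

module _ {m} {p : Index m} {box : Box {m}} {i : Fin m} where

  private
    s = proj₁ (lookup box i)
    l = proj₂ (lookup box i)

  InBox-lowerHalf⁻ : InBox p (lowerHalf i box) → InBox p box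
  InBox-lowerHalf⁻ = InBox-updateAt⁻ (λ (s≤ , <s+l/2) → s≤ , <-≤-trans <s+l/2 (+-monoʳ-≤ s (⌊n/2⌋≤n l)))

  InBox-upperHalf⁻ : InBox p (upperHalf i box) → InBox p box
  InBox-upperHalf⁻ = InBox-updateAt⁻ (λ (s+l/2≤ , <s+l) →
    ≤-trans (m≤m+n s _) s+l/2≤ , <-≤-trans <s+l (≤-reflexive (s+⌊l/2⌋+⌈l/2⌉≡s+l s l)))

  InBox-halves : InBox p box → InBox p (lowerHalf i box) ⊎ InBox p (upperHalf i box)
  InBox-halves p∈ with lookup p i <? s + ⌊ l /2⌋
  ... | yes <s+l/2 = inj₁ (InBox-updateAt⁺ p∈ (proj₁ (coord p∈ i) , <s+l/2))
  ... | no  ≮s+l/2 = inj₂ (InBox-updateAt⁺ p∈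
    (≮⇒≥ ≮s+l/2 , <-≤-trans (proj₂ (coord p∈ i)) (≤-reflexive (sym (s+⌊l/2⌋+⌈l/2⌉≡s+l s l)))))

  halves-disjoint : InBox p (lowerHalf i box) → ¬ InBox p (upperHalf i box)
  halves-disjoint p∈lower p∈upper = <⇒≱
    (proj₂ (InBox-updateAt-at {box = box} p∈lower)) (proj₁ (InBox-updateAt-at {box = box} p∈upper))

InBox-removeAt : ∀ {p : Index (suc m)} {box} j → InBox p box → InBox (removeAt p j) (removeAt box j)
InBox-removeAt {p = p} {box} j p∈ .coord l =
  subst₂ InRange (sym (lookup-removeAt p j l)) (sym (lookup-removeAt box j l)) (coord p∈ (punchIn j l))

InBox-insertAt : ∀ {e : Index m} {box : Box {suc m}} j {x} → InBox e (removeAt box j) → InRange x (lookup box j) →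
  InBox (insertAt e j x) box
InBox-insertAt {e = e} {box} j {x} e∈ x∈ .coord l with j Fin.≟ l
... | yes refl = subst (λ y → InRange y (lookup box l)) (sym (Vec.insertAt-lookup e l x)) x∈
... | no  j≢l  = subst (λ l → InRange (lookup (insertAt e j x) l) (lookup box l)) (Fin.punchIn-punchOut j≢l)
  (subst₂ InRange (sym (Vec.insertAt-punchIn e j x l′)) (lookup-removeAt box j l′) (coord e∈ l′))
  where l′ = punchOut j≢l

range : ℕ × ℕ → List ℕ
range (s , l) = map (s +_) (upTo l)

∈-range⁺ : ∀ {x r} → InRange x r → x ∈ range r
∈-range⁺ {x} {s , l} (s≤x , x<s+l) = subst (_∈ range (s , l)) (m+[n∸m]≡n s≤x)
  (∈-map⁺ (s +_) (∈-upTo⁺ (+-cancelˡ-< s (x ∸ s) l (subst (_< s + l) (sym (m+[n∸m]≡n s≤x)) x<s+l))))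

∈-range⁻ : ∀ {x r} → x ∈ range r → InRange x r
∈-range⁻ {r = s , l} x∈ with ∈-map⁻ (s +_) x∈
... | i , i∈ , refl = m≤m+n s i , +-monoʳ-< s (∈-upTo⁻ i∈)

range-unique : ∀ r → Unique (range r)
range-unique (s , l) = Unique.map⁺ (+-cancelˡ-≡ s _ _) (Unique.upTo⁺ l)

length-range : ∀ r → length (range r) ≡ proj₂ r
length-range (s , l) = trans (List.length-map (s +_) (upTo l)) (List.length-upTo l)

points-∷ : ∀ r (box : Box {m}) → points (r ∷ box) ≡ List.cartesianProductWith _∷_ (range r) (points box)
points-∷ r box = go (range r)
  where
  go : ∀ xs → concatMap (λ i → map (i ∷_) (points box)) xs ≡ List.cartesianProductWith _∷_ xs (points box)
  go []       = refl
  go (x ∷ xs) = cong (map (x ∷_) (points box) ++_) (go xs)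

∈-points⁺ : ∀ {p : Index m} {box} → InBox p box → p ∈ points box
∈-points⁺ {p = []}    {[]}      p∈ = here refl
∈-points⁺ {p = x ∷ p} {r ∷ box} p∈ = subst ((x ∷ p) ∈_) (sym (points-∷ r box))
  (∈-cartesianProductWith⁺ _∷_ (∈-range⁺ (coord p∈ zero)) (∈-points⁺ {box = box} (inBox (coord p∈ ∘ suc))))

∈-points⁻ : ∀ {p : Index m} {box} → p ∈ points box → InBox p box
∈-points⁻ {p = []}    {[]}      p∈ = inBox λ ()
∈-points⁻ {p = x ∷ p} {r ∷ box} p∈
  with ∈-cartesianProductWith⁻ _∷_ (range r) (points box) (subst ((x ∷ p) ∈_) (points-∷ r box) p∈)
... | _ , _ , x∈ , p∈′ , refl = inBox λ where
  zero    → ∈-range⁻ x∈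
  (suc i) → coord (∈-points⁻ {box = box} p∈′) i

points-unique : ∀ (box : Box {m}) → Unique (points box)
points-unique []        = [] ∷ []
points-unique (r ∷ box) = subst Unique (sym (points-∷ r box))
  (Unique.cartesianProductWith⁺ _∷_ (λ where refl → refl , refl) (range-unique r) (points-unique box))

length-points : ∀ (box : Box {m}) → length (points box) ≡ product (lengths box)
length-points []        = refl
length-points (r ∷ box) = begin
  length (points (r ∷ box))                                      ≡⟨ cong length (points-∷ r box) ⟩
  length (List.cartesianProductWith _∷_ (range r) (points box))  ≡⟨ length-cartesianProductWith (range r) ⟩
  length (range r) * length (points box)                         ≡⟨ cong₂ _*_ (length-range r) (length-points box) ⟩
  proj₂ r * product (lengths box)                                ∎
  where
  open ≡-Reasoning

  length-cartesianProductWith : ∀ xs →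
    length (List.cartesianProductWith _∷_ xs (points box)) ≡ length xs * length (points box)
  length-cartesianProductWith []       = refl
  length-cartesianProductWith (x ∷ xs) = trans (List.length-++ (map (x ∷_) (points box)))
    (cong₂ _+_ (List.length-map (x ∷_) (points box)) (length-cartesianProductWith xs))

product-halves : ∀ (box : Box {m}) i →
  product (lengths (lowerHalf i box)) + product (lengths (upperHalf i box)) ≡ product (lengths box)
product-halves box i = trans
  (cong₂ _+_ (cong product (lengths-lowerHalf box i)) (cong product (lengths-upperHalf box i)))
  (product-updateAt-+ ⌊n/2⌋+⌈n/2⌉≡n (lengths box) i)

module _ {m} {f : Fin m → ℕ → ℚ} {small : Vec ℕ m → Bool} where

  ∈-Division⁺ : ∀ {box t p} → Division f small box t → InBox p box → p ∈ t
  ∈-Division⁺ (stop _) p∈ = ∈-points⁺ p∈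
  ∈-Division⁺ (halve {t₁ = t₁} i _ D₁ D₂) p∈ with InBox-halves {i = i} p∈
  ... | inj₁ p∈₁ = ∈-++⁺ˡ (∈-Division⁺ D₁ p∈₁)
  ... | inj₂ p∈₂ = ∈-++⁺ʳ t₁ (∈-Division⁺ D₂ p∈₂)

  ∈-Division⁻ : ∀ {box t p} → Division f small box t → p ∈ t → InBox p box
  ∈-Division⁻ (stop _) p∈ = ∈-points⁻ p∈
  ∈-Division⁻ (halve {t₁ = t₁} i _ D₁ D₂) p∈ with ∈-++⁻ t₁ p∈
  ... | inj₁ p∈₁ = InBox-lowerHalf⁻ {i = i} (∈-Division⁻ D₁ p∈₁)
  ... | inj₂ p∈₂ = InBox-upperHalf⁻ {i = i} (∈-Division⁻ D₂ p∈₂)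

  Division-unique : ∀ {box t} → Division f small box t → Unique t
  Division-unique (stop {box} _) = points-unique box
  Division-unique (halve {box} i _ D₁ D₂) = Unique.++⁺ (Division-unique D₁) (Division-unique D₂)
    (λ (p∈₁ , p∈₂) → halves-disjoint {box = box} {i = i} (∈-Division⁻ D₁ p∈₁) (∈-Division⁻ D₂ p∈₂))

  length-Division : ∀ {box t} → Division f small box t → length t ≡ product (lengths box)
  length-Division (stop {box} _) = length-points box
  length-Division (halve {box} {t₁} i _ D₁ D₂) = trans (List.length-++ t₁)
    (trans (cong₂ _+_ (length-Division D₁) (length-Division D₂)) (product-halves box i))

module _ {d : ℕ} where

  open Grid d using (position)

  position-++ˡ : ∀ {e} L {R} → e ∈ L → position e (L ++ R) ≡ position e L
  position-++ˡ {e} (x ∷ L) e∈ with Vec.≡-dec _≟_ e x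
  position-++ˡ {e} (x ∷ L) e∈           | yes _  = refl
  position-++ˡ {e} (x ∷ L) (here e≡x)   | no e≢x = contradiction e≡x e≢x
  position-++ˡ {e} (x ∷ L) (there e∈L)  | no _   = cong suc (position-++ˡ L e∈L)

  position-++ʳ : ∀ {e} P {R} → e ∉ P → position e (P ++ R) ≡ length P + position e R
  position-++ʳ {e} []      e∉ = refl
  position-++ʳ {e} (x ∷ P) e∉ with Vec.≡-dec _≟_ e x
  ... | yes e≡x = contradiction (here e≡x) e∉
  ... | no  _   = cong suc (position-++ʳ P (e∉ ∘ there))

  position-< : ∀ {e} L → e ∈ L → position e L < length L
  position-< {e} (x ∷ L) e∈ with Vec.≡-dec _≟_ e x
  position-< {e} (x ∷ L) e∈          | yes _  = s≤s z≤n
  position-< {e} (x ∷ L) (here e≡x)  | no e≢x = contradiction e≡x e≢x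
  position-< {e} (x ∷ L) (there e∈L) | no _   = s≤s (position-< L e∈L)

  position-surjective : ∀ {i} L → Unique L → i < length L → ∃ λ e → e ∈ L × position e L ≡ i
  position-surjective {zero}  (x ∷ L) _ _ = x , here refl , position-x
    where
    position-x : position x (x ∷ L) ≡ 0
    position-x with Vec.≡-dec _≟_ x x
    ... | yes _  = refl
    ... | no x≢x = contradiction refl x≢x
  position-surjective {suc i} (x ∷ L) (x∉ ∷ L!) (s≤s i<) with position-surjective L L! i<
  ... | e , e∈ , eq = e , there e∈ , position-e
    where
    position-e : position e (x ∷ L) ≡ suc i
    position-e with Vec.≡-dec _≟_ e x
    ... | yes refl = contradiction refl (All.lookup x∉ e∈)
    ... | no  _    = cong suc eq

-- Correctness

module _ (d : ℕ) where

  open Grid d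

  contributes? : (e : Index d) → Decidable (λ p → e ≡ removeAt p out)
  contributes? e p = Vec.≡-dec _≟_ e (removeAt p out)

  entriesOf : Index d → List Cell → List Cell
  entriesOf e = filter (contributes? e)

entriesOf-map-∷ : ∀ {d} x (e : Index d) ps → entriesOf (suc d) (x ∷ e) (map (x ∷_) ps) ≡ map (x ∷_) (entriesOf d e ps)
entriesOf-map-∷ x e []             = refl
entriesOf-map-∷ {d} x e (p@(_ ∷ _) ∷ ps) = case contributes? d e p of λ where
    (yes e≡) → trans (List.filter-accept P′? {x = x ∷ p} {xs = map (x ∷_) ps} (cong (x ∷_) e≡))
      (trans (cong ((x ∷ p) ∷_) (entriesOf-map-∷ x e ps)) (cong (map (x ∷_)) (sym (List.filter-accept P? {x = p} {xs = ps} e≡))))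
    (no e≢)  → trans (List.filter-reject P′? {x = x ∷ p} {xs = map (x ∷_) ps} (e≢ ∘ Vec.∷-injectiveʳ))
      (trans (entriesOf-map-∷ x e ps) (cong (map (x ∷_)) (sym (List.filter-reject P? {x = p} {xs = ps} e≢))))
  where
  P? = contributes? d e
  P′? = contributes? (suc d) (x ∷ e)

entriesOf-map-∷-≢ : ∀ {d} {x y} (e : Index d) ps → x ≢ y → entriesOf (suc d) (x ∷ e) (map (y ∷_) ps) ≡ []
entriesOf-map-∷-≢ {d} {x} {y} e ps x≢y =
  List.filter-none (contributes? (suc d) (x ∷ e)) (All.map⁺ (All.tabulate {xs = ps} λ {p} _ → tails p))
  where
  tails : ∀ p → x ∷ e ≢ removeAt (y ∷ p) (fromℕ (suc d))
  tails (z ∷ zs) = x≢y ∘ Vec.∷-injectiveˡ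

-- Induction on the dimension: of the slices with constant first coordinate exactly one agrees with
-- the first coordinate of the entry, because a range has no repetitions.
entriesOf-points : ∀ {d} (e : Index d) box → InBox e (removeAt box (fromℕ d)) →
  entriesOf d e (points box) ≡ map (e ∷ʳ_) (range (lookup box (fromℕ d)))
entriesOf-points {zero} [] (r ∷ []) _ = trans (List.filter-all (contributes? 0 []) {xs = points (r ∷ [])} (All.tabulate λ {p} _ → empty p)) (singletons (range r))
  where
  empty : ∀ (p : Index 1) → [] ≡ removeAt p zero
  empty (x ∷ []) = refl

  singletons : ∀ xs → concatMap (λ i → map (i ∷_) ([] ∷ [])) xs ≡ map ([] ∷ʳ_) xs
  singletons []       = refl
  singletons (x ∷ xs) = cong ((x ∷ []) ∷_) (singletons xs)
entriesOf-points {suc d} (x ∷ e) (r ∷ box@(_ ∷ _)) e∈ = go (range r) (range-unique r) (∈-range⁺ (coord e∈ zero))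
  where
  R = range (lookup box (fromℕ d))
  slices : List ℕ → List (Index (2 + d))
  slices = concatMap (λ i → map (i ∷_) (points box))

  slice : entriesOf (suc d) (x ∷ e) (map (x ∷_) (points box)) ≡ map ((x ∷ e) ∷ʳ_) R
  slice = begin
    entriesOf (suc d) (x ∷ e) (map (x ∷_) (points box))  ≡⟨ entriesOf-map-∷ x e (points box) ⟩
    map (x ∷_) (entriesOf d e (points box))
      ≡⟨ cong (map (x ∷_)) (entriesOf-points e box (inBox (coord e∈ ∘ suc))) ⟩
    map (x ∷_) (map (e ∷ʳ_) R)                           ≡⟨ List.map-∘ R ⟨
    map ((x ∷ e) ∷ʳ_) R                                  ∎
    where
    open ≡-Reasoning

  none : ∀ ys → x ∉ ys → entriesOf (suc d) (x ∷ e) (slices ys) ≡ []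
  none []       x∉ = refl
  none (y ∷ ys) x∉ = trans (List.filter-++ (contributes? (suc d) (x ∷ e)) (map (y ∷_) (points box)) (slices ys))
    (cong₂ _++_ (entriesOf-map-∷-≢ e (points box) (x∉ ∘ here)) (none ys (x∉ ∘ there)))

  go : ∀ ys → Unique ys → x ∈ ys → entriesOf (suc d) (x ∷ e) (slices ys) ≡ map ((x ∷ e) ∷ʳ_) R
  go (y ∷ ys) (y∉ ∷ ys!) x∈ = trans (List.filter-++ (contributes? (suc d) (x ∷ e)) (map (y ∷_) (points box)) (slices ys)) (case x∈ of λ where
    (here refl) → trans (cong₂ _++_ slice (none ys (λ x∈ys → All.lookup y∉ x∈ys refl))) (List.++-identityʳ _)
    (there x∈ys) → cong₂ _++_ (entriesOf-map-∷-≢ e (points box) (λ where refl → All.lookup y∉ x∈ys refl)) (go ys ys! x∈ys))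

applyUpTo-+ : ∀ (f : ℕ → ℕ) a b → applyUpTo f (a + b) ≡ applyUpTo f a ++ applyUpTo (λ x → f (a + x)) b
applyUpTo-+ f zero    b = refl
applyUpTo-+ f (suc a) b = cong (f 0 ∷_) (applyUpTo-+ (f ∘ suc) a b)

range-++ : ∀ s a b → range (s , a) ++ range (s + a , b) ≡ range (s , a + b)
range-++ s a b = begin
  map (s +_) (upTo a) ++ map (s + a +_) (upTo b)
    ≡⟨ cong₂ _++_ (List.map-upTo (s +_) a) (List.map-upTo (s + a +_) b) ⟩
  applyUpTo (s +_) a ++ applyUpTo (s + a +_) b
    ≡⟨ cong (applyUpTo (s +_) a ++_) (trans (sym (List.map-upTo (s + a +_) b)) (trans (List.map-cong (+-assoc s a) (upTo b)) (List.map-upTo (λ x → s + (a + x)) b))) ⟩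
  applyUpTo (s +_) a ++ applyUpTo (λ x → s + (a + x)) b          ≡⟨ applyUpTo-+ (s +_) a b ⟨
  applyUpTo (s +_) (a + b)                                       ≡⟨ List.map-upTo (s +_) (a + b) ⟨
  map (s +_) (upTo (a + b))                                      ∎
  where
  open ≡-Reasoning

removeAt-lowerHalf-punchIn : ∀ (box : Box {suc m}) j i → removeAt (lowerHalf (punchIn j i) box) j ≡ lowerHalf i (removeAt box j)
removeAt-lowerHalf-punchIn box j i = removeAt-updateAt-punchIn box j i

removeAt-upperHalf-punchIn : ∀ (box : Box {suc m}) j i → removeAt (upperHalf (punchIn j i) box) j ≡ upperHalf i (removeAt box j)
removeAt-upperHalf-punchIn box j i = removeAt-updateAt-punchIn box j i

module _ {d : ℕ} where

  open Grid d

  module _ {f : Fin k → ℕ → ℚ} {small : Vec ℕ k → Bool} (e : Index d) where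

    entriesOf-outside : ∀ {box t} → Division f small box t → ¬ InBox e (removeAt box out) → entriesOf d e t ≡ []
    entriesOf-outside {box} D e∉ = List.filter-none (contributes? d e) (All.tabulate λ p∈ e≡ →
      e∉ (subst (λ e → InBox e (removeAt box out)) (sym e≡) (InBox-removeAt out (∈-Division⁻ D p∈))))

    -- Commutativity of the accumulation is not assumed, so the cells of an entry must come in
    -- increasing last coordinate. Halving the last dimension concatenates two adjacent ranges in
    -- that order; any other halving leaves all these cells in one half.
    entriesOf-Division : ∀ {box t} → Division f small box t → InBox e (removeAt box out) →
      entriesOf d e t ≡ map (e ∷ʳ_) (range (lookup box out))
    entriesOf-Division (stop {box} _) e∈ = entriesOf-points e box e∈
    entriesOf-Division (halve {box} {t₁} {t₂} i _ D₁ D₂) e∈ with out Fin.≟ i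
    ... | yes refl = begin
      entriesOf d e (t₁ ++ t₂)
        ≡⟨ List.filter-++ (contributes? d e) t₁ t₂ ⟩
      entriesOf d e t₁ ++ entriesOf d e t₂                                              ≡⟨ cong₂ _++_
        (entriesOf-Division D₁ (subst (InBox e) (sym (removeAt-updateAt box out)) e∈))
        (entriesOf-Division D₂ (subst (InBox e) (sym (removeAt-updateAt box out)) e∈)) ⟩
      map (e ∷ʳ_) (range (lookup (lowerHalf out box) out)) ++ map (e ∷ʳ_) (range (lookup (upperHalf out box) out))
        ≡⟨ List.map-++ (e ∷ʳ_) (range (lookup (lowerHalf out box) out)) _ ⟨
      map (e ∷ʳ_) (range (lookup (lowerHalf out box) out) ++ range (lookup (upperHalf out box) out))
        ≡⟨ cong (map (e ∷ʳ_)) (cong₂ (λ x y → range x ++ range y) (Vec.lookup∘updateAt out box) (Vec.lookup∘updateAt out box)) ⟩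
      map (e ∷ʳ_) (range (s , ⌊ l /2⌋) ++ range (s + ⌊ l /2⌋ , ⌈ l /2⌉))
        ≡⟨ cong (map (e ∷ʳ_)) (range-++ s ⌊ l /2⌋ ⌈ l /2⌉) ⟩
      map (e ∷ʳ_) (range (s , ⌊ l /2⌋ + ⌈ l /2⌉))
        ≡⟨ cong (λ l → map (e ∷ʳ_) (range (s , l))) (⌊n/2⌋+⌈n/2⌉≡n l) ⟩
      map (e ∷ʳ_) (range (lookup box out))                                              ∎
      where
      open ≡-Reasoning
      s = proj₁ (lookup box out)
      l = proj₂ (lookup box out)
    ... | no out≢i = begin
      entriesOf d e (t₁ ++ t₂)              ≡⟨ List.filter-++ (contributes? d e) t₁ t₂ ⟩
      entriesOf d e t₁ ++ entriesOf d e t₂  ≡⟨ one (InBox-halves {i = i′} e∈) ⟩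
      map (e ∷ʳ_) (range (lookup box out))  ∎
      where
      open ≡-Reasoning
      i′ = punchOut out≢i
      lower : removeAt (lowerHalf i box) out ≡ lowerHalf i′ (removeAt box out)
      lower = trans (cong (λ i → removeAt (lowerHalf i box) out) (sym (Fin.punchIn-punchOut out≢i))) (removeAt-lowerHalf-punchIn box out i′)
      upper : removeAt (upperHalf i box) out ≡ upperHalf i′ (removeAt box out)
      upper = trans (cong (λ i → removeAt (upperHalf i box) out) (sym (Fin.punchIn-punchOut out≢i))) (removeAt-upperHalf-punchIn box out i′)

      one : InBox e (lowerHalf i′ (removeAt box out)) ⊎ InBox e (upperHalf i′ (removeAt box out)) →
            entriesOf d e t₁ ++ entriesOf d e t₂ ≡ map (e ∷ʳ_) (range (lookup box out))
      one (inj₁ e∈₁) = trans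
        (cong₂ _++_ (entriesOf-Division D₁ (subst (InBox e) (sym lower) e∈₁))
          (entriesOf-outside D₂ (halves-disjoint {i = i′} e∈₁ ∘ subst (InBox e) upper)))
        (trans (List.++-identityʳ _) (cong (λ r → map (e ∷ʳ_) (range r)) (Vec.lookup∘updateAt′ out i out≢i box)))
      one (inj₂ e∈₂) = trans
        (cong₂ _++_ (entriesOf-outside D₁ (λ e∈₁ → halves-disjoint {i = i′} (subst (InBox e) lower e∈₁) e∈₂))
          (entriesOf-Division D₂ (subst (InBox e) (sym upper) e∈₂)))
        (cong (λ r → map (e ∷ʳ_) (range r)) (Vec.lookup∘updateAt′ out i out≢i box))

  asymAlg-Division : ∀ ω b ns → Positive ns → Division (priority ω) (smallArrays b) (wholeBox ns) (asymAlg ω b ns)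
  asymAlg-Division ω b ns ns-pos = divide-Division (priority ω) (smallArrays b) (wholeBox ns)
    (subst Positive (sym (lengths-wholeBox ns)) ns-pos)

  asymAlg-computesGrid : ∀ a c ℓ ω b ns → Positive ns → ComputesGrid a c ℓ ns (asymAlg ω b ns)
  asymAlg-computesGrid a c ℓ ω b ns ns-pos S A g I O e e<ns = reflexive (begin
    execute t O e                                            ≡⟨ execute-entriesOf t O ⟩
    foldl _⊕_ (O e) (entriesOf d e t)
      ≡⟨ cong (foldl _⊕_ (O e)) (entriesOf-Division e (asymAlg-Division ω b ns ns-pos) e∈) ⟩
    foldl _⊕_ (O e) (map (e ∷ʳ_) (range (lookup (wholeBox ns) out)))
      ≡⟨ cong (λ r → foldl _⊕_ (O e) (map (e ∷ʳ_) (range r))) (Vec.lookup-map out (0 ,_) ns) ⟩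
    foldl _⊕_ (O e) (map (e ∷ʳ_) (map id (upTo (lookup ns out))))
      ≡⟨ cong (foldl _⊕_ (O e) ∘ map (e ∷ʳ_)) (List.map-id (upTo (lookup ns out))) ⟩
    foldl _⊕_ (O e) (map (e ∷ʳ_) (upTo (lookup ns out)))     ≡⟨ List.foldl-map _⊕_ (e ∷ʳ_) (O e) (upTo (lookup ns out)) ⟩
    foldl (λ acc i → acc ∙ value (e ∷ʳ i)) (O e) (upTo (lookup ns out)) ∎)
    where
    open ≡-Reasoning
    open Semigroup S using (Carrier; _∙_; reflexive)
    open Semantics S A g I
    t = asymAlg ω b ns
    _⊕_ : Carrier → Cell → Carrier
    acc ⊕ p = acc ∙ value p

    execute-entriesOf : ∀ t O → execute t O e ≡ foldl _⊕_ (O e) (entriesOf d e t)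
    execute-entriesOf []      O = refl
    execute-entriesOf (p ∷ t) O rewrite execute-entriesOf t (step O p) with Vec.≡-dec _≟_ e (removeAt p out)
    ... | yes _ = refl
    ... | no  _ = refl

    e∈ : InBox e (removeAt (wholeBox ns) out)
    e∈ .coord i = subst (InRange (lookup e i)) (sym eq) (z≤n , subst (λ j → lookup e i < lookup ns j) inject₁≡ (e<ns i))
      where
      punchIn-fromℕ : ∀ {d} (i : Fin d) → inject₁ i ≡ punchIn (fromℕ d) i
      punchIn-fromℕ zero    = refl
      punchIn-fromℕ (suc i) = cong suc (punchIn-fromℕ i)
      inject₁≡ = punchIn-fromℕ i
      eq : lookup (removeAt (wholeBox ns) out) i ≡ (0 , lookup ns (punchIn out i))
      eq = trans (lookup-removeAt (wholeBox ns) out i) (Vec.lookup-map (punchIn out i) (0 ,_) ns)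

-- Cache lines of stored subarrays

-- The blocks of B entries that meet the interval of positions [s , s + w].
module Blocks (B s w : ℕ) .{{_ : NonZero B}} where

  private
    first = s / B
    last  = (s + w) / B

    first≤last : first ≤ last
    first≤last = /-monoˡ-≤ B (m≤m+n s w)

    first+[last∸first] : first + (last ∸ first) ≡ last
    first+[last∸first] = m+[n∸m]≡n first≤last

    <[1+/]* : ∀ x → x < suc (x / B) * B
    <[1+/]* x = begin-strict
      x                    ≡⟨ m≡m%n+[m/n]*n x B ⟩
      x % B + x / B * B    <⟨ +-monoˡ-< (x / B * B) (m%n<n x B) ⟩
      suc (x / B) * B      ∎
      where
      open ≤-Reasoning

  count : ℕ
  count = suc (last ∸ first)

  block-bounded : ∀ x → s ≤ x → x < s + suc w → ∃ λ i → i < count × x / B ≡ first + i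
  block-bounded x s≤x x<s+1+w = x / B ∸ first , s≤s (∸-monoˡ-≤ first x/B≤last) , sym (m+[n∸m]≡n (/-monoˡ-≤ B s≤x))
    where
    x/B≤last : x / B ≤ last
    x/B≤last = /-monoˡ-≤ B (m<1+n⇒m≤n (<-≤-trans x<s+1+w (≤-reflexive (+-suc s w))))

  block-hit : ∀ i → i < count → ∃ λ x → x < suc w × (s + x) / B ≡ first + i
  block-hit zero    _ = 0 , s≤s z≤n , trans (cong (_/ B) (+-identityʳ s)) (sym (+-identityʳ first))
  -- Every block after the first begins inside the interval, so its first position `y` is a witness.
  block-hit (suc i) (s≤s i<) = x , s≤s x≤w , trans (cong (_/ B) s+x≡) (m*n/n≡m (first + suc i) B)
    where
    open ≤-Reasoning
    y = (first + suc i) * B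
    x = y ∸ s
    s≤y : s ≤ y
    s≤y = <⇒≤ (<-≤-trans (<[1+/]* s) (*-monoˡ-≤ B (≤-trans (s≤s (m≤m+n first i)) (≤-reflexive (sym (+-suc first i))))))
    s+x≡ : s + x ≡ y
    s+x≡ = m+[n∸m]≡n s≤y
    x≤w : x ≤ w
    x≤w = m≤n+o⇒m∸n≤o y s (begin
      (first + suc i) * B  ≤⟨ *-monoˡ-≤ B (≤-trans (+-monoʳ-≤ first i<) (≤-reflexive first+[last∸first])) ⟩
      last * B             ≤⟨ m/n*n≤m (s + w) B ⟩
      s + w                ∎)

  width≤count*B : suc w ≤ count * B
  width≤count*B = +-cancelˡ-≤ s _ _ (begin
    s + suc w                   ≡⟨ +-suc s w ⟩
    suc (s + w)                 ≤⟨ <[1+/]* (s + w) ⟩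
    suc last * B                ≡⟨ cong (λ x → suc x * B) first+[last∸first] ⟨
    suc (first + (last ∸ first)) * B ≡⟨ cong (_* B) (+-suc first (last ∸ first)) ⟨
    (first + count) * B         ≡⟨ *-distribʳ-+ B first count ⟩
    first * B + count * B       ≤⟨ +-monoˡ-≤ (count * B) (m/n*n≤m s B) ⟩
    s + count * B               ∎)
    where
    open ≤-Reasoning

  -- Only the two blocks at the ends can stick out of the interval.
  count*B≤width+2B : count * B ≤ suc w + 2 * B
  count*B≤width+2B = +-cancelˡ-≤ (first * B) _ _ (begin
    first * B + count * B            ≡⟨ *-distribʳ-+ B first count ⟨
    (first + count) * B              ≡⟨ cong (_* B) (+-suc first (last ∸ first)) ⟩
    suc (first + (last ∸ first)) * B ≡⟨ cong (λ x → suc x * B) first+[last∸first] ⟩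
    B + last * B                     ≤⟨ +-monoʳ-≤ B (m/n*n≤m (s + w) B) ⟩
    B + (s + w)                      ≤⟨ +-monoʳ-≤ B (+-monoˡ-≤ w (<⇒≤ (<[1+/]* s))) ⟩
    B + (B + first * B + w)
      ≡⟨ solve 3 (λ b f w → b :+ (b :+ f :+ w) := f :+ (w :+ (b :+ (b :+ con 0)))) refl B (first * B) w ⟩
    first * B + (w + 2 * B)          ≤⟨ +-monoʳ-≤ (first * B) (n≤1+n _) ⟩
    first * B + (suc w + 2 * B)      ∎)
    where
    open ≤-Reasoning
    open +-*-Solver

module Layout (d′ : ℕ) where

  private d = suc d′
  open Grid d

  module _ (ω : ℚ) (ns : Vec ℕ k) where

    arrayPriority : Fin k → Fin d → ℕ → ℚ
    arrayPriority j i = priority ω (punchIn j i)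

    -- Contiguity of a subarray. Its division is kept along with it, since the halves of the
    -- subarray are found one level further down in this tree.
    record Stored (j : Fin k) (sub : Box {d}) : Set where
      constructor stored
      field
        before entries after : List (Index d)
        infix≡  : layout ω ns j ≡ before ++ entries ++ after
        divided : Division (arrayPriority j) (λ _ → false) sub entries

  module _ {ω : ℚ} {ns : Vec ℕ k} where

    open Stored

    layout-Division : Positive ns → ∀ j →
      Division (arrayPriority ω ns j) (λ _ → false) (wholeBox (removeAt ns j)) (layout ω ns j)
    layout-Division ns-pos j = divide-Division (arrayPriority ω ns j) (λ _ → false) (wholeBox (removeAt ns j)) λ i →
      subst (1 ≤_) (sym (length-at i)) (ns-pos (punchIn j i))
      where
      length-at : ∀ i → lookup (lengths (wholeBox (removeAt ns j))) i ≡ lookup ns (punchIn j i)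
      length-at i = trans (Vec.lookup-map i proj₂ (wholeBox (removeAt ns j)))
        (trans (cong proj₂ (Vec.lookup-map i (0 ,_) (removeAt ns j))) (lookup-removeAt ns j i))

    stored-whole : Positive ns → ∀ j → Stored ω ns j (removeAt (wholeBox ns) j)
    stored-whole ns-pos j = subst (Stored ω ns j) (map-removeAt (0 ,_) ns j)
      (stored [] (layout ω ns j) [] (sym (List.++-identityʳ _)) (layout-Division ns-pos j))

    -- If the array lacks the halved dimension, both halves of the box use the same subarray.
    -- Otherwise the layout divides the subarray along the same dimension, and its halves are
    -- neighbouring infixes.
    stored-halves : ∀ {box i} → splitDimension (priority ω) (lengths box) ≡ just i → ∀ j → Stored ω ns j (removeAt box j) →
      Stored ω ns j (removeAt (lowerHalf i box) j) × Stored ω ns j (removeAt (upperHalf i box) j)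
    stored-halves {box} {i} split≡ j st with j Fin.≟ i
    ... | yes refl = subst (Stored ω ns j) (sym (removeAt-updateAt box j)) st
                   , subst (Stored ω ns j) (sym (removeAt-updateAt box j)) st
    ... | no j≢i = subst (λ i → Stored ω ns j (removeAt (lowerHalf i box) j) × Stored ω ns j (removeAt (upperHalf i box) j))
        (Fin.punchIn-punchOut j≢i)
        (subst₂ (λ x y → Stored ω ns j x × Stored ω ns j y)
          (sym (removeAt-lowerHalf-punchIn box j i′)) (sym (removeAt-upperHalf-punchIn box j i′))
          (halves {before st} {entries st} {after st} (infix≡ st) (divided st)))
      where
      i′ = punchOut j≢i

      sub-split≡ : splitDimension (arrayPriority ω ns j) (lengths (removeAt box j)) ≡ just i′
      sub-split≡ = trans (cong (splitDimension (arrayPriority ω ns j)) (map-removeAt proj₂ box j))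
        (splitDimension-removeAt (priority ω) (lengths box) j (trans split≡ (cong just (sym (Fin.punchIn-punchOut j≢i)))))

      halves : ∀ {before L after} → layout ω ns j ≡ before ++ L ++ after →
        Division (arrayPriority ω ns j) (λ _ → false) (removeAt box j) L →
        Stored ω ns j (lowerHalf i′ (removeAt box j)) × Stored ω ns j (upperHalf i′ (removeAt box j))
      -- The layout never counts a box as small, so stopping could only mean that no dimension can
      -- be halved; but `i′` can.
      halves eq (stop (inj₂ none≡)) = contradiction (trans (sym none≡) sub-split≡) λ ()
      halves {before} {_} {after} eq (halve {t₁ = t₁} {t₂} i″ some≡ D₁ D₂)
        with refl ← just-injective (trans (sym some≡) sub-split≡) =
        stored before t₁ (t₂ ++ after) eq′ D₁ ,
        stored (before ++ t₁) t₂ after (trans eq′ (sym (List.++-assoc before t₁ (t₂ ++ after)))) D₂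
        where
        eq′ : layout ω ns j ≡ before ++ t₁ ++ t₂ ++ after
        eq′ = trans eq (cong (before ++_) (List.++-assoc t₁ t₂ after))

    layout-unique : Positive ns → ∀ j → Unique (layout ω ns j)
    layout-unique ns-pos j = Division-unique (layout-Division ns-pos j)

    module _ (ns-pos : Positive ns) {j : Fin k} {sub : Box {d}} (st : Stored ω ns j sub) where

      start : ℕ
      start = length (before st)

      private
        size≡ : length (entries st) ≡ product (lengths sub)
        size≡ = length-Division (divided st)

        position-entry : ∀ {e} → e ∈ entries st → position e (layout ω ns j) ≡ start + position e (entries st)
        position-entry {e} e∈ = begin
          position e (layout ω ns j)                           ≡⟨ cong (position e) (infix≡ st) ⟩
          position e (before st ++ entries st ++ after st)     ≡⟨ position-++ʳ (before st) e∉before ⟩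
          start + position e (entries st ++ after st)          ≡⟨ cong (start +_) (position-++ˡ (entries st) e∈) ⟩
          start + position e (entries st)                      ∎
          where
          open ≡-Reasoning
          -- `position` finds the first occurrence, which must not lie in front of the subarray.
          e∉before : e ∉ before st
          e∉before e∈b = disjoint (before st) (subst Unique (infix≡ st) (layout-unique ns-pos j)) e∈b (∈-++⁺ˡ e∈)
            where
            disjoint : ∀ xs {ys} → Unique (xs ++ ys) → e ∈ xs → e ∉ ys
            disjoint (x ∷ xs) (x∉ ∷ xs!) (here refl) e∈ys = All.lookup x∉ (∈-++⁺ʳ xs e∈ys) refl
            disjoint (x ∷ xs) (_ ∷ xs!)  (there e∈xs) e∈ys = disjoint xs xs! e∈xs e∈ys

      position-bounded : ∀ {e} → InBox e sub → start ≤ position e (layout ω ns j) ×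
        position e (layout ω ns j) < start + product (lengths sub)
      position-bounded {e} e∈ =
        subst (start ≤_) (sym pos≡) (m≤m+n start _) ,
        subst₂ _<_ (sym pos≡) (cong (start +_) size≡) (+-monoʳ-< start (position-< (entries st) e∈entries))
        where
        e∈entries = ∈-Division⁺ (divided st) e∈
        pos≡ = position-entry e∈entries

      position-hit : ∀ x → x < product (lengths sub) → ∃ λ e → InBox e sub × position e (layout ω ns j) ≡ start + x
      position-hit x x< with position-surjective (entries st) (Division-unique (divided st)) (subst (x <_) (sym size≡) x<)
      ... | e , e∈ , eq = e , ∈-Division⁻ (divided st) e∈ , trans (position-entry e∈) (cong (start +_) eq)

  module Lines {ω : ℚ} {ns : Vec ℕ k} (ns-pos : Positive ns) (B : ℕ) .{{_ : NonZero B}} (capacity : ℕ)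
               {box : Box {k}} (box-pos : Positive (lengths box)) (j : Fin k) (st : Stored ω ns j (removeAt box j)) where

    open Machine ω ns B capacity using (line)

    size : ℕ
    size = product (removeAt (lengths box) j)

    private
      size≡ : size ≡ product (lengths (removeAt box j))
      size≡ = cong product (sym (map-removeAt proj₂ box j))

      size-pos : 1 ≤ size
      size-pos = product-pos (removeAt (lengths box) j) λ i → subst (1 ≤_) (sym (lookup-removeAt (lengths box) j i)) (box-pos (punchIn j i))

      1+pred≡ : suc (pred size) ≡ size
      1+pred≡ = suc-pred size {{>-nonZero size-pos}}

      module Bl = Blocks B (start ns-pos st) (pred size)

    lines : List Line
    lines = map (λ i → j , start ns-pos st / B + i) (upTo Bl.count)

    lines-unique : Unique lines
    lines-unique = Unique.map⁺ (λ eq → +-cancelˡ-≡ (start ns-pos st / B) _ _ (cong proj₂ eq)) (Unique.upTo⁺ Bl.count)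

    ∈-lines⇒array : ∀ {x} → x ∈ lines → proj₁ x ≡ j
    ∈-lines⇒array x∈ with ∈-map⁻ _ x∈
    ... | _ , _ , refl = refl

    line∈lines : ∀ {p} → InBox p box → line j p ∈ lines
    line∈lines {p} p∈ with position-bounded ns-pos st (InBox-removeAt j p∈)
    ... | start≤ , <start+ with Bl.block-bounded _ start≤ (<-≤-trans <start+ (≤-reflexive (cong (start ns-pos st +_) (trans (sym size≡) (sym 1+pred≡)))))
    ... | i , i< , eq = subst (_∈ lines) (cong (j ,_) (sym eq)) (∈-map⁺ _ (∈-upTo⁺ i<))

    -- Needed for the lower bound: none of the counted lines is idle while the box is processed. The
    -- missing coordinate j of the cell may be any in range; the first one, `s`, is taken.
    lines-hit : ∀ {x} → x ∈ lines → ∃ λ p → InBox p box × line j p ≡ x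
    lines-hit x∈ with ∈-map⁻ _ x∈
    ... | i , i∈ , refl with Bl.block-hit i (∈-upTo⁻ i∈)
    ... | y , y< , eq with position-hit ns-pos st y (<-≤-trans y< (≤-reflexive (trans 1+pred≡ size≡)))
    ... | e , e∈ , pos≡ = insertAt e j s , InBox-insertAt j e∈ (≤-refl , m<m+n s l-pos) ,
      cong (j ,_) (trans (cong (λ e → position e (layout ω ns j) / B) (Vec.removeAt-insertAt e j s))
                         (trans (cong (_/ B) pos≡) eq))
      where
      s = proj₁ (lookup box j)
      l-pos : 0 < proj₂ (lookup box j)
      l-pos = subst (1 ≤_) (Vec.lookup-map j proj₂ box) (box-pos j)

    size≤lines*B : size ≤ length lines * B
    size≤lines*B = subst₂ _≤_ 1+pred≡ (cong (_* B) (sym length-lines)) Bl.width≤count*B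
      where length-lines = trans (List.length-map _ (upTo Bl.count)) (List.length-upTo Bl.count)

    lines*B≤size+2B : length lines * B ≤ size + 2 * B
    lines*B≤size+2B = subst₂ _≤_ (cong (_* B) (sym length-lines)) (cong (_+ 2 * B) 1+pred≡) Bl.count*B≤width+2B
      where length-lines = trans (List.length-map _ (upTo Bl.count)) (List.length-upTo Bl.count)

-- Proportions of the boxes

^-cancelˡ-≤ : ∀ {x y} k .{{_ : NonZero k}} → x ^ k ≤ y ^ k → x ≤ y
^-cancelˡ-≤ k xᵏ≤yᵏ = ≮⇒≥ λ y<x → <⇒≱ (^-monoˡ-< k y<x) xᵏ≤yᵏ

m≤m^n : ∀ m n .{{_ : NonZero n}} → m ≤ m ^ n
m≤m^n zero      (suc n) = z≤n
m≤m^n m@(suc _) (suc n) = m≤m*n m (m ^ n) {{m^n≢0 m n}}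

-- For ω = p / q, `weight l` is `priority ω l` multiplied by q^d, and n is the side length of the whole grid.
module Shape (d′ p q n : ℕ) (1≤q : 1 ≤ q) (q≤p : q ≤ p) where

  private d = suc d′
  open Grid d using (k; out)

  factor : Fin k → ℕ
  factor l with l Fin.≟ out
  ... | yes _ = q ^ d
  ... | no  _ = p ^ d

  factor-out : factor out ≡ q ^ d
  factor-out with out Fin.≟ out
  ... | yes _    = refl
  ... | no out≢out = contradiction refl out≢out

  factor-≢ : ∀ {j} → j ≢ out → factor j ≡ p ^ d
  factor-≢ {j} j≢out with j Fin.≟ out
  ... | yes j≡out = contradiction j≡out j≢out
  ... | no  _     = refl

  qᵈ≤pᵈ : q ^ d ≤ p ^ d
  qᵈ≤pᵈ = ^-monoˡ-≤ d q≤p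

  factor≤pᵈ : ∀ l → factor l ≤ p ^ d
  factor≤pᵈ l with l Fin.≟ out
  ... | yes _ = qᵈ≤pᵈ
  ... | no  _ = ≤-refl

  factor≤ : ∀ l {j} → j ≢ out → factor l ≤ factor j
  factor≤ l j≢out = subst (factor l ≤_) (sym (factor-≢ j≢out)) (factor≤pᵈ l)

  1≤qᵈ : 1 ≤ q ^ d
  1≤qᵈ = m^n>0 q {{>-nonZero 1≤q}} d

  weight : Fin k → ℕ → ℕ
  weight l x = x ^ k * factor l

  weight-mono : ∀ l {x y} → x ≤ y → weight l x ≤ weight l y
  weight-mono l x≤y = *-monoˡ-≤ (factor l) (^-monoˡ-≤ k x≤y)

  weight-triple : ∀ l {x y} → x ≤ 3 * y → weight l x ≤ 3 ^ k * weight l y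
  weight-triple l {x} {y} x≤3y = begin
    weight l x                    ≤⟨ weight-mono l x≤3y ⟩
    (3 * y) ^ k * factor l        ≡⟨ cong (_* factor l) (^-distribʳ-* 3 y k) ⟩
    3 ^ k * y ^ k * factor l      ≡⟨ *-assoc (3 ^ k) (y ^ k) (factor l) ⟩
    3 ^ k * weight l y            ∎
    where
    open ≤-Reasoning

  weight≤ : ∀ l {j} → j ≢ out → ∀ x → weight l x ≤ weight j x
  weight≤ l j≢out x = *-monoʳ-≤ (x ^ k) (factor≤ l j≢out)

  weight-triple-≤ : ∀ l x → weight l x ≤ 3 ^ k * weight l x
  weight-triple-≤ l x = weight-triple l {x} {x} (m≤n*m x 3)

  record Splittable (ns : Vec ℕ k) (i : Fin k) : Set where
    field
      2≤  : 2 ≤ lookup ns i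
      max : ∀ l → 2 ≤ lookup ns l → weight l (lookup ns l) ≤ weight i (lookup ns i)

  -- The invariant of the tree. `wide` and `near` hold at the root because `out` has the smallest
  -- factor; they persist because the halved dimension had maximal weight and shrinks at most
  -- threefold. The converse bound in `deep` can fail at the root for large ω. It is gained when the
  -- last dimension is first halved, having then maximal weight; until that moment the length is
  -- `n`. A dimension of length 1 takes no part in that comparison, hence the first alternative.
  record Balanced (ns : Vec ℕ k) : Set where
    field
      positive : Positive ns
      wide     : ∀ l {j} → j ≢ out → weight l (lookup ns l) ≤ 3 ^ k * weight j (lookup ns j)
      near     : ∀ {j} → j ≢ out → ∀ l → lookup ns j ≤ 3 * lookup ns l
      deep     : ∀ {j} → j ≢ out → lookup ns j ≤ 1 ⊎ lookup ns out ≡ n ⊎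
                 weight j (lookup ns j) ≤ 3 ^ k * weight out (lookup ns out)

  size : Fin k → Vec ℕ k → ℕ
  size j ns = product (removeAt ns j)

  balanced-replicate : 1 ≤ n → Balanced (replicate k n)
  balanced-replicate 1≤n = record
    { positive = λ i → subst (1 ≤_) (sym (at i)) 1≤n
    ; wide     = λ l {j} j≢out → subst₂ (λ x y → weight l x ≤ 3 ^ k * weight j y) (sym (at l)) (sym (at j))
                   (≤-trans (weight≤ l j≢out n) (weight-triple-≤ j n))
    ; near     = λ {j} _ l → subst₂ (λ x y → x ≤ 3 * y) (sym (at j)) (sym (at l)) (m≤n*m n 3)
    ; deep     = λ _ → inj₂ (inj₁ (at out))
    }
    where
    at : ∀ i → lookup (replicate k n) i ≡ n
    at i = Vec.lookup-replicate i n

  module _ {ns i} (splittable : Splittable ns i) {h} (halving : Halving h) where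

    open Splittable splittable
    open Halving halving

    private
      ns′ = updateAt ns i h
      x = lookup ns i

      at-i : lookup ns′ i ≡ h x
      at-i = Vec.lookup∘updateAt i ns

      at-≢ : ∀ {l} → l ≢ i → lookup ns′ l ≡ lookup ns l
      at-≢ {l} l≢i = Vec.lookup∘updateAt′ l i l≢i ns

    half-≤ : ∀ l → lookup ns′ l ≤ lookup ns l
    half-≤ l with l Fin.≟ i
    ... | yes refl = subst (_≤ x) (sym at-i) (h≤ 2≤)
    ... | no  l≢i  = ≤-reflexive (at-≢ l≢i)

    ≤3half : ∀ l → lookup ns l ≤ 3 * lookup ns′ l
    ≤3half l with l Fin.≟ i
    ... | yes refl = subst (λ y → x ≤ 3 * y) (sym at-i) (≤3h 2≤)
    ... | no  l≢i  = subst (λ y → lookup ns l ≤ 3 * y) (sym (at-≢ l≢i)) (m≤n*m (lookup ns l) 3)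

    size≤3half : ∀ j → size j ns ≤ 3 * size j ns′
    size≤3half j with j Fin.≟ i
    ... | yes refl = subst (λ y → size j ns ≤ 3 * product y) (sym (removeAt-updateAt ns j)) (m≤n*m (size j ns) 3)
    ... | no  j≢i  = subst (λ i → size j ns ≤ 3 * size j (updateAt ns i h)) (Fin.punchIn-punchOut j≢i)
      (subst (λ y → size j ns ≤ 3 * product y) (sym (removeAt-updateAt-punchIn ns j i′))
        (product-updateAt-≤ {c = 3} (removeAt ns j) i′ (subst (λ x → x ≤ 3 * h x) (sym at-i′) (≤3h 2≤))))
      where
      i′ = punchOut j≢i
      at-i′ : lookup (removeAt ns j) i′ ≡ x
      at-i′ = trans (lookup-removeAt ns j i′) (cong (lookup ns) (Fin.punchIn-punchOut j≢i))

    balanced-half : Balanced ns → Balanced ns′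
    balanced-half bal = record
      { positive = updateAt-positive halving ns 2≤ positive
      ; wide     = λ l j≢out → ≤-trans (weight-mono l (half-≤ l)) (wide′ l j≢out)
      ; near     = λ {j} j≢out l → ≤-trans (half-≤ j) (near′ j≢out l)
      ; deep     = deep′
      }
      where
      open Balanced bal

      weight-i : weight i x ≤ 3 ^ k * weight i (h x)
      weight-i = weight-triple i {x} {h x} (≤3h 2≤)

      wide′ : ∀ l {j} → j ≢ out → weight l (lookup ns l) ≤ 3 ^ k * weight j (lookup ns′ j)
      wide′ l {j} j≢out with j Fin.≟ i
      ... | no  j≢i  = subst (λ y → weight l (lookup ns l) ≤ 3 ^ k * weight j y) (sym (at-≢ j≢i)) (wide l j≢out)
      ... | yes refl = subst (λ y → weight l (lookup ns l) ≤ 3 ^ k * weight j y) (sym at-i) (case 2 ≤? lookup ns l of λ where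
        (yes 2≤l) → ≤-trans (max l 2≤l) weight-i
        (no  2≰l) → begin
          weight l (lookup ns l)   ≤⟨ weight-mono l (≤-trans (m<1+n⇒m≤n (≰⇒> 2≰l)) (Halving.pos halving 2≤)) ⟩
          weight l (h x)           ≤⟨ weight≤ l j≢out (h x) ⟩
          weight j (h x)           ≤⟨ weight-triple-≤ j (h x) ⟩
          3 ^ k * weight j (h x)   ∎)
        where
        open ≤-Reasoning

      near′ : ∀ {j} → j ≢ out → ∀ l → lookup ns j ≤ 3 * lookup ns′ l
      near′ {j} j≢out l with l Fin.≟ i
      ... | no  l≢i  = subst (λ y → lookup ns j ≤ 3 * y) (sym (at-≢ l≢i)) (near j≢out l)
      ... | yes refl = subst (λ y → lookup ns j ≤ 3 * y) (sym at-i) (case 2 ≤? lookup ns j of λ where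
        -- Dimension j was a candidate too, so its weight is at most that of i. As the factor of i
        -- does not exceed that of j, the lengths compare in the same way.
        (yes 2≤j) → ≤-trans
          (^-cancelˡ-≤ k (*-cancelʳ-≤ _ _ (factor j) {{>-nonZero (≤-trans 1≤qᵈ (subst (q ^ d ≤_) (sym (factor-≢ j≢out)) qᵈ≤pᵈ))}}
            (≤-trans (max j 2≤j) (weight≤ i j≢out x))))
          (≤3h 2≤)
        (no  2≰j) → ≤-trans (m<1+n⇒m≤n (≰⇒> 2≰j)) (≤-trans (Halving.pos halving 2≤) (m≤n*m (h x) 3)))

      deep′ : ∀ {j} → j ≢ out → lookup ns′ j ≤ 1 ⊎ lookup ns′ out ≡ n ⊎
              weight j (lookup ns′ j) ≤ 3 ^ k * weight out (lookup ns′ out)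
      deep′ {j} j≢out with out Fin.≟ i
      ... | yes refl = case 2 ≤? lookup ns j of λ where
        (yes 2≤j) → inj₂ (inj₂ (subst (λ y → weight j (lookup ns′ j) ≤ 3 ^ k * weight out y) (sym at-i)
          (≤-trans (weight-mono j (half-≤ j)) (≤-trans (max j 2≤j) weight-i))))
        (no  2≰j) → inj₁ (≤-trans (half-≤ j) (m<1+n⇒m≤n (≰⇒> 2≰j)))
      ... | no out≢i = case deep j≢out of λ where
        (inj₁ ≤1)        → inj₁ (≤-trans (half-≤ j) ≤1)
        (inj₂ (inj₁ ≡n)) → inj₂ (inj₁ (trans (at-≢ out≢i) ≡n))
        (inj₂ (inj₂ w))  → inj₂ (inj₂ (subst (λ y → weight j (lookup ns′ j) ≤ 3 ^ k * weight out y) (sym (at-≢ out≢i))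
          (≤-trans (weight-mono j (half-≤ j)) w)))

  module _ {ns} (bal : Balanced ns) where

    open Balanced bal

    private
      N = lookup ns out
      P = size out ns

      otherDims : ∀ {c} {f : ℕ → ℕ → Set c} {y} → (∀ {j} → j ≢ out → f y (lookup ns j)) →
                  ∀ i → f y (lookup (removeAt ns out) i)
      otherDims {f = f} {y} all i = subst (f y) (sym (lookup-removeAt ns out i)) (all (Fin.punchInᵢ≢i out i))

    -- With real exponents: N ≤ 3 ω^(d/k) P^(1/d). This is `wide` multiplied over the d dimensions
    -- other than the last.
    depth-bound : (N ^ k * q ^ d) ^ d ≤ (3 ^ k * p ^ d) ^ d * P ^ k
    depth-bound = x^m≤product (N ^ k * q ^ d) (3 ^ k * p ^ d) k (removeAt ns out)
      (otherDims {f = λ x y → x ≤ 3 ^ k * p ^ d * y ^ k} λ {j} j≢out → begin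
        N ^ k * q ^ d                        ≡⟨ cong (N ^ k *_) factor-out ⟨
        weight out N                         ≤⟨ wide out j≢out ⟩
        3 ^ k * (lookup ns j ^ k * factor j) ≡⟨ cong (λ f → 3 ^ k * (lookup ns j ^ k * f)) (factor-≢ j≢out) ⟩
        3 ^ k * (lookup ns j ^ k * p ^ d)
          ≡⟨ trans (cong (3 ^ k *_) (*-comm (lookup ns j ^ k) (p ^ d))) (sym (*-assoc (3 ^ k) (p ^ d) _)) ⟩
        3 ^ k * p ^ d * lookup ns j ^ k      ∎)
      where
      open ≤-Reasoning

    -- Size times missing dimension is the volume for every array, so sizes compare inversely to
    -- dimensions, and `near` applies.
    size-comparable : ∀ {j} → j ≢ out → ∀ l → size l ns ≤ 3 * size j ns
    size-comparable {j} j≢out l = *-cancelˡ-≤ {size l ns} {3 * size j ns} (lookup ns l) {{>-nonZero (positive l)}} (begin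
      lookup ns l * size l ns             ≡⟨ trans (product-removeAt ns l) (sym (product-removeAt ns j)) ⟩
      lookup ns j * size j ns             ≤⟨ *-monoˡ-≤ (size j ns) (near j≢out l) ⟩
      3 * lookup ns l * size j ns
        ≡⟨ trans (cong (_* size j ns) (*-comm 3 (lookup ns l))) (*-assoc (lookup ns l) 3 (size j ns)) ⟩
      lookup ns l * (3 * size j ns)       ∎)
      where
      open ≤-Reasoning

    size-out≤ : ∀ {l} → l ≢ out → P ^ k ≤ ((3 * lookup ns l) ^ k) ^ d
    size-out≤ {l} l≢out = ≤-trans
      (^-monoˡ-≤ k (product≤^ (3 * lookup ns l) (removeAt ns out)
        (otherDims {f = λ x y → y ≤ 3 * x} {lookup ns l} (λ j≢out → near j≢out l))))
      (≤-reflexive (^-swap (3 * lookup ns l) d k))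

    -- With real exponents: the size of array j is at most ω^(d/k) (9 n_l)^d. For an input, size ·
    -- n_j = N P and N ≤ 3 ω^(d/k) n_j by `wide`, so the size is at most 3 ω^(d/k) P; moreover P ≤
    -- (3 n_l)^d by `near`. The first 3 is moved into the d-th power, which makes 9.
    size-bound : ∀ j {l} → l ≢ out → q ^ d * size j ns ^ k ≤ p ^ d * ((9 * lookup ns l) ^ k) ^ d
    size-bound j {l} l≢out = ≤-trans (lemma (j Fin.≟ out)) (*-monoʳ-≤ (p ^ d) 3ᵏ*)
      where
      open ≤-Reasoning
      X = ((3 * lookup ns l) ^ k) ^ d
      3ᵏ* : 3 ^ k * X ≤ ((9 * lookup ns l) ^ k) ^ d
      3ᵏ* = begin
        3 ^ k * X                                 ≤⟨ *-monoˡ-≤ X (m≤m^n (3 ^ k) d) ⟩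
        (3 ^ k) ^ d * X                           ≡⟨ ^-distribʳ-* (3 ^ k) ((3 * lookup ns l) ^ k) d ⟨
        (3 ^ k * (3 * lookup ns l) ^ k) ^ d       ≡⟨ cong (_^ d) (^-distribʳ-* 3 (3 * lookup ns l) k) ⟨
        ((3 * (3 * lookup ns l)) ^ k) ^ d         ≡⟨ cong (λ y → (y ^ k) ^ d) (*-assoc 3 3 (lookup ns l)) ⟨
        ((9 * lookup ns l) ^ k) ^ d               ∎

      lemma : Dec (j ≡ out) → q ^ d * size j ns ^ k ≤ p ^ d * (3 ^ k * X)
      lemma (yes refl) = *-mono-≤ qᵈ≤pᵈ (≤-trans (size-out≤ l≢out) (m≤n*m X (3 ^ k) {{>-nonZero (m^n>0 3 k)}}))
      lemma (no j≢out) = ≤-trans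
        (*-cancelˡ-≤ (lookup ns j ^ k) {{>-nonZero (m^n>0 (lookup ns j) {{>-nonZero (positive j)}} k)}} (begin
          lookup ns j ^ k * (q ^ d * size j ns ^ k)
            ≡⟨ trans (cong (lookup ns j ^ k *_) (*-comm (q ^ d) _)) (sym (*-assoc (lookup ns j ^ k) _ _)) ⟩
          lookup ns j ^ k * size j ns ^ k * q ^ d      ≡⟨ cong (_* q ^ d) (trans (sym (^-distribʳ-* (lookup ns j) (size j ns) k))
                                                          (trans (cong (_^ k) (trans (product-removeAt ns j) (sym (product-removeAt ns out)))) (^-distribʳ-* N P k))) ⟩
          N ^ k * P ^ k * q ^ d
            ≡⟨ trans (cong (N ^ k * P ^ k *_) (sym factor-out)) (xy-z (N ^ k) (P ^ k) (factor out)) ⟩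
          P ^ k * weight out N                         ≤⟨ *-monoʳ-≤ (P ^ k) (wide out j≢out) ⟩
          P ^ k * (3 ^ k * (lookup ns j ^ k * factor j))
            ≡⟨ cong (λ f → P ^ k * (3 ^ k * (lookup ns j ^ k * f))) (factor-≢ j≢out) ⟩
          P ^ k * (3 ^ k * (lookup ns j ^ k * p ^ d))  ≡⟨ reorder (P ^ k) (3 ^ k) (lookup ns j ^ k) (p ^ d) ⟩
          lookup ns j ^ k * (p ^ d * (3 ^ k * P ^ k))  ∎))
        (*-monoʳ-≤ (p ^ d) (*-monoʳ-≤ (3 ^ k) (size-out≤ l≢out)))
        where
        open +-*-Solver
        xy-z : ∀ x y z → x * y * z ≡ y * (x * z)
        xy-z = solve 3 (λ x y z → x :* y :* z := y :* (x :* z)) refl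
        reorder : ∀ a b c e → a * (b * (c * e)) ≡ c * (e * (b * a))
        reorder = solve 4 (λ a b c e → a :* (b :* (c :* e)) := c :* (e :* (b :* a))) refl

    -- With real exponents: ω^(d/k) P^(1/d) ≤ 3 N, the converse of `depth-bound`. `deep` says
    -- nothing about dimensions of length 1, but P ≥ 2 provides a longer one, `j₀`, whose weight
    -- dominates theirs.
    depth-bound-below : 2 ≤ P → N ≢ n → (p ^ d) ^ d * P ^ k ≤ (3 ^ k * (N ^ k * q ^ d)) ^ d
    depth-bound-below 2≤P N≢n with Fin.any? (λ i → 2 ≤? lookup (removeAt ns out) i)
    ... | no none = contradiction
      (≤-trans 2≤P (≤-trans (product≤^ 1 (removeAt ns out) (λ i → m<1+n⇒m≤n (≰⇒> λ 2≤ → none (i , 2≤)))) (≤-reflexive (^-zeroˡ d))))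
      (<⇒≱ ≤-refl)
    ... | yes (i₀ , 2≤j₀) = product≤x^m (3 ^ k * (N ^ k * q ^ d)) (p ^ d) k (removeAt ns out)
      (otherDims {f = λ x y → p ^ d * y ^ k ≤ x} λ {j} j≢out → begin
        p ^ d * lookup ns j ^ k     ≡⟨ trans (*-comm (p ^ d) _) (cong (lookup ns j ^ k *_) (sym (factor-≢ j≢out))) ⟩
        weight j (lookup ns j)      ≤⟨ below j≢out ⟩
        3 ^ k * weight out N        ≡⟨ cong (λ f → 3 ^ k * (N ^ k * f)) factor-out ⟩
        3 ^ k * (N ^ k * q ^ d)     ∎)
      where
      open ≤-Reasoning
      j₀ = punchIn out i₀
      j₀≢out : j₀ ≢ out
      j₀≢out = Fin.punchInᵢ≢i out i₀
      2≤nⱼ₀ : 2 ≤ lookup ns j₀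
      2≤nⱼ₀ = subst (2 ≤_) (lookup-removeAt ns out i₀) 2≤j₀

      resolve : ∀ {j} → j ≢ out → 2 ≤ lookup ns j → weight j (lookup ns j) ≤ 3 ^ k * weight out N
      resolve j≢out 2≤j with deep j≢out
      ... | inj₁ ≤1        = contradiction ≤1 (<⇒≱ 2≤j)
      ... | inj₂ (inj₁ ≡n) = contradiction ≡n N≢n
      ... | inj₂ (inj₂ w)  = w

      below : ∀ {j} → j ≢ out → weight j (lookup ns j) ≤ 3 ^ k * weight out N
      below {j} j≢out with 2 ≤? lookup ns j
      ... | yes 2≤j = resolve j≢out 2≤j
      ... | no  2≰j = begin
        weight j (lookup ns j)    ≤⟨ weight-mono j (≤-trans (m<1+n⇒m≤n (≰⇒> 2≰j)) (<⇒≤ 2≤nⱼ₀)) ⟩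
        weight j (lookup ns j₀)   ≤⟨ weight≤ j j₀≢out (lookup ns j₀) ⟩
        weight j₀ (lookup ns j₀)  ≤⟨ resolve j₀≢out 2≤nⱼ₀ ⟩
        3 ^ k * weight out N      ∎

-- Runs of the machine

module _ {a} {A : Set a} where

  ∈-─⁺ : ∀ {xs : List A} {x y} (x∈ : x ∈ xs) → y ∈ xs → y ≢ x → y ∈ (xs ─ x∈)
  ∈-─⁺ (here refl) (here refl) y≢x = contradiction refl y≢x
  ∈-─⁺ (here refl) (there y∈)  y≢x = y∈
  ∈-─⁺ (there x∈)  (here refl) y≢x = here refl
  ∈-─⁺ (there x∈)  (there y∈)  y≢x = there (∈-─⁺ x∈ y∈ y≢x)

  length-─ : ∀ {xs : List A} {x} (x∈ : x ∈ xs) → suc (length (xs ─ x∈)) ≡ length xs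
  length-─ (here refl) = refl
  length-─ (there x∈)  = cong suc (length-─ x∈)

  Unique-⊆⇒length-≤ : ∀ {xs ys : List A} → Unique xs → (∀ {x} → x ∈ xs → x ∈ ys) → length xs ≤ length ys
  Unique-⊆⇒length-≤ {[]}     _          _  = z≤n
  Unique-⊆⇒length-≤ {x ∷ xs} (x∉ ∷ xs!) ⊆ys = ≤-trans
    (s≤s (Unique-⊆⇒length-≤ xs! λ y∈ → ∈-─⁺ x∈ys (⊆ys (there y∈)) λ where refl → All.lookup x∉ y∈ refl))
    (≤-reflexive (length-─ x∈ys))
    where x∈ys = ⊆ys (here refl)

module Runs {d : ℕ} (ω : ℚ) (ns : Vec ℕ (suc d)) (B : ℕ) .{{_ : NonZero B}} (capacity : ℕ) where

  open Grid d
  open Machine ω ns B capacity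

  Dirty : Cache → Line → Set
  Dirty C x = (x , true) ∈ C

  dirty-─ : ∀ {C x y} (y∈ : (y , false) ∈ C) → Dirty C x → Dirty (C ─ y∈) x
  dirty-─ y∈ x∈ = ∈-─⁺ y∈ x∈ λ ()

  dirty-modify : ∀ {C x} y → Dirty C x → Dirty (modify y C) x
  dirty-modify {C = (z , _) ∷ C} y (here refl) = here (cong (z ,_) (sym (∨-zeroʳ ⌊ y ≟ᴸ z ⌋)))
  dirty-modify y (there x∈)  = there (dirty-modify y x∈)

  modify-dirty : ∀ {C x} → x ∈ held C → Dirty (modify x C) x
  modify-dirty {(y , flag) ∷ C} {x} (here x≡y) = here (cong₂ _,_ x≡y (sym dirty))
    where
    dirty : (⌊ x ≟ᴸ y ⌋ ∨ flag) ≡ true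
    dirty with x ≟ᴸ y
    ... | yes _  = refl
    ... | no x≢y = contradiction x≡y x≢y
  modify-dirty {_ ∷ C} (there x∈) = there (modify-dirty x∈)

  dirty⇒held : ∀ {C x} → Dirty C x → x ∈ held C
  dirty⇒held = ∈-map⁺ proj₁

  held-modify : ∀ x C → held (modify x C) ≡ held C
  held-modify x C = sym (List.map-∘ C)

  Touched : List Cell → Line → Set
  Touched t x = ∃ λ p → p ∈ t × line out p ≡ x

  -- A modified line stays modified until it is written back, and `finish` tolerates none.
  run-written : ∀ {C t r w} → Run C t r w →
    ∃ λ W → length W ≡ w × (∀ {x} → Dirty C x ⊎ Touched t x → x ∈ W)
  run-written (finish clean) = [] , refl , λ where
    (inj₁ dirty) → contradiction (All.lookup clean dirty) λ ()
  run-written (read x x∉ <cap run) =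
    let W , |W| , written = run-written run in
    W , |W| , λ where
      (inj₁ dirty) → written (inj₁ (there dirty))
      (inj₂ touched) → written (inj₂ touched)
  run-written (discard x∈ run) =
    let W , |W| , written = run-written run in
    W , |W| , λ where
      (inj₁ dirty) → written (inj₁ (dirty-─ x∈ dirty))
      (inj₂ touched) → written (inj₂ touched)
  run-written (writeBack {x = x} x∈ run) =
    let W , |W| , written = run-written run in
    x ∷ W , cong suc |W| , λ where
      (inj₂ touched) → there (written (inj₂ touched))
      {y} (inj₁ dirty) → case y ≟ᴸ x of λ where
        (yes refl) → here refl
        (no y≢x)   → there (written (inj₁ (∈-─⁺ x∈ dirty (y≢x ∘ cong proj₁))))
  run-written (compute {p = p} held run) =
    let W , |W| , written = run-written run in
    W , |W| , λ where
      (inj₁ dirty)                      → written (inj₁ (dirty-modify (line out p) dirty))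
      (inj₂ (_ , here refl , refl))     → written (inj₁ (modify-dirty (held out)))
      (inj₂ (p′ , there p′∈ , refl))    → written (inj₂ (p′ , p′∈ , refl))

  record Interrupted (C : Cache) (t₁ t₂ : List Cell) (w : ℕ) : Set where
    constructor interrupted
    field
      {cache}   : Cache
      {r₂ w₂}   : ℕ
      rest      : Run cache t₂ r₂ w₂
      cache≤    : length cache ≤ capacity
      writes    : List Line
      w≡        : w ≡ length writes + w₂
      accounted : ∀ {x} → Dirty C x ⊎ Touched t₁ x → x ∈ writes ⊎ Dirty cache x

  interrupt : ∀ {C} t₁ {t₂ t r w} → t ≡ t₁ ++ t₂ → length C ≤ capacity → Run C t r w → Interrupted C t₁ t₂ w
  interrupt [] refl C≤ run = interrupted run C≤ [] refl λ where (inj₁ dirty) → inj₂ dirty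
  interrupt t₁@(_ ∷ _) eq C≤ (read x x∉ <cap run) =
    let interrupted rest cache≤ writes w≡ accounted = interrupt t₁ eq <cap run in
    interrupted rest cache≤ writes w≡ λ where
      (inj₁ dirty) → accounted (inj₁ (there dirty))
      (inj₂ touched) → accounted (inj₂ touched)
  interrupt t₁@(_ ∷ _) eq C≤ (discard x∈ run) =
    let interrupted rest cache≤ writes w≡ accounted =
          interrupt t₁ eq (≤-trans (n≤1+n _) (≤-trans (≤-reflexive (length-─ x∈)) C≤)) run in
    interrupted rest cache≤ writes w≡ λ where
      (inj₁ dirty) → accounted (inj₁ (dirty-─ x∈ dirty))
      (inj₂ touched) → accounted (inj₂ touched)
  interrupt t₁@(_ ∷ _) eq C≤ (writeBack {x = x} x∈ run) =
    let interrupted rest cache≤ writes w≡ accounted =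
          interrupt t₁ eq (≤-trans (n≤1+n _) (≤-trans (≤-reflexive (length-─ x∈)) C≤)) run
        later : ∀ {y} → y ∈ writes ⊎ Dirty _ y → y ∈ x ∷ writes ⊎ Dirty _ y
        later = [ inj₁ ∘ there , inj₂ ]′
    in
    interrupted rest cache≤ (x ∷ writes) (cong suc w≡) λ where
      (inj₂ touched) → later (accounted (inj₂ touched))
      {y} (inj₁ dirty) → case y ≟ᴸ x of λ where
        (yes refl) → inj₁ (here refl)
        (no y≢x)   → later (accounted (inj₁ (∈-─⁺ x∈ dirty (y≢x ∘ cong proj₁))))
  interrupt {C} (p ∷ t₁) refl C≤ (compute held run) =
    let interrupted rest cache≤ writes w≡ accounted =
          interrupt t₁ refl (≤-trans (≤-reflexive (List.length-map _ C)) C≤) run in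
    interrupted rest cache≤ writes w≡ λ where
      (inj₁ dirty)                   → accounted (inj₁ (dirty-modify (line out p) dirty))
      (inj₂ (_ , here refl , refl))  → accounted (inj₁ (modify-dirty (held out)))
      (inj₂ (p′ , there p′∈ , refl)) → accounted (inj₂ (p′ , p′∈ , refl))

  -- Each touched output line has been written by the time of the cut or is still in the cache,
  -- which has room for only `capacity` lines.
  interrupted-writes : ∀ {C t₁ t₂ w} (I : Interrupted C t₁ t₂ w) → ∀ {L} → Unique L → (∀ {x} → x ∈ L → Touched t₁ x) →
    length L ≤ length (Interrupted.writes I) + capacity
  interrupted-writes (interrupted {cache} _ cache≤ writes _ accounted) {L} L! touched = begin
    length L
      ≤⟨ Unique-⊆⇒length-≤ L! (λ x∈ → [ ∈-++⁺ˡ , ∈-++⁺ʳ writes ∘ dirty⇒held ]′ (accounted (inj₂ (touched x∈)))) ⟩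
    length (writes ++ held cache)            ≡⟨ List.length-++ writes ⟩
    length writes + length (held cache)      ≡⟨ cong (length writes +_) (List.length-map proj₁ cache) ⟩
    length writes + length cache             ≤⟨ +-monoʳ-≤ (length writes) cache≤ ⟩
    length writes + capacity                 ∎
    where
    open ≤-Reasoning

  -- Partial runs, composable because the counts of the remaining run are left open.
  Steps : Cache → List Cell → ℕ → ℕ → Cache → Set
  Steps C t r w C′ = ∀ {t′ r′ w′} → Run C′ t′ r′ w′ → Run C (t ++ t′) (r + r′) (w + w′)

  steps-trans : ∀ {C C′ C″ t₁ t₂ r₁ r₂ w₁ w₂} → Steps C t₁ r₁ w₁ C′ → Steps C′ t₂ r₂ w₂ C″ →
    Steps C (t₁ ++ t₂) (r₁ + r₂) (w₁ + w₂) C″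
  steps-trans {C} {t₁ = t₁} {t₂} {r₁} {r₂} {w₁} {w₂} S₁ S₂ {t′} {r′} {w′} run =
    subst (λ t → Run C t (r₁ + r₂ + r′) (w₁ + w₂ + w′)) (sym (List.++-assoc t₁ t₂ t′))
      (subst₂ (Run C (t₁ ++ t₂ ++ t′)) (sym (+-assoc r₁ r₂ r′)) (sym (+-assoc w₁ w₂ w′)) (S₁ (S₂ run)))

  clean : List Line → Cache
  clean = map (_, false)

  held-clean : ∀ L → held (clean L) ≡ L
  held-clean L = trans (sym (List.map-∘ L)) (List.map-id L)

  held-clean-++ : ∀ L C → held (clean L ++ C) ≡ L ++ held C
  held-clean-++ L C = trans (List.map-++ proj₁ (clean L) C) (cong (_++ held C) (held-clean L))

  length-clean-++ : ∀ L C → length (clean L ++ C) ≡ length L + length C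
  length-clean-++ L C = trans (List.length-++ (clean L)) (cong (_+ length C) (List.length-map _ L))

  readAll : ∀ L {C} → Unique L → (∀ {x} → x ∈ L → x ∉ held C) → length L + length C ≤ capacity →
    Steps C [] (length L) 0 (clean L ++ C)
  readAll []      _          _  _    run = run
  readAll (x ∷ L) {C} (x∉L ∷ L!) ∉C ≤cap {t′} {r′} {w′} run =
    subst (λ r → Run C t′ r w′) (+-suc (length L) r′)
      (readAll L L! (∉C ∘ there) (<⇒≤ ≤cap)
        (read x (λ x∈ → case ∈-++⁻ L (subst (x ∈_) (held-clean-++ L C) x∈) of λ where
                   (inj₁ x∈L) → All.lookup x∉L x∈L refl
                   (inj₂ x∈C) → ∉C (here refl) x∈C)
          (subst (_< capacity) (sym (length-clean-++ L C)) ≤cap) run))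

  dropAll : ∀ L {C} → Steps (clean L ++ C) [] 0 0 C
  dropAll []      run = run
  dropAll (x ∷ L) run = discard (here refl) (dropAll L run)

  modify-clean-++ : ∀ {x} L C → x ∉ L → modify x (clean L ++ C) ≡ clean L ++ modify x C
  modify-clean-++ []      C x∉ = refl
  modify-clean-++ {x} (y ∷ L) C x∉ with x ≟ᴸ y
  ... | yes x≡y = contradiction (here x≡y) x∉
  ... | no  _   = cong ((y , false) ∷_) (modify-clean-++ L C (x∉ ∘ there))

  -- `L` is meant for input lines, in front of the output lines in `C`. Computing modifies output
  -- lines only, so `L` remains clean and can afterwards be discarded without a write, while `C`
  -- changes in its flags alone.
  computeAll : ∀ L t {C} → (∀ {p} → p ∈ t → ∀ j → line j p ∈ L ⊎ line j p ∈ held C) →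
    (∀ {p} → p ∈ t → line out p ∉ L) →
    ∃ λ C′ → held C′ ≡ held C × Steps (clean L ++ C) t 0 0 (clean L ++ C′)
  computeAll L []      {C} _      _  = C , refl , id
  computeAll L (p ∷ t) {C} lines∈ ∉L =
    let held≡ = held-modify (line out p) C
        C′ , held′≡ , steps = computeAll L t
          (λ {p′} p∈ j → [ inj₁ , (λ x∈ → inj₂ (subst (line j p′ ∈_) (sym held≡) x∈)) ]′ (lines∈ (there p∈) j)) (∉L ∘ there)
    in
    C′ , trans held′≡ held≡ , λ {t′} {r′} {w′} run → compute
      (λ j → subst (line j p ∈_) (sym (held-clean-++ L C)) ([ ∈-++⁺ˡ , ∈-++⁺ʳ L ]′ (lines∈ (here refl) j)))
      (subst (λ C → Run C (t ++ t′) r′ w′) (sym (modify-clean-++ L C (∉L (here refl)))) (steps run))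

  flush : ∀ C → ∃ λ w → w ≤ length C × Steps C [] 0 w []
  flush []                = 0 , z≤n , id
  flush ((x , false) ∷ C) = let w , w≤ , steps = flush C in w , ≤-trans w≤ (n≤1+n _) , discard (here refl) ∘ steps
  flush ((x , true) ∷ C)  = let w , w≤ , steps = flush C in suc w , s≤s w≤ , writeBack (here refl) ∘ steps

  processReading : ∀ L t {C} → Unique L → (∀ {x} → x ∈ L → x ∉ held C) → length L + length C ≤ capacity →
    (∀ {p} → p ∈ t → ∀ j → line j p ∈ L ⊎ line j p ∈ held C) → (∀ {p} → p ∈ t → line out p ∉ L) →
    ∃ λ C′ → held C′ ≡ held C × Steps C t (length L) 0 C′
  processReading L t {C} L! ∉C ≤cap lines∈ ∉L =
    let C′ , held≡ , steps = computeAll L t lines∈ ∉L in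
    C′ , held≡ , λ run → readAll L L! ∉C ≤cap (steps (dropAll L run))

-- Clearing the denominator of ω

module ℚExp = CommutativeSemiringExp (CommutativeRing.commutativeSemiring ℚ.+-*-commutativeRing)
module ℚ* = CommutativeSemigroupProperties (CommutativeRing.*-commutativeSemigroup ℚ.+-*-commutativeRing)

-- `ι n` is obtained by reducing the fraction n / 1; this is its reduced form, on which the rational
-- operations compute.
ι-mkℚ : ∀ n → ι n ≡ ℚ.mkℚ (ℤ.+ n) 0 (Coprimality.sym (Coprimality.1-coprimeTo n))
ι-mkℚ n = ℚ.↥p/↧p≡p (ℚ.mkℚ (ℤ.+ n) 0 (Coprimality.sym (Coprimality.1-coprimeTo n)))

ι-+ : ∀ m n → ι (m + n) ≡ ι m ℚ.+ ι n
ι-+ m n rewrite ι-mkℚ m | ι-mkℚ n =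
  cong (ℚ._/ 1) (sym (cong₂ ℤ._+_ (ℤ.*-identityʳ (ℤ.+ m)) (ℤ.*-identityʳ (ℤ.+ n))))

ι-* : ∀ m n → ι (m * n) ≡ ι m ℚ.* ι n
ι-* m n rewrite ι-mkℚ m | ι-mkℚ n = cong (ℚ._/ 1) (ℤ.pos-* m n)

ι-^ : ∀ m n → ι (m ^ n) ≡ ι m ^ᵠ n
ι-^ m zero    = refl
ι-^ m (suc n) = trans (ι-* m (m ^ n)) (cong (ι m ℚ.*_) (ι-^ m n))

ι-mono-≤ : ∀ {m n} → m ≤ n → ι m ℚ.≤ ι n
ι-mono-≤ {m} {n} m≤n rewrite ι-mkℚ m | ι-mkℚ n = ℚ.*≤* (ℤ.*-monoʳ-≤-nonNeg (ℤ.+ 1) (ℤ.+≤+ m≤n))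

ι-cancel-≤ : ∀ {m n} → ι m ℚ.≤ ι n → m ≤ n
ι-cancel-≤ {m} {n} ιm≤ιn rewrite ι-mkℚ m | ι-mkℚ n = ℤ.drop‿+≤+
  (subst₂ ℤ._≤_ (ℤ.*-identityʳ (ℤ.+ m)) (ℤ.*-identityʳ (ℤ.+ n)) (ℚ.drop-*≤* ιm≤ιn))

ι-nonNeg : ∀ n → ℚ.NonNegative (ι n)
ι-nonNeg n rewrite ι-mkℚ n = _

ι-pos : ∀ {n} → 1 ≤ n → ℚ.Positive (ι n)
ι-pos {suc n} _ rewrite ι-mkℚ (suc n) = _

*ι-mono-≤ : ∀ c {x y m n} → x ℚ.* ι c ≡ ι m → y ℚ.* ι c ≡ ι n → x ℚ.≤ y → m ≤ n
*ι-mono-≤ c eq₁ eq₂ x≤y = ι-cancel-≤ (subst₂ ℚ._≤_ eq₁ eq₂ (ℚ.*-monoʳ-≤-nonNeg (ι c) {{ι-nonNeg c}} x≤y))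

*ι-cancel-≤ : ∀ c {x y m n} → 1 ≤ c → x ℚ.* ι c ≡ ι m → y ℚ.* ι c ≡ ι n → m ≤ n → x ℚ.≤ y
*ι-cancel-≤ c 1≤c eq₁ eq₂ m≤n = ℚ.*-cancelʳ-≤-pos (ι c) {{ι-pos 1≤c}} (subst₂ ℚ._≤_ (sym eq₁) (sym eq₂) (ι-mono-≤ m≤n))

record Fraction (ω : ℚ) : Set where
  field
    p q  : ℕ
    1≤q  : 1 ≤ q
    q≤p  : q ≤ p
    ωq≡p : ω ℚ.* ι q ≡ ι p

fraction : ∀ {ω} → 1ℚ ℚ.≤ ω → Fraction ω
fraction {ℚ.mkℚ ℤ.-[1+ _ ] _ _} (ℚ.*≤* ())
fraction {ω@(ℚ.mkℚ (ℤ.+ p) q-1 _)} 1≤ω = record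
  { 1≤q  = s≤s z≤n
  ; q≤p  = *ι-mono-≤ (suc q-1) {1ℚ} {ω} {suc q-1} {p} (ℚ.*-identityˡ (ι (suc q-1))) ωq≡p 1≤ω
  ; ωq≡p = ωq≡p
  }
  where
  ωq≡p : ω ℚ.* ι (suc q-1) ≡ ι p
  ωq≡p rewrite ι-mkℚ (suc q-1) = ℚ.fromℚᵘ-cong {ℚᵘ.mkℚᵘ (ℤ.+ p ℤ.* ℤ.+ suc q-1) (q-1 * 1)} {ℚᵘ.mkℚᵘ (ℤ.+ p) 0}
    (ℚᵘ.*≡* (trans (ℤ.*-identityʳ _) (cong (λ x → ℤ.+ p ℤ.* ℤ.+ suc x) (sym (*-identityʳ q-1)))))

module Scaled (d′ : ℕ) {ω : ℚ} (ω-frac : Fraction ω) (n : ℕ) where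

  private d = suc d′
  open Grid d using (k; out; priority; LargeSize; cost; module Target)
  open Fraction ω-frac
  open Shape d′ p q n 1≤q q≤p

  ωᵐqᵐ≡pᵐ : ∀ m → ω ^ᵠ m ℚ.* ι (q ^ m) ≡ ι (p ^ m)
  ωᵐqᵐ≡pᵐ m = begin
    ω ^ᵠ m ℚ.* ι (q ^ m)   ≡⟨ cong (ω ^ᵠ m ℚ.*_) (ι-^ q m) ⟩
    ω ^ᵠ m ℚ.* ι q ^ᵠ m    ≡⟨ ℚExp.^-distrib-* ω (ι q) m ⟨
    (ω ℚ.* ι q) ^ᵠ m       ≡⟨ cong (_^ᵠ m) ωq≡p ⟩
    ι p ^ᵠ m               ≡⟨ ι-^ p m ⟨
    ι (p ^ m)              ∎
    where
    open ≡-Reasoning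

  priority-weight : ∀ l x → priority ω l x ℚ.* ι (q ^ d) ≡ ι (weight l x)
  priority-weight l x with l Fin.≟ out
  ... | yes _ = trans (cong (ℚ._* ι (q ^ d)) (sym (ι-^ x k))) (sym (ι-* (x ^ k) (q ^ d)))
  ... | no  _ = begin
    ι x ^ᵠ k ℚ.* ω ^ᵠ d ℚ.* ι (q ^ d)   ≡⟨ ℚ.*-assoc (ι x ^ᵠ k) (ω ^ᵠ d) (ι (q ^ d)) ⟩
    ι x ^ᵠ k ℚ.* (ω ^ᵠ d ℚ.* ι (q ^ d)) ≡⟨ cong₂ ℚ._*_ (sym (ι-^ x k)) (ωᵐqᵐ≡pᵐ d) ⟩
    ι (x ^ k) ℚ.* ι (p ^ d)             ≡⟨ ι-* (x ^ k) (p ^ d) ⟨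
    ι (x ^ k * p ^ d)                   ∎
    where
    open ≡-Reasoning

  splitDimension-splittable : ∀ {ns i} → splitDimension (priority ω) ns ≡ just i → Splittable ns i
  splitDimension-splittable {ns} {i} eq = record
    { 2≤  = IsSplitDimension.2≤ is-split
    ; max = λ l 2≤l → *ι-mono-≤ (q ^ d) {m = weight l (lookup ns l)} {weight i (lookup ns i)} (priority-weight l (lookup ns l)) (priority-weight i (lookup ns i))
                        (IsSplitDimension.max is-split l 2≤l)
    }
    where is-split = splitDimension-just (priority ω) ns eq

  largeSize : ∀ {a M} → LargeSize a n M ω → p ^ d * M ^ k ≤ (a * n) ^ k * q ^ d
  largeSize {a} {M} = *ι-mono-≤ (q ^ d) {m = p ^ d * M ^ k} {(a * n) ^ k * q ^ d}
    (begin
      ω ^ᵠ d ℚ.* ι M ^ᵠ k ℚ.* ι (q ^ d)    ≡⟨ ℚ*.xy∙z≈xz∙y (ω ^ᵠ d) (ι M ^ᵠ k) (ι (q ^ d)) ⟩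
      ω ^ᵠ d ℚ.* ι (q ^ d) ℚ.* ι M ^ᵠ k    ≡⟨ cong₂ ℚ._*_ (ωᵐqᵐ≡pᵐ d) (sym (ι-^ M k)) ⟩
      ι (p ^ d) ℚ.* ι (M ^ k)              ≡⟨ ι-* (p ^ d) (M ^ k) ⟨
      ι (p ^ d * M ^ k)                    ∎)
    (begin
      (ι a ℚ.* ι n) ^ᵠ k ℚ.* ι (q ^ d)     ≡⟨ cong (λ x → x ^ᵠ k ℚ.* ι (q ^ d)) (ι-* a n) ⟨
      ι (a * n) ^ᵠ k ℚ.* ι (q ^ d)         ≡⟨ cong (ℚ._* ι (q ^ d)) (ι-^ (a * n) k) ⟨
      ι ((a * n) ^ k) ℚ.* ι (q ^ d)        ≡⟨ ι-* ((a * n) ^ k) (q ^ d) ⟨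
      ι ((a * n) ^ k * q ^ d)              ∎)
    where
    open ≡-Reasoning

  module _ (M B : ℕ) (r w : ℕ) where

    private
      K = k * d
      x = cost ω r w

    scaledCost : ℕ
    scaledCost = r * q + p * w

    cost*q : x ℚ.* ι q ≡ ι scaledCost
    cost*q = begin
      (ι r ℚ.+ ω ℚ.* ι w) ℚ.* ι q           ≡⟨ ℚ.*-distribʳ-+ (ι q) (ι r) (ω ℚ.* ι w) ⟩
      ι r ℚ.* ι q ℚ.+ ω ℚ.* ι w ℚ.* ι q
        ≡⟨ cong₂ ℚ._+_ (sym (ι-* r q)) (trans (ℚ*.xy∙z≈xz∙y ω (ι w) (ι q)) (trans (cong (ℚ._* ι w) ωq≡p) (sym (ι-* p w)))) ⟩
      ι (r * q) ℚ.+ ι (p * w)               ≡⟨ ι-+ (r * q) (p * w) ⟨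
      ι scaledCost                          ∎
      where
      open ≡-Reasoning

    -- As k d = d + d², the factor q^(k d) turns ω^d into p^d q^(d²).
    scaledTarget : ∀ C → ι C ^ᵠ K ℚ.* (ι n ^ᵠ (k * K) ℚ.* ω ^ᵠ d) ℚ.* ι (q ^ K)
                   ≡ ι (C ^ K * (n ^ (k * K) * (p ^ d * q ^ (d * d))))
    scaledTarget C = begin
      ι C ^ᵠ K ℚ.* (ι n ^ᵠ (k * K) ℚ.* ω ^ᵠ d) ℚ.* ι (q ^ K)              ≡⟨ ℚ.*-assoc (ι C ^ᵠ K) _ _ ⟩
      ι C ^ᵠ K ℚ.* (ι n ^ᵠ (k * K) ℚ.* ω ^ᵠ d ℚ.* ι (q ^ K))
        ≡⟨ cong (ι C ^ᵠ K ℚ.*_) (ℚ.*-assoc (ι n ^ᵠ (k * K)) _ _) ⟩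
      ι C ^ᵠ K ℚ.* (ι n ^ᵠ (k * K) ℚ.* (ω ^ᵠ d ℚ.* ι (q ^ K)))
        ≡⟨ cong₂ ℚ._*_ (sym (ι-^ C K)) (cong₂ ℚ._*_ (sym (ι-^ n (k * K))) ωᵈqᴷ) ⟩
      ι (C ^ K) ℚ.* (ι (n ^ (k * K)) ℚ.* ι (p ^ d * q ^ (d * d)))          ≡⟨ cong (ι (C ^ K) ℚ.*_) (ι-* (n ^ (k * K)) _) ⟨
      ι (C ^ K) ℚ.* ι (n ^ (k * K) * (p ^ d * q ^ (d * d)))                ≡⟨ ι-* (C ^ K) _ ⟨
      ι (C ^ K * (n ^ (k * K) * (p ^ d * q ^ (d * d))))                   ∎
      where
      open ≡-Reasoning
      ωᵈqᴷ : ω ^ᵠ d ℚ.* ι (q ^ K) ≡ ι (p ^ d * q ^ (d * d))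
      ωᵈqᴷ = begin
        ω ^ᵠ d ℚ.* ι (q ^ K)                        ≡⟨ cong (λ y → ω ^ᵠ d ℚ.* ι y) (^-distribˡ-+-* q d (d * d)) ⟩
        ω ^ᵠ d ℚ.* ι (q ^ d * q ^ (d * d))          ≡⟨ cong (ω ^ᵠ d ℚ.*_) (ι-* (q ^ d) _) ⟩
        ω ^ᵠ d ℚ.* (ι (q ^ d) ℚ.* ι (q ^ (d * d)))  ≡⟨ ℚ.*-assoc (ω ^ᵠ d) _ _ ⟨
        ω ^ᵠ d ℚ.* ι (q ^ d) ℚ.* ι (q ^ (d * d))    ≡⟨ cong (ℚ._* ι (q ^ (d * d))) (ωᵐqᵐ≡pᵐ d) ⟩
        ι (p ^ d) ℚ.* ι (q ^ (d * d))               ≡⟨ ι-* (p ^ d) _ ⟨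
        ι (p ^ d * q ^ (d * d))                     ∎

    scaledPower : ∀ C → ι C ^ᵠ K ℚ.* ((x ℚ.* ι B) ^ᵠ K ℚ.* ι M ^ᵠ k) ℚ.* ι (q ^ K)
                  ≡ ι (C ^ K * ((scaledCost * B) ^ K * M ^ k))
    scaledPower C = begin
      ι C ^ᵠ K ℚ.* ((x ℚ.* ι B) ^ᵠ K ℚ.* ι M ^ᵠ k) ℚ.* ι (q ^ K)      ≡⟨ ℚ.*-assoc (ι C ^ᵠ K) _ _ ⟩
      ι C ^ᵠ K ℚ.* ((x ℚ.* ι B) ^ᵠ K ℚ.* ι M ^ᵠ k ℚ.* ι (q ^ K))      ≡⟨ cong₂ ℚ._*_ (sym (ι-^ C K)) inner ⟩
      ι (C ^ K) ℚ.* ι ((scaledCost * B) ^ K * M ^ k)                  ≡⟨ ι-* (C ^ K) _ ⟨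
      ι (C ^ K * ((scaledCost * B) ^ K * M ^ k))                      ∎
      where
      open ≡-Reasoning
      base : x ℚ.* ι B ℚ.* ι q ≡ ι (scaledCost * B)
      base = trans (ℚ*.xy∙z≈xz∙y x (ι B) (ι q)) (trans (cong (ℚ._* ι B) cost*q) (sym (ι-* scaledCost B)))
      inner : (x ℚ.* ι B) ^ᵠ K ℚ.* ι M ^ᵠ k ℚ.* ι (q ^ K) ≡ ι ((scaledCost * B) ^ K * M ^ k)
      inner = begin
        (x ℚ.* ι B) ^ᵠ K ℚ.* ι M ^ᵠ k ℚ.* ι (q ^ K)     ≡⟨ ℚ*.xy∙z≈xz∙y ((x ℚ.* ι B) ^ᵠ K) _ _ ⟩
        (x ℚ.* ι B) ^ᵠ K ℚ.* ι (q ^ K) ℚ.* ι M ^ᵠ k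
          ≡⟨ cong₂ ℚ._*_ (trans (cong ((x ℚ.* ι B) ^ᵠ K ℚ.*_) (ι-^ q K)) (sym (ℚExp.^-distrib-* (x ℚ.* ι B) (ι q) K))) (sym (ι-^ M k)) ⟩
        (x ℚ.* ι B ℚ.* ι q) ^ᵠ K ℚ.* ι (M ^ k)          ≡⟨ cong (λ y → y ^ᵠ K ℚ.* ι (M ^ k)) base ⟩
        ι (scaledCost * B) ^ᵠ K ℚ.* ι (M ^ k)           ≡⟨ cong (ℚ._* ι (M ^ k)) (ι-^ (scaledCost * B) K) ⟨
        ι ((scaledCost * B) ^ K) ℚ.* ι (M ^ k)          ≡⟨ ι-* ((scaledCost * B) ^ K) (M ^ k) ⟨
        ι ((scaledCost * B) ^ K * M ^ k)                ∎

    open Target n M B ω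

    private
      1≤qᴷ : 1 ≤ q ^ K
      1≤qᴷ = m^n>0 q {{>-nonZero 1≤q}} K

      1* : ∀ y → ι 1 ^ᵠ K ℚ.* y ≡ y
      1* y = trans (cong (ℚ._* y) (trans (sym (ι-^ 1 K)) (cong ι (^-zeroˡ K)))) (ℚ.*-identityˡ y)

      1*′ : ∀ y → ι (1 ^ K * y) ≡ ι y
      1*′ y = cong ι (trans (cong (_* y) (^-zeroˡ K)) (*-identityˡ y))

    cost≤target : ∀ C → (scaledCost * B) ^ K * M ^ k ≤ C ^ K * (n ^ (k * K) * (p ^ d * q ^ (d * d))) → x ≤ C ·T
    cost≤target C = *ι-cancel-≤ (q ^ K) {m = (scaledCost * B) ^ K * M ^ k} {C ^ K * (n ^ (k * K) * (p ^ d * q ^ (d * d)))} 1≤qᴷ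
      (trans (cong (ℚ._* ι (q ^ K)) (sym (1* _))) (trans (scaledPower 1) (1*′ _))) (scaledTarget C)

    target≤cost : ∀ C → n ^ (k * K) * (p ^ d * q ^ (d * d)) ≤ C ^ K * ((scaledCost * B) ^ K * M ^ k) → T≤ C · x
    target≤cost C = *ι-cancel-≤ (q ^ K) {m = n ^ (k * K) * (p ^ d * q ^ (d * d))} {C ^ K * ((scaledCost * B) ^ K * M ^ k)} 1≤qᴷ
      (trans (cong (ℚ._* ι (q ^ K)) (sym (1* _))) (trans (scaledTarget 1) (1*′ _))) (scaledPower C)

-- Nodes of the recursion tree and the lower bound on the writes

module Recursion (d′ : ℕ) {ω : ℚ} (ω-frac : Fraction ω) (n : ℕ) (1≤n : 1 ≤ n) (b : ℕ)
                 (B : ℕ) .{{_ : NonZero B}} (capacity : ℕ) where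

  private d = suc d′
  open Grid d
  open Fraction ω-frac
  open Shape d′ p q n 1≤q q≤p
  open Scaled d′ ω-frac n using (splitDimension-splittable)
  open Layout d′ using (Stored; stored-whole; stored-halves)

  cube : Vec ℕ k
  cube = replicate k n

  cube-positive : Positive cube
  cube-positive i = subst (1 ≤_) (sym (Vec.lookup-replicate i n)) 1≤n

  open Machine ω cube B capacity
  open Runs ω cube B capacity

  record Node (box : Box {k}) : Set where
    field
      balanced : Balanced (lengths box)
      stored   : ∀ j → Stored ω cube j (removeAt box j)

  open Node

  module _ {box : Box {k}} (ν : Node box) (j : Fin k) where

    private
      module L = Layout.Lines d′ {ω} {cube} cube-positive B capacity {box} (Balanced.positive (balanced ν)) j (stored ν j)

    open L public using ()
      renaming (lines to arrayLines; lines-unique to arrayLines-unique; ∈-lines⇒array to ∈-arrayLines⇒array; line∈lines to line∈arrayLines;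
                lines-hit to arrayLines-hit; size≤lines*B to size≤arrayLines*B; lines*B≤size+2B to arrayLines*B≤size+2B)

  Dims : Box {k} → Fin k → ℕ
  Dims box = lookup (lengths box)

  volume : Box {k} → ℕ
  volume box = product (lengths box)

  arraySize : Fin k → Box {k} → ℕ
  arraySize j box = size j (lengths box)

  dim*size : ∀ j box → Dims box j * arraySize j box ≡ volume box
  dim*size j box = product-removeAt (lengths box) j

  record Child (i : Fin k) (box box′ : Box {k}) : Set where
    field
      node     : Node box′
      inside   : ∀ {p} → InBox p box′ → InBox p box
      size≤3   : ∀ j → arraySize j box ≤ 3 * arraySize j box′
      dim≤3    : ∀ l → Dims box l ≤ 3 * Dims box′ l
      sameSize : ∀ {j} → j ≡ i → arraySize j box′ ≡ arraySize j box
      sameDim  : ∀ {j} → j ≢ i → Dims box′ j ≡ Dims box j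

  children : ∀ {box i} → splitDimension (priority ω) (lengths box) ≡ just i → Node box →
    Child i box (lowerHalf i box) × Child i box (upperHalf i box)
  children {box} {i} split≡ ν =
    child ⌊/2⌋-halving (lengths-lowerHalf box i) (InBox-lowerHalf⁻ {i = i}) (proj₁ ∘ stored-both) ,
    child ⌈/2⌉-halving (lengths-upperHalf box i) (InBox-upperHalf⁻ {i = i}) (proj₂ ∘ stored-both)
    where
    splittable : Splittable (lengths box) i
    splittable = splitDimension-splittable split≡

    stored-both : ∀ j → Stored ω cube j (removeAt (lowerHalf i box) j) × Stored ω cube j (removeAt (upperHalf i box) j)
    stored-both j = stored-halves {box = box} {i} split≡ j (stored ν j)

    same-size : ∀ {h box′ j} → lengths box′ ≡ updateAt (lengths box) i h → j ≡ i → arraySize j box′ ≡ arraySize j box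
    same-size {j = j} lengths≡ refl = trans (cong (size j) lengths≡) (cong product (removeAt-updateAt (lengths box) j))

    child : ∀ {h box′} → Halving h → lengths box′ ≡ updateAt (lengths box) i h →
            (∀ {p} → InBox p box′ → InBox p box) → (∀ j → Stored ω cube j (removeAt box′ j)) → Child i box box′
    child halving lengths≡ inside st = record
      { node     = record { balanced = subst Balanced (sym lengths≡) (balanced-half splittable halving (balanced ν)) ; stored = st }
      ; inside   = inside
      ; size≤3   = λ j → subst (λ ns → arraySize j box ≤ 3 * size j ns) (sym lengths≡) (size≤3half splittable halving j)
      ; dim≤3    = λ l → subst (λ ns → Dims box l ≤ 3 * lookup ns l) (sym lengths≡) (≤3half splittable halving l)
      ; sameSize = same-size lengths≡
      ; sameDim  = λ {j} j≢i → trans (cong (λ ns → lookup ns j) lengths≡) (Vec.lookup∘updateAt′ j i j≢i (lengths box))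
      }

  Recursive : Box {k} → List Cell → Set
  Recursive = Division (priority ω) (smallArrays b)

  -- The recursion stops only if all arrays have at most `b` entries, or if all lengths are at most
  -- 1 and thus all arrays have at most one entry.
  large⇒¬stop : ∀ {box j θ} → b ≤ θ → 1 ≤ θ → θ < arraySize j box →
    ¬ (smallArrays b (lengths box) ≡ true ⊎ splitDimension (priority ω) (lengths box) ≡ nothing)
  large⇒¬stop {box} {j} b≤θ 1≤θ θ<size (inj₁ small≡) = <⇒≱ θ<size (≤-trans (toWitness small j) b≤θ)
    where
    small : T ⌊ Fin.all? (λ j → arraySize j box ≤? b) ⌋
    small = subst T (sym small≡) _
  large⇒¬stop {box} {j} b≤θ 1≤θ θ<size (inj₂ split≡) = <⇒≱ θ<size (begin
    arraySize j box        ≤⟨ product≤^ 1 (removeAt (lengths box) j) (λ i →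
                                subst (_≤ 1) (sym (lookup-removeAt (lengths box) j i))
                                  (splitDimension-nothing (priority ω) (lengths box) split≡ (punchIn j i))) ⟩
    1 ^ d                  ≡⟨ ^-zeroˡ d ⟩
    1                      ≤⟨ 1≤θ ⟩
    _                      ∎)
    where
    open ≤-Reasoning

  lines-touched : ∀ {box t} (ν : Node box) → Recursive box t → ∀ {x} → x ∈ arrayLines ν out → Touched t x
  lines-touched ν D x∈ =
    let p , p∈ , line≡ = arrayLines-hit ν out x∈ in
    p , ∈-Division⁺ D p∈ , line≡

  root : Node (wholeBox cube)
  root = record
    { balanced = subst Balanced (sym (lengths-wholeBox cube)) (balanced-replicate 1≤n)
    ; stored   = stored-whole cube-positive
    }

  module LowerBound (θ N : ℕ) (b≤θ : b ≤ θ) (1≤θ : 1 ≤ θ) (6cap≤θ : 3 * (2 * (capacity * B)) ≤ θ)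
    (N-max : ∀ {box} → Node box → arraySize out box ≤ θ → Dims box out ≤ N) where

    -- The writes are compared with the volume rather than with the size of the output: the former
    -- is additive over halves, whereas halving the last dimension leaves both halves with the same
    -- output.
    record Written (box : Box {k}) (t : List Cell) (w : ℕ) : Set where
      constructor written
      field
        {cache}    : Cache
        {r₂ w₁ w₂} : ℕ
        rest       : Run cache t r₂ w₂
        cache≤     : length cache ≤ capacity
        w≡         : w ≡ w₁ + w₂
        volume≤    : volume box ≤ N * (2 * (w₁ * B))

    volume≤N*size : ∀ {box} → Node box → arraySize out box ≤ θ → volume box ≤ N * arraySize out box
    volume≤N*size {box} ν size≤θ = ≤-trans (≤-reflexive (sym (dim*size out box))) (*-monoˡ-≤ (arraySize out box) (N-max ν size≤θ))

    -- Origin of the 6 in the threshold: halving may cost a factor 3, and 2 must remain so that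
    -- lines still in the cache make up at most half of those touched.
    large-child : ∀ {i box box′} → Child i box box′ → θ < arraySize out box → 2 * (capacity * B) ≤ arraySize out box′
    large-child {box′ = box′} c θ<size = *-cancelˡ-≤ 3 (≤-trans 6cap≤θ (≤-trans (<⇒≤ θ<size) (Child.size≤3 c out)))

    -- The second half starts with whatever cache the first half leaves, so nothing is assumed of
    -- `C` beyond its length.
    written-box : ∀ {box t} → Recursive box t → Node box → 2 * (capacity * B) ≤ arraySize out box →
      ∀ {C t′ r w} → length C ≤ capacity → Run C (t ++ t′) r w → Written box t′ w
    written-box {box} {t} D ν 2cap≤size {C} C≤ run with arraySize out box ≤? θ
    ... | yes size≤θ = written (Interrupted.rest I) (Interrupted.cache≤ I) (Interrupted.w≡ I) (begin
        volume box                 ≤⟨ volume≤N*size ν size≤θ ⟩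
        N * arraySize out box      ≤⟨ *-monoʳ-≤ N size≤ ⟩
        N * (2 * (w₁ * B))         ∎)
      where
      open ≤-Reasoning
      I = interrupt t refl C≤ run
      w₁ = length (Interrupted.writes I)
      L = arrayLines ν out
      L≤ : length L ≤ w₁ + capacity
      L≤ = interrupted-writes I (arrayLines-unique ν out) (lines-touched ν D)
      P = arraySize out box
      cap = capacity * B
      P≤ : P ≤ w₁ * B + cap
      P≤ = begin
        P                        ≤⟨ size≤arrayLines*B ν out ⟩
        length L * B             ≤⟨ *-monoˡ-≤ B L≤ ⟩
        (w₁ + capacity) * B      ≡⟨ *-distribʳ-+ B w₁ capacity ⟩
        w₁ * B + cap             ∎
      size≤ : P ≤ 2 * (w₁ * B)
      size≤ = +-cancelʳ-≤ P P (2 * (w₁ * B)) (begin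
        P + P                        ≤⟨ +-mono-≤ P≤ P≤ ⟩
        w₁ * B + cap + (w₁ * B + cap) ≡⟨ solve 2 (λ x y → x :+ y :+ (x :+ y) := con 2 :* x :+ con 2 :* y) refl (w₁ * B) cap ⟩
        2 * (w₁ * B) + 2 * cap       ≤⟨ +-monoʳ-≤ (2 * (w₁ * B)) 2cap≤size ⟩
        2 * (w₁ * B) + P             ∎)
        where
        open +-*-Solver
    written-box {box} (stop reason) ν 2cap≤size C≤ run | no size≰θ =
      contradiction reason (large⇒¬stop {box} {out} b≤θ 1≤θ (≰⇒> size≰θ))
    written-box {box} (halve {t₁ = t₁} {t₂} i split≡ D₁ D₂) ν 2cap≤size {C} {t′} {r} {w} C≤ run | no size≰θ =
      let c₁ , c₂ = children split≡ ν
          θ<size = ≰⇒> size≰θ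
          W₁ = written-box D₁ (Child.node c₁) (large-child c₁ θ<size) C≤
                 (subst (λ t → Run C t r w) (List.++-assoc t₁ t₂ t′) run)
          W₂ = written-box D₂ (Child.node c₂) (large-child c₂ θ<size) (Written.cache≤ W₁) (Written.rest W₁)
          x₁ = Written.w₁ W₁
          x₂ = Written.w₁ W₂
      in written {w₁ = x₁ + x₂} (Written.rest W₂) (Written.cache≤ W₂)
        (trans (Written.w≡ W₁) (trans (cong (x₁ +_) (Written.w≡ W₂)) (sym (+-assoc x₁ x₂ _))))
        (begin
          volume box                                                 ≡⟨ product-halves box i ⟨
          volume (lowerHalf i box) + volume (upperHalf i box)        ≤⟨ +-mono-≤ (Written.volume≤ W₁) (Written.volume≤ W₂) ⟩
          N * (2 * (x₁ * B)) + N * (2 * (x₂ * B))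
            ≡⟨ solve 4 (λ N x y B → N :* (con 2 :* (x :* B)) :+ N :* (con 2 :* (y :* B)) := N :* (con 2 :* ((x :+ y) :* B))) refl N x₁ x₂ B ⟩
          N * (2 * ((x₁ + x₂) * B))                                  ∎)
      where
      open ≤-Reasoning
      open +-*-Solver

    volume≤writes : ∀ {box t} → Recursive box t → Node box → ∀ {r w} → Run [] t r w → volume box ≤ N * (2 * (w * B))
    volume≤writes {box} {t} D ν {r} {w} run with 2 * (capacity * B) ≤? arraySize out box
    ... | yes 2cap≤size =
      let W = written-box D ν 2cap≤size z≤n (subst (λ t → Run [] t r w) (sym (List.++-identityʳ t)) run) in
      ≤-trans (Written.volume≤ W) (*-monoʳ-≤ N (*-monoʳ-≤ 2 (*-monoˡ-≤ B
        (≤-trans (m≤m+n (Written.w₁ W) _) (≤-reflexive (sym (Written.w≡ W)))))))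
    ... | no 2cap≰size =
      let W , |W|≡w , in-W = run-written run
          L≤w = ≤-trans (Unique-⊆⇒length-≤ (arrayLines-unique ν out)
                          (λ x∈ → in-W (inj₂ (lines-touched ν D x∈))))
                        (≤-reflexive |W|≡w)
      in begin
        volume box
          ≤⟨ volume≤N*size ν (≤-trans (<⇒≤ (≰⇒> 2cap≰size)) (≤-trans (m≤n*m (2 * (capacity * B)) 3) 6cap≤θ)) ⟩
        N * arraySize out box     ≤⟨ *-monoʳ-≤ N (size≤arrayLines*B ν out) ⟩
        N * (length (arrayLines ν out) * B) ≤⟨ *-monoʳ-≤ N (*-monoˡ-≤ B L≤w) ⟩
        N * (w * B)               ≤⟨ *-monoʳ-≤ N (m≤n*m (w * B) 2) ⟩
        N * (2 * (w * B))         ∎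
      where
      open ≤-Reasoning

-- Construction of a run

module _ {a b} {A : Set a} {B : Set b} where

  length-concatMap-≤ : ∀ (f : A → List B) c X xs → (∀ x → length (f x) * c ≤ X) → length (concatMap f xs) * c ≤ length xs * X
  length-concatMap-≤ f c X []       ≤X = z≤n
  length-concatMap-≤ f c X (x ∷ xs) ≤X = begin
    length (f x ++ concatMap f xs) * c              ≡⟨ cong (_* c) (List.length-++ (f x)) ⟩
    (length (f x) + length (concatMap f xs)) * c    ≡⟨ *-distribʳ-+ c (length (f x)) _ ⟩
    length (f x) * c + length (concatMap f xs) * c  ≤⟨ +-mono-≤ (≤X x) (length-concatMap-≤ f c X xs ≤X) ⟩
    X + length xs * X                               ∎
    where
    open ≤-Reasoning

  concatMap-unique : ∀ {f : A → List B} → (∀ x → Unique (f x)) → (∀ {x y z} → z ∈ f x → z ∈ f y → x ≡ y) →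
    ∀ {xs} → Unique xs → Unique (concatMap f xs)
  concatMap-unique f! f-disjoint []          = []
  concatMap-unique {f} f! f-disjoint {x ∷ xs} (x∉ ∷ xs!) =
    Unique.++⁺ (f! x) (concatMap-unique f! f-disjoint xs!) λ (z∈fx , z∈) →
      let y , y∈ , z∈fy = find (∈-concatMap⁻ f {xs = xs} z∈) in
      All.lookup x∉ y∈ (f-disjoint z∈fx z∈fy)

module UpperBound (d′ : ℕ) {ω : ℚ} (ω-frac : Fraction ω) (n : ℕ) (1≤n : 1 ≤ n) (b : ℕ)
                  (B : ℕ) .{{_ : NonZero B}} (capacity : ℕ) where

  private d = suc d′
  open Grid d
  open Fraction ω-frac
  open Shape d′ p q n 1≤q q≤p
  open Recursion d′ ω-frac n 1≤n b B capacity
  open Machine ω cube B capacity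
  open Runs ω cube B capacity
  open Node

  module _ (θ M a N N′ : ℕ) (b≤θ : b ≤ θ) (1≤θ : 1 ≤ θ) (9M≤θ : 9 * M ≤ θ) (1≤a : 1 ≤ a) (B≤M : B ≤ M)
    (fits : ∀ x → x * B ≤ k * (θ + 2 * B) → x ≤ capacity)
    (N-min : ∀ {box} → Node box → θ < arraySize out box → N ≤ Dims box out)
    (N′-min : ∀ {box} → Node box → ∀ j → θ < arraySize j box → ∀ {l} → l ≢ out → ∀ x → Dims box l ≤ 3 * x → N′ ≤ x)
    where

    -- What allows the output lines of a box to be charged to its volume; `Thick` is the analogue
    -- for the input lines.
    record Flat (box : Box {k}) : Set where
      field
        N≤dim   : N ≤ Dims box out
        B≤asize : B ≤ a * arraySize out box

    record Thick (box : Box {k}) : Set where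
      field
        N′≤dim  : ∀ {l} → l ≢ out → N′ ≤ Dims box l
        B≤asize : ∀ {j} → j ≢ out → B ≤ a * arraySize j box

    -- There are at most S / B + 2 lines for S entries. B ≤ a S turns the two extra lines into 2 a S
    -- entries, and S times the missing dimension is the volume.
    lines-cost : ∀ {box} (ν : Node box) {x} j → x ≤ Dims box j → B ≤ a * arraySize j box →
      x * (length (arrayLines ν j) * B) ≤ (1 + 2 * a) * volume box
    lines-cost {box} ν {x} j x≤dim B≤asize = begin
      x * (length (arrayLines ν j) * B)          ≤⟨ *-mono-≤ x≤dim (arrayLines*B≤size+2B ν j) ⟩
      D * (S + 2 * B)                            ≤⟨ *-monoʳ-≤ D (+-monoʳ-≤ S (*-monoʳ-≤ 2 B≤asize)) ⟩
      D * (S + 2 * (a * S))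
        ≡⟨ solve 3 (λ D S a → D :* (S :+ con 2 :* (a :* S)) := (con 1 :+ con 2 :* a) :* (D :* S)) refl D S a ⟩
      (1 + 2 * a) * (D * S)                      ≡⟨ cong ((1 + 2 * a) *_) (dim*size j box) ⟩
      (1 + 2 * a) * volume box                   ∎
      where
      open ≤-Reasoning
      open +-*-Solver
      D = Dims box j
      S = arraySize j box

    -- Origin of the 9 in the threshold: one factor 3 for passing from array j to j′, another for
    -- halving.
    M≤child : ∀ {i box box′ j j′} → Child i box box′ → θ < arraySize j box → arraySize j box ≤ 3 * arraySize j′ box →
      M ≤ arraySize j′ box′
    M≤child {box = box} {box′} {j} {j′} c θ<size size≤ = *-cancelˡ-≤ 9 (begin
      9 * M                             ≤⟨ 9M≤θ ⟩
      θ                                 ≤⟨ <⇒≤ θ<size ⟩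
      arraySize j box                   ≤⟨ size≤ ⟩
      3 * arraySize j′ box              ≤⟨ *-monoʳ-≤ 3 (Child.size≤3 c j′) ⟩
      3 * (3 * arraySize j′ box′)       ≡⟨ *-assoc 3 3 (arraySize j′ box′) ⟨
      9 * arraySize j′ box′             ∎)
      where
      open ≤-Reasoning

    B≤a* : ∀ {x} → M ≤ x → B ≤ a * x
    B≤a* {x} M≤x = ≤-trans B≤M (≤-trans M≤x (m≤n*m x a {{>-nonZero 1≤a}}))

    -- The oversized array belongs to the parent, whose dimensions are at most three times those of
    -- the child; hence the form of `N′-min`.
    thick-child : ∀ {i box box′ j} → Node box → Child i box box′ → θ < arraySize j box → Thick box′
    thick-child {box = box} {box′} {j} ν c θ<size = record
      { N′≤dim  = λ {l} l≢out → N′-min ν j θ<size l≢out (Dims box′ l) (Child.dim≤3 c l)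
      ; B≤asize = λ {j′} j′≢out → B≤a* (M≤child c θ<size (size-comparable (balanced ν) j′≢out j))
      }

    -- Halving the last dimension would not have shrunk the output. So the step from above θ to at
    -- most θ halves another dimension, and the child inherits the depth of its parent.
    flat-child : ∀ {i box box′} → Node box → Child i box box′ → θ < arraySize out box → arraySize out box′ ≤ θ → Flat box′
    flat-child {i} {box} {box′} ν c θ<size size′≤θ = record
      { N≤dim   = subst (N ≤_) (sym (Child.sameDim c out≢i)) (N-min ν θ<size)
      ; B≤asize = B≤a* (M≤child c θ<size (m≤n*m (arraySize out box) 3))
      }
      where
      out≢i : out ≢ i
      out≢i out≡i = <⇒≱ θ<size (subst (_≤ θ) (Child.sameSize c out≡i) size′≤θ)

    Fits : Box {k} → Set
    Fits box = ∀ j → arraySize j box ≤ θ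

    tooLarge : ∀ {box} → ¬ Fits box → ∃ λ j → θ < arraySize j box
    tooLarge {box} ¬fits =
      let j , size≰θ = Fin.¬∀⟶∃¬ k _ (λ j → arraySize j box ≤? θ) ¬fits in j , ≰⇒> size≰θ

    lines≤ : ∀ {box} (ν : Node box) j → arraySize j box ≤ θ → length (arrayLines ν j) * B ≤ θ + 2 * B
    lines≤ ν j size≤θ = ≤-trans (arrayLines*B≤size+2B ν j) (+-monoˡ-≤ (2 * B) size≤θ)

    c-read : ℕ
    c-read = d * (1 + 2 * a)

    cost-halves : ∀ {box} i N c x y → N * (x * B) ≤ c * volume (lowerHalf i box) → N * (y * B) ≤ c * volume (upperHalf i box) →
      N * ((x + y) * B) ≤ c * volume box
    cost-halves {box} i N c x y x≤ y≤ = begin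
      N * ((x + y) * B)
        ≡⟨ solve 4 (λ N x y B → N :* ((x :+ y) :* B) := N :* (x :* B) :+ N :* (y :* B)) refl N x y B ⟩
      N * (x * B) + N * (y * B)       ≤⟨ +-mono-≤ x≤ y≤ ⟩
      c * volume (lowerHalf i box) + c * volume (upperHalf i box) ≡⟨ *-distribˡ-+ c (volume (lowerHalf i box)) _ ⟨
      c * (volume (lowerHalf i box) + volume (upperHalf i box))   ≡⟨ cong (c *_) (product-halves box i) ⟩
      c * volume box                  ∎
      where
      open ≤-Reasoning
      open +-*-Solver

    module _ (O : List Line) (O-out : ∀ {x} → x ∈ O → proj₁ x ≡ out) (O≤ : length O * B ≤ θ + 2 * B) where

      -- `steps` fixes the held lines but not their flags, because boxes treated earlier may have
      -- modified output lines.
      record Reading (box : Box {k}) (t : List Cell) : Set where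
        constructor reading
        field
          reads  : ℕ
          reads≤ : N′ * (reads * B) ≤ c-read * volume box
          steps  : ∀ {C} → held C ≡ O → ∃ λ C′ → held C′ ≡ O × Steps C t reads 0 C′

      -- Only the first boxes that fit are charged, so `Thick` is asked of these alone. The caller
      -- supplies it for the starting box; further down it comes from a parent with an array above
      -- θ.
      read-box : ∀ {box t} → Recursive box t → (ν : Node box) → (Fits box → Thick box) →
        (∀ {p} → InBox p box → line out p ∈ O) → Reading box t
      read-box {box} {t} D ν thick in-O with Fin.all? (λ j → arraySize j box ≤? θ)
      ... | yes sizes≤θ = reading (length L) (begin
          N′ * (length L * B)
            ≡⟨ solve 3 (λ N L B → N :* (L :* B) := L :* (N :* B)) refl N′ (length L) B ⟩
          length L * (N′ * B)                        ≤⟨ length-concatMap-≤ inputs (N′ * B) ((1 + 2 * a) * volume box) (allFin d) (λ i → begin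
              length (inputs i) * (N′ * B)
                ≡⟨ solve 3 (λ N L B → L :* (N :* B) := N :* (L :* B)) refl N′ (length (inputs i)) B ⟩
              N′ * (length (inputs i) * B)
                ≤⟨ lines-cost ν (punchIn out i) (Thick.N′≤dim (thick sizes≤θ) (≢out i)) (Thick.B≤asize (thick sizes≤θ) (≢out i)) ⟩
              (1 + 2 * a) * volume box                 ∎) ⟩
          length (allFin d) * ((1 + 2 * a) * volume box)
            ≡⟨ trans (cong (_* ((1 + 2 * a) * volume box)) (List.length-tabulate {n = d} id)) (sym (*-assoc d (1 + 2 * a) (volume box))) ⟩
          c-read * volume box                        ∎)
          λ {C} held≡O →
            let C′ , held≡ , steps = processReading L t L!
                  (λ x∈L x∈C → input≢out x∈L (O-out (subst (_ ∈_) held≡O x∈C)))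
                  (subst (λ x → length L + x ≤ capacity) (trans (cong length (sym held≡O)) (List.length-map proj₁ C)) L+O≤cap)
                  (λ p∈ j → line-held (∈-Division⁻ D p∈) held≡O j)
                  (λ p∈ x∈L → input≢out x∈L refl)
            in C′ , trans held≡ held≡O , steps
        where
        open ≤-Reasoning
        open +-*-Solver
        ≢out : ∀ i → punchIn out i ≢ out
        ≢out = Fin.punchInᵢ≢i out

        inputs : Fin d → List Line
        inputs i = arrayLines ν (punchIn out i)

        L = concatMap inputs (allFin d)

        L! : Unique L
        L! = concatMap-unique (λ i → arrayLines-unique ν (punchIn out i))
          (λ {i} {i′} x∈ x∈′ → Fin.punchIn-injective out i i′
            (trans (sym (∈-arrayLines⇒array ν (punchIn out i) x∈)) (∈-arrayLines⇒array ν (punchIn out i′) x∈′)))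
          (Unique.allFin⁺ d)

        input≢out : ∀ {x} → x ∈ L → proj₁ x ≢ out
        input≢out x∈ =
          let i , _ , x∈ᵢ = find (∈-concatMap⁻ inputs {xs = allFin d} x∈) in
          λ x≡out → ≢out i (trans (sym (∈-arrayLines⇒array ν (punchIn out i) x∈ᵢ)) x≡out)

        L+O≤cap : length L + length O ≤ capacity
        L+O≤cap = fits (length L + length O) (begin
          (length L + length O) * B                        ≡⟨ *-distribʳ-+ B (length L) (length O) ⟩
          length L * B + length O * B
            ≤⟨ +-mono-≤ (length-concatMap-≤ inputs B (θ + 2 * B) (allFin d) (λ i → lines≤ ν (punchIn out i) (sizes≤θ (punchIn out i)))) O≤ ⟩
          length (allFin d) * (θ + 2 * B) + (θ + 2 * B)
            ≡⟨ cong (λ x → x * (θ + 2 * B) + (θ + 2 * B)) (List.length-tabulate {n = d} id) ⟩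
          d * (θ + 2 * B) + (θ + 2 * B)                    ≡⟨ +-comm (d * (θ + 2 * B)) (θ + 2 * B) ⟩
          k * (θ + 2 * B)                                  ∎)

        line-held : ∀ {p C} → InBox p box → held C ≡ O → ∀ j → line j p ∈ L ⊎ line j p ∈ held C
        line-held {p} p∈ held≡O j with out Fin.≟ j
        ... | yes refl  = inj₂ (subst (line j p ∈_) (sym held≡O) (in-O p∈))
        ... | no  out≢j = inj₁ (∈-concatMap⁺ inputs (lose (∈-allFin (punchOut out≢j))
          (subst (λ j′ → line j p ∈ arrayLines ν j′) (sym (Fin.punchIn-punchOut out≢j)) (line∈arrayLines ν j p∈))))
      read-box {box} (stop reason) ν _ _ | no ¬fits =
        let j , θ<size = tooLarge {box} ¬fits in contradiction reason (large⇒¬stop {box} {j} b≤θ 1≤θ θ<size)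
      read-box {box} (halve {t₁ = t₁} {t₂} i split≡ D₁ D₂) ν _ in-O | no ¬fits =
        let j , θ<size = tooLarge {box} ¬fits
            c₁ , c₂ = children split≡ ν
            reading r₁ r₁≤ steps₁ = read-box D₁ (Child.node c₁) (λ _ → thick-child ν c₁ θ<size) (in-O ∘ Child.inside c₁)
            reading r₂ r₂≤ steps₂ = read-box D₂ (Child.node c₂) (λ _ → thick-child ν c₂ θ<size) (in-O ∘ Child.inside c₂)
        in reading (r₁ + r₂) (cost-halves {box} i N′ c-read r₁ r₂ r₁≤ r₂≤)
          λ held≡O →
            let C₁ , held₁ , S₁ = steps₁ held≡O
                C₂ , held₂ , S₂ = steps₂ held₁
            in C₂ , held₂ , steps-trans {t₁ = t₁} {t₂} {r₁} {r₂} {0} {0} S₁ S₂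

    -- The cache is empty at both ends, so that the halves can be chained. Only output lines are
    -- ever written, each at most once per reading.
    record Processing (box : Box {k}) (t : List Cell) : Set where
      constructor processing
      field
        inputReads outputReads writes : ℕ
        inputReads≤  : N′ * (inputReads * B) ≤ c-read * volume box
        outputReads≤ : N * (outputReads * B) ≤ (1 + 2 * a) * volume box
        writes≤      : writes ≤ outputReads
        steps        : Steps [] t (inputReads + outputReads) writes []

    process-box : ∀ {box t} → Recursive box t → (ν : Node box) →
      (arraySize out box ≤ θ → Flat box) → (Fits box → Thick box) → Processing box t
    process-box {box} {t} D ν flat thick with arraySize out box ≤? θ
    ... | yes size≤θ =
      let O = arrayLines ν out
          reading r r≤ steps = read-box O (∈-arrayLines⇒array ν out) (lines≤ ν out size≤θ) D ν thick (line∈arrayLines ν out)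
          C′ , held≡ , S = steps {clean O ++ []} (trans (held-clean-++ O []) (List.++-identityʳ O))
          w , w≤ , F = flush C′
          |C′|≡|O| = trans (sym (List.length-map proj₁ C′)) (cong length held≡)
          O≤cap = fits (length O) (≤-trans (lines≤ ν out size≤θ) (m≤m+n (θ + 2 * B) (d * (θ + 2 * B))))
      in processing r (length O) w r≤
        (lines-cost ν out (Flat.N≤dim (flat size≤θ)) (Flat.B≤asize (flat size≤θ)))
        (≤-trans w≤ (≤-reflexive |C′|≡|O|))
        λ {t′} {r′} {w′} run → subst (λ r → Run [] (t ++ t′) r (w + w′))
          (trans (sym (+-assoc (length O) r r′)) (cong (_+ r′) (+-comm (length O) r)))
          (readAll O (arrayLines-unique ν out) (λ _ ()) (≤-trans (≤-reflexive (+-identityʳ (length O))) O≤cap) (S (F run)))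
    process-box {box} (stop reason) ν _ _ | no size≰θ =
      contradiction reason (large⇒¬stop {box} {out} b≤θ 1≤θ (≰⇒> size≰θ))
    process-box {box} (halve {t₁ = t₁} {t₂} i split≡ D₁ D₂) ν _ _ | no size≰θ =
      let θ<size = ≰⇒> size≰θ
          c₁ , c₂ = children split≡ ν
          processing ri₁ ro₁ w₁ ri₁≤ ro₁≤ w₁≤ S₁ = process-box D₁ (Child.node c₁) (flat-child ν c₁ θ<size) (λ _ → thick-child ν c₁ θ<size)
          processing ri₂ ro₂ w₂ ri₂≤ ro₂≤ w₂≤ S₂ = process-box D₂ (Child.node c₂) (flat-child ν c₂ θ<size) (λ _ → thick-child ν c₂ θ<size)
      in processing (ri₁ + ri₂) (ro₁ + ro₂) (w₁ + w₂)
        (cost-halves {box} i N′ c-read ri₁ ri₂ ri₁≤ ri₂≤) (cost-halves {box} i N (1 + 2 * a) ro₁ ro₂ ro₁≤ ro₂≤) (+-mono-≤ w₁≤ w₂≤)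
        λ {t′} {r′} {w′} run → subst (λ r → Run [] ((t₁ ++ t₂) ++ t′) (r + r′) (w₁ + w₂ + w′))
          (solve 4 (λ a b c d → a :+ b :+ (c :+ d) := a :+ c :+ (b :+ d)) refl ri₁ ro₁ ri₂ ro₂)
          (steps-trans {t₁ = t₁} {t₂} {ri₁ + ro₁} {ri₂ + ro₂} {w₁} {w₂} S₁ S₂ run)
      where
      open +-*-Solver

-- Comparison with the target

-- k = d + 1 enters only through x^(k d) = x^d x^(d²); a variable k keeps the powers from unfolding.
module Numerics (d k n p q : ℕ) .{{_ : NonZero d}} (^-split : ∀ x → x ^ (k * d) ≡ x ^ d * x ^ (d * d)) where

  private
    K = k * d
    pq = p ^ d * q ^ (d * d)

  [xᵏyᵈ]ᵈ : ∀ x y → (x ^ k * y ^ d) ^ d ≡ x ^ K * y ^ (d * d)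
  [xᵏyᵈ]ᵈ x y = trans (^-distribʳ-* (x ^ k) (y ^ d) d) (cong₂ _*_ (^-*-assoc x k d) (^-*-assoc y d d))

  -- With real exponents: N ≤ 3 ω^(d/k) (6 α M)^(1/d) and n^k ≤ 2 N w B give T ≤ 2 · 3 · (6 α)^(1/d)
  -- ω w, as d/k + 1/k = 1. The root of 6 α is then estimated by 6 α.
  lower-numeric : ∀ {N α M B w X} → (N ^ k * q ^ d) ^ d ≤ (3 ^ k * p ^ d) ^ d * (6 * α * M) ^ k → 1 ≤ α →
    n ^ k ≤ N * (2 * (w * B)) → p * w ≤ X → n ^ (k * K) * pq ≤ (2 * 3 * 6 * α) ^ K * ((X * B) ^ K * M ^ k)
  lower-numeric {N} {α} {M} {B} {w} {X} N≤ 1≤α volume≤ pw≤X = begin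
    n ^ (k * K) * pq                                   ≡⟨ cong (_* pq) (^-*-assoc n k K) ⟨
    (n ^ k) ^ K * pq                                   ≤⟨ *-monoˡ-≤ pq (^-monoˡ-≤ K volume≤) ⟩
    (N * (2 * (w * B))) ^ K * pq                       ≡⟨ cong (_* pq) (^-distribʳ-* N (2 * (w * B)) K) ⟩
    N ^ K * Y * (p ^ d * q ^ (d * d))
      ≡⟨ solve 4 (λ N Y p q → N :* Y :* (p :* q) := Y :* p :* (N :* q)) refl (N ^ K) Y (p ^ d) (q ^ (d * d)) ⟩
    Y * p ^ d * (N ^ K * q ^ (d * d))                  ≤⟨ *-monoʳ-≤ (Y * p ^ d) Nᴷq≤ ⟩
    Y * p ^ d * (3 ^ K * p ^ (d * d) * ((6 * α) ^ K * M ^ k))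
      ≡⟨ solve 6 (λ Y p t p′ a m → Y :* p :* (t :* p′ :* (a :* m)) := Y :* (t :* (a :* (p :* p′))) :* m) refl Y (p ^ d) (3 ^ K) (p ^ (d * d)) ((6 * α) ^ K) (M ^ k) ⟩
    Y * (3 ^ K * ((6 * α) ^ K * (p ^ d * p ^ (d * d)))) * M ^ k ≡⟨ cong (_* M ^ k) gather ⟩
    (2 * 3 * 6 * α * (p * w * B)) ^ K * M ^ k
      ≤⟨ *-monoˡ-≤ (M ^ k) (^-monoˡ-≤ K (*-monoʳ-≤ (2 * 3 * 6 * α) (*-monoˡ-≤ B pw≤X))) ⟩
    (2 * 3 * 6 * α * (X * B)) ^ K * M ^ k                     ≡⟨ cong (_* M ^ k) (^-distribʳ-* (2 * 3 * 6 * α) (X * B) K) ⟩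
    (2 * 3 * 6 * α) ^ K * (X * B) ^ K * M ^ k                 ≡⟨ *-assoc ((2 * 3 * 6 * α) ^ K) _ _ ⟩
    (2 * 3 * 6 * α) ^ K * ((X * B) ^ K * M ^ k)               ∎
    where
    open ≤-Reasoning
    open +-*-Solver
    Y = (2 * (w * B)) ^ K
    Nᴷq≤ : N ^ K * q ^ (d * d) ≤ 3 ^ K * p ^ (d * d) * ((6 * α) ^ K * M ^ k)
    Nᴷq≤ = begin
      N ^ K * q ^ (d * d)                            ≡⟨ [xᵏyᵈ]ᵈ N q ⟨
      (N ^ k * q ^ d) ^ d                            ≤⟨ N≤ ⟩
      (3 ^ k * p ^ d) ^ d * (6 * α * M) ^ k          ≡⟨ cong₂ _*_ ([xᵏyᵈ]ᵈ 3 p) (^-distribʳ-* (6 * α) M k) ⟩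
      3 ^ K * p ^ (d * d) * ((6 * α) ^ k * M ^ k)
        ≤⟨ *-monoʳ-≤ (3 ^ K * p ^ (d * d)) (*-monoˡ-≤ (M ^ k) (≤-trans (m≤m^n ((6 * α) ^ k) d) (≤-reflexive (^-*-assoc (6 * α) k d)))) ⟩
      3 ^ K * p ^ (d * d) * ((6 * α) ^ K * M ^ k)    ∎
    gather : Y * (3 ^ K * ((6 * α) ^ K * (p ^ d * p ^ (d * d)))) ≡ (2 * 3 * 6 * α * (p * w * B)) ^ K
    gather = sym (begin-equality
      (2 * 3 * 6 * α * (p * w * B)) ^ K
        ≡⟨ cong (_^ K) (solve 7 (λ x y z α p w B → x :* y :* z :* α :* (p :* w :* B) := x :* (w :* B) :* (y :* (z :* α :* p))) refl 2 3 6 α p w B) ⟩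
      (2 * (w * B) * (3 * (6 * α * p))) ^ K             ≡⟨ ^-distribʳ-* (2 * (w * B)) _ K ⟩
      Y * (3 * (6 * α * p)) ^ K                         ≡⟨ cong (Y *_) (^-distribʳ-* 3 (6 * α * p) K) ⟩
      Y * (3 ^ K * (6 * α * p) ^ K)                     ≡⟨ cong (λ z → Y * (3 ^ K * z)) (^-distribʳ-* (6 * α) p K) ⟩
      Y * (3 ^ K * ((6 * α) ^ K * p ^ K))               ≡⟨ cong (λ z → Y * (3 ^ K * ((6 * α) ^ K * z))) (^-split p) ⟩
      Y * (3 ^ K * ((6 * α) ^ K * (p ^ d * p ^ (d * d)))) ∎)

  private
    gather-upper : ∀ u s {v a c N Z} → Z ≤ (s * a * N) ^ K * pq → N * v ≤ c * n ^ k →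
      (u * v) ^ K * Z ≤ (u * s * a * c) ^ K * (n ^ (k * K) * pq)
    gather-upper u s {v} {a} {c} {N} {Z} Z≤ Nv≤ = begin
      (u * v) ^ K * Z                                  ≤⟨ *-monoʳ-≤ ((u * v) ^ K) Z≤ ⟩
      (u * v) ^ K * ((s * a * N) ^ K * pq)             ≡⟨ *-assoc ((u * v) ^ K) _ _ ⟨
      (u * v) ^ K * (s * a * N) ^ K * pq               ≡⟨ cong (_* pq) (^-distribʳ-* (u * v) (s * a * N) K) ⟨
      (u * v * (s * a * N)) ^ K * pq
        ≡⟨ cong (λ x → x ^ K * pq) (solve 5 (λ u v s a N → u :* v :* (s :* a :* N) := u :* s :* a :* (N :* v)) refl u v s a N) ⟩
      (u * s * a * (N * v)) ^ K * pq                   ≤⟨ *-monoˡ-≤ pq (^-monoˡ-≤ K (*-monoʳ-≤ (u * s * a) Nv≤)) ⟩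
      (u * s * a * (c * n ^ k)) ^ K * pq               ≡⟨ cong (λ x → x ^ K * pq) (*-assoc (u * s * a) c (n ^ k)) ⟨
      (u * s * a * c * n ^ k) ^ K * pq                 ≡⟨ cong (_* pq) (^-distribʳ-* (u * s * a * c) (n ^ k) K) ⟩
      (u * s * a * c) ^ K * (n ^ k) ^ K * pq           ≡⟨ cong (λ x → (u * s * a * c) ^ K * x * pq) (^-*-assoc n k K) ⟩
      (u * s * a * c) ^ K * n ^ (k * K) * pq           ≡⟨ *-assoc ((u * s * a * c) ^ K) _ _ ⟩
      (u * s * a * c) ^ K * (n ^ (k * K) * pq)         ∎
      where
      open ≤-Reasoning
      open +-*-Solver

  -- With real exponents: 27 a N ≥ M^(1/d) ω^(-1/k), so N r B ≤ c n^k gives r ≤ 27 a c T. The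
  -- leading 2 is what `upper-numeric` requires.
  reads-numeric : ∀ {a c M B N r} → q ^ d * M ^ k ≤ p ^ d * ((27 * a * N) ^ k) ^ d → N * (r * B) ≤ c * n ^ k →
    (2 * (r * q * B)) ^ K * M ^ k ≤ (2 * 27 * a * c) ^ K * (n ^ (k * K) * pq)
  reads-numeric {a} {c} {M} {B} {N} {r} N≥ r≤ = begin
    (2 * (r * q * B)) ^ K * M ^ k
      ≡⟨ cong (λ x → x ^ K * M ^ k) (solve 3 (λ r q B → con 2 :* (r :* q :* B) := con 2 :* (r :* B) :* q) refl r q B) ⟩
    (2 * (r * B) * q) ^ K * M ^ k
      ≡⟨ cong (_* M ^ k) (trans (^-distribʳ-* (2 * (r * B)) q K) (cong ((2 * (r * B)) ^ K *_) (^-split q))) ⟩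
    (2 * (r * B)) ^ K * (q ^ d * q ^ (d * d)) * M ^ k
      ≡⟨ solve 4 (λ r q q′ m → r :* (q :* q′) :* m := r :* (q :* m :* q′)) refl ((2 * (r * B)) ^ K) (q ^ d) (q ^ (d * d)) (M ^ k) ⟩
    (2 * (r * B)) ^ K * (q ^ d * M ^ k * q ^ (d * d)) ≤⟨ gather-upper 2 27 {r * B} {a} {c} {N} (begin
      q ^ d * M ^ k * q ^ (d * d)                       ≤⟨ *-monoˡ-≤ (q ^ (d * d)) N≥ ⟩
      p ^ d * ((27 * a * N) ^ k) ^ d * q ^ (d * d)
        ≡⟨ cong (λ x → p ^ d * x * q ^ (d * d)) (^-*-assoc (27 * a * N) k d) ⟩
      p ^ d * (27 * a * N) ^ K * q ^ (d * d)
        ≡⟨ solve 3 (λ p x q → p :* x :* q := x :* (p :* q)) refl (p ^ d) ((27 * a * N) ^ K) (q ^ (d * d)) ⟩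
      (27 * a * N) ^ K * pq                             ∎) r≤ ⟩
    (2 * 27 * a * c) ^ K * (n ^ (k * K) * pq)      ∎
    where
    open ≤-Reasoning
    open +-*-Solver

  -- With real exponents: 3 a N ≥ ω^(d/k) M^(1/d), so N r B ≤ c n^k gives ω r ≤ 3 a c T.
  writes-numeric : ∀ {a c M B N r} → (p ^ d) ^ d * M ^ k ≤ ((3 * a * N) ^ k * q ^ d) ^ d → N * (r * B) ≤ c * n ^ k →
    (4 * (p * r * B)) ^ K * M ^ k ≤ (4 * 3 * a * c) ^ K * (n ^ (k * K) * pq)
  writes-numeric {a} {c} {M} {B} {N} {r} N≥ r≤ = begin
    (4 * (p * r * B)) ^ K * M ^ k
      ≡⟨ cong (λ x → x ^ K * M ^ k) (solve 3 (λ r p B → con 4 :* (p :* r :* B) := con 4 :* (r :* B) :* p) refl r p B) ⟩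
    (4 * (r * B) * p) ^ K * M ^ k
      ≡⟨ cong (_* M ^ k) (trans (^-distribʳ-* (4 * (r * B)) p K) (cong ((4 * (r * B)) ^ K *_) (^-split p))) ⟩
    (4 * (r * B)) ^ K * (p ^ d * p ^ (d * d)) * M ^ k
      ≡⟨ solve 4 (λ r p p′ m → r :* (p :* p′) :* m := r :* (p′ :* m :* p)) refl ((4 * (r * B)) ^ K) (p ^ d) (p ^ (d * d)) (M ^ k) ⟩
    (4 * (r * B)) ^ K * (p ^ (d * d) * M ^ k * p ^ d) ≤⟨ gather-upper 4 3 {r * B} {a} {c} {N} (begin
      p ^ (d * d) * M ^ k * p ^ d                       ≡⟨ cong (λ x → x * M ^ k * p ^ d) (^-*-assoc p d d) ⟨
      (p ^ d) ^ d * M ^ k * p ^ d                       ≤⟨ *-monoˡ-≤ (p ^ d) N≥ ⟩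
      ((3 * a * N) ^ k * q ^ d) ^ d * p ^ d             ≡⟨ cong (_* p ^ d) ([xᵏyᵈ]ᵈ (3 * a * N) q) ⟩
      (3 * a * N) ^ K * q ^ (d * d) * p ^ d
        ≡⟨ solve 3 (λ x q p → x :* q :* p := x :* (p :* q)) refl ((3 * a * N) ^ K) (q ^ (d * d)) (p ^ d) ⟩
      (3 * a * N) ^ K * pq                              ∎) r≤ ⟩
    (4 * 3 * a * c) ^ K * (n ^ (k * K) * pq)       ∎
    where
    open ≤-Reasoning
    open +-*-Solver

  -- Input reads contribute `U`; output reads and writes together contribute at most `V`, since 1 ≤
  -- ω and w ≤ r′. A power does not distribute over the sum, so the larger of the two is doubled,
  -- which yields the coefficients 2 and 4.
  upper-numeric : ∀ {a c c′ M B N N′ r r′ w} → q ≤ p →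
    q ^ d * M ^ k ≤ p ^ d * ((27 * a * N′) ^ k) ^ d → N′ * (r * B) ≤ c * n ^ k →
    (p ^ d) ^ d * M ^ k ≤ ((3 * a * N) ^ k * q ^ d) ^ d → N * (r′ * B) ≤ c′ * n ^ k → w ≤ r′ →
    (((r + r′) * q + p * w) * B) ^ K * M ^ k ≤ (2 * 27 * a * c + 4 * 3 * a * c′) ^ K * (n ^ (k * K) * pq)
  upper-numeric {a} {c} {c′} {M} {B} {N} {N′} {r} {r′} {w} q≤p N′≥ r≤ N≥ r′≤ w≤r′ = by-cases (≤-total U V)
    where
    open ≤-Reasoning
    open +-*-Solver
    U = r * q * B
    V = 2 * (p * r′ * B)
    X = ((r + r′) * q + p * w) * B
    X≤U+V : X ≤ U + V
    X≤U+V = begin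
      ((r + r′) * q + p * w) * B
        ≡⟨ solve 6 (λ r r′ q p w B → ((r :+ r′) :* q :+ p :* w) :* B := r :* q :* B :+ (r′ :* q :+ p :* w) :* B) refl r r′ q p w B ⟩
      U + (r′ * q + p * w) * B
        ≤⟨ +-monoʳ-≤ U (*-monoˡ-≤ B (+-mono-≤ (*-monoʳ-≤ r′ q≤p) (*-monoʳ-≤ p w≤r′))) ⟩
      U + (r′ * p + p * r′) * B
        ≡⟨ cong (U +_) (solve 3 (λ r p B → (r :* p :+ p :* r) :* B := con 2 :* (p :* r :* B)) refl r′ p B) ⟩
      U + V                                       ∎
    by-cases : U ≤ V ⊎ V ≤ U → X ^ K * M ^ k ≤ (2 * 27 * a * c + 4 * 3 * a * c′) ^ K * (n ^ (k * K) * pq)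
    by-cases (inj₁ U≤V) = begin
      X ^ K * M ^ k                               ≤⟨ *-monoˡ-≤ (M ^ k) (^-monoˡ-≤ K (≤-trans X≤U+V (≤-trans (+-monoˡ-≤ V U≤V)
                                                       (≤-reflexive (solve 1 (λ x → con 2 :* x :+ con 2 :* x := con 4 :* x) refl (p * r′ * B)))))) ⟩
      (4 * (p * r′ * B)) ^ K * M ^ k              ≤⟨ writes-numeric {a} {c′} {M} {B} {N} {r′} N≥ r′≤ ⟩
      (4 * 3 * a * c′) ^ K * (n ^ (k * K) * pq)
        ≤⟨ *-monoˡ-≤ (n ^ (k * K) * pq) (^-monoˡ-≤ K (m≤n+m (4 * 3 * a * c′) (2 * 27 * a * c))) ⟩
      (2 * 27 * a * c + 4 * 3 * a * c′) ^ K * (n ^ (k * K) * pq) ∎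
    by-cases (inj₂ V≤U) = begin
      X ^ K * M ^ k                               ≤⟨ *-monoˡ-≤ (M ^ k) (^-monoˡ-≤ K (≤-trans X≤U+V (≤-trans (+-monoʳ-≤ U V≤U)
                                                       (≤-reflexive (solve 1 (λ x → x :+ x := con 2 :* x) refl U))))) ⟩
      (2 * (r * q * B)) ^ K * M ^ k               ≤⟨ reads-numeric {a} {c} {M} {B} {N′} {r} N′≥ r≤ ⟩
      (2 * 27 * a * c) ^ K * (n ^ (k * K) * pq)
        ≤⟨ *-monoˡ-≤ (n ^ (k * K) * pq) (^-monoˡ-≤ K (m≤m+n (2 * 27 * a * c) (4 * 3 * a * c′))) ⟩
      (2 * 27 * a * c + 4 * 3 * a * c′) ^ K * (n ^ (k * K) * pq) ∎

-- Choice of thresholds and constants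

module Bounds (d′ b a α n M B : ℕ) .{{_ : NonZero B}} (ω : ℚ) (1≤ω : 1ℚ ℚ.≤ ω) (B≤M : B ≤ M)
              (large : Grid.LargeSize (suc d′) a n M ω) (α-large : suc (suc d′) * (b + 11) ≤ α) where

  private d = suc d′
  open Grid d

  ω-frac : Fraction ω
  ω-frac = fraction 1≤ω

  open Fraction ω-frac
  open Shape d′ p q n 1≤q q≤p
  open Scaled d′ ω-frac n using (largeSize; cost≤target; target≤cost)
  open Numerics d k n p q (λ x → ^-distribˡ-+-* x d (d * d))

  1≤M : 1 ≤ M
  1≤M = ≤-trans (>-nonZero⁻¹ B) B≤M

  largeℕ : p ^ d * M ^ k ≤ (a * n) ^ k * q ^ d
  largeℕ = largeSize {a} {M} large

  M≤an : M ≤ a * n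
  M≤an = ^-cancelˡ-≤ k (*-cancelˡ-≤ (p ^ d) {{>-nonZero (≤-trans 1≤qᵈ qᵈ≤pᵈ)}} (begin
    p ^ d * M ^ k          ≤⟨ largeℕ ⟩
    (a * n) ^ k * q ^ d    ≤⟨ *-monoʳ-≤ ((a * n) ^ k) qᵈ≤pᵈ ⟩
    (a * n) ^ k * p ^ d    ≡⟨ *-comm ((a * n) ^ k) (p ^ d) ⟩
    p ^ d * (a * n) ^ k    ∎))
    where
    open ≤-Reasoning

  1≤an : 1 ≤ a * n
  1≤an = ≤-trans 1≤M M≤an

  1≤a : 1 ≤ a
  1≤a = n≢0⇒n>0 λ a≡0 → <⇒≱ 1≤an (≤-reflexive (cong (_* n) a≡0))

  1≤n : 1 ≤ n
  1≤n = n≢0⇒n>0 λ n≡0 → <⇒≱ 1≤an (≤-reflexive (trans (cong (a *_) n≡0) (*-zeroʳ a)))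

  b+11≤α : b + 11 ≤ α
  b+11≤α = ≤-trans (m≤n*m (b + 11) k) α-large

  1≤α : 1 ≤ α
  1≤α = ≤-trans (s≤s z≤n) (≤-trans (m≤n+m 11 b) b+11≤α)

  capacity : ℕ
  capacity = (α * M) / B

  open Recursion d′ ω-frac n 1≤n b B capacity
  open Machine ω cube B capacity
  open Runs ω cube B capacity
  open Node

  cells : List Cell
  cells = asymAlg ω b cube

  cells-recursive : Recursive (wholeBox cube) cells
  cells-recursive = asymAlg-Division ω b cube cube-positive

  whole-dim : ∀ l → Dims (wholeBox cube) l ≡ n
  whole-dim l = trans (cong (λ ns → lookup ns l) (lengths-wholeBox cube)) (Vec.lookup-replicate l n)

  whole-volume : volume (wholeBox cube) ≡ n ^ k
  whole-volume = trans (cong product (lengths-wholeBox cube)) (product-replicate k n)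

  lower-bound : ∀ {r w} → Run [] cells r w → Target.T≤_·_ n M B ω (2 * 3 * 6 * α) (cost ω r w)
  lower-bound {r} {w} run = target≤cost M B r w (2 * 3 * 6 * α)
    (lower-numeric {N} {α} {M} {B} {w} {r * q + p * w} N-deep 1≤α
      (subst (_≤ N * (2 * (w * B))) whole-volume (volume≤writes cells-recursive root run))
      (m≤n+m (p * w) (r * q)))
    where
    θ = 6 * α * M

    Deep : ℕ → Set
    Deep x = (x ^ k * q ^ d) ^ d ≤ (3 ^ k * p ^ d) ^ d * θ ^ k

    -- The right-hand side of `Deep` can serve as the limit of the search, as x is at most the
    -- left-hand side.
    maximum : ∃ λ N → Deep N × (∀ x → x ≤ (3 ^ k * p ^ d) ^ d * θ ^ k → Deep x → x ≤ N)
    maximum = maximalBelow (λ x → (x ^ k * q ^ d) ^ d ≤? (3 ^ k * p ^ d) ^ d * θ ^ k) ((3 ^ k * p ^ d) ^ d * θ ^ k) z≤n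

    N = proj₁ maximum
    N-deep = proj₁ (proj₂ maximum)

    Deep⇒≤ : ∀ x → Deep x → x ≤ (3 ^ k * p ^ d) ^ d * θ ^ k
    Deep⇒≤ x deep = ≤-trans (m≤m^n x k) (≤-trans (m≤m*n (x ^ k) (q ^ d) {{>-nonZero 1≤qᵈ}}) (≤-trans (m≤m^n (x ^ k * q ^ d) d) deep))

    N-max : ∀ {box} → Node box → arraySize out box ≤ θ → Dims box out ≤ N
    N-max {box} ν size≤θ = proj₂ (proj₂ maximum) (Dims box out) (Deep⇒≤ (Dims box out) deep) deep
      where
      deep : Deep (Dims box out)
      deep = ≤-trans (depth-bound (balanced ν)) (*-monoʳ-≤ ((3 ^ k * p ^ d) ^ d) (^-monoˡ-≤ k size≤θ))

    α≤θ : α ≤ θ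
    α≤θ = ≤-trans (m≤n*m α 6) (m≤m*n (6 * α) M {{>-nonZero 1≤M}})

    6cap≤θ : 3 * (2 * (capacity * B)) ≤ θ
    6cap≤θ = ≤-trans (*-monoʳ-≤ 3 (*-monoʳ-≤ 2 (m/n*n≤m (α * M) B)))
      (≤-reflexive (trans (sym (*-assoc 3 2 (α * M))) (sym (*-assoc 6 α M))))

    open LowerBound θ N (≤-trans (m≤m+n b 11) (≤-trans b+11≤α α≤θ)) (≤-trans 1≤α α≤θ) 6cap≤θ N-max

  c-read c-write : ℕ
  c-read  = d * (1 + 2 * a)
  c-write = 1 + 2 * a

  upper-bound : ∃₂ λ r w → Run [] cells r w × Target._≤_·T n M B ω (cost ω r w) (2 * 27 * a * c-read + 4 * 3 * a * c-write)
  upper-bound = inputReads + outputReads , writes , run ,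
    cost≤target M B (inputReads + outputReads) writes (2 * 27 * a * c-read + 4 * 3 * a * c-write)
      (upper-numeric {a} {c-read} {c-write} {M} {B} {N} {N′} {inputReads} {outputReads} {writes} q≤p
        N′-thick (subst (λ v → N′ * (inputReads * B) ≤ c-read * v) whole-volume inputReads≤)
        N-deep (subst (λ v → N * (outputReads * B) ≤ c-write * v) whole-volume outputReads≤) writes≤)
    where
    open ≤-Reasoning
    -- The `b` keeps the recursion going above θ, the 9 is the one of `M≤child`.
    θ = (b + 9) * M

    -- These say 3 a x ≥ ω^(d/k) M^(1/d) and 27 a x ≥ M^(1/d) ω^(-1/k). The 3 comes from
    -- `depth-bound-below`; 27 is the 9 of `size-bound` times 3 for halving. The factor `a` lets the
    -- size hypothesis imply both for x = n.
    Deep Thick′ : ℕ → Set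
    Deep x   = (p ^ d) ^ d * M ^ k ≤ ((3 * a * x) ^ k * q ^ d) ^ d
    Thick′ x = q ^ d * M ^ k ≤ p ^ d * ((27 * a * x) ^ k) ^ d

    deep-n : Deep n
    deep-n = begin
      (p ^ d) ^ d * M ^ k             ≤⟨ *-monoʳ-≤ ((p ^ d) ^ d) (m≤m^n (M ^ k) d) ⟩
      (p ^ d) ^ d * (M ^ k) ^ d       ≡⟨ ^-distribʳ-* (p ^ d) (M ^ k) d ⟨
      (p ^ d * M ^ k) ^ d             ≤⟨ ^-monoˡ-≤ d largeℕ ⟩
      ((a * n) ^ k * q ^ d) ^ d       ≤⟨ ^-monoˡ-≤ d (*-monoˡ-≤ (q ^ d) (^-monoˡ-≤ k (*-monoˡ-≤ n (m≤n*m a 3)))) ⟩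
      ((3 * a * n) ^ k * q ^ d) ^ d   ∎

    thick-n : Thick′ n
    thick-n = begin
      q ^ d * M ^ k                   ≤⟨ *-monoˡ-≤ (M ^ k) qᵈ≤pᵈ ⟩
      p ^ d * M ^ k                   ≤⟨ *-monoʳ-≤ (p ^ d) (^-monoˡ-≤ k (≤-trans M≤an (*-monoˡ-≤ n (m≤n*m a 27)))) ⟩
      p ^ d * (27 * a * n) ^ k        ≤⟨ *-monoʳ-≤ (p ^ d) (m≤m^n ((27 * a * n) ^ k) d) ⟩
      p ^ d * ((27 * a * n) ^ k) ^ d  ∎

    least-deep = minimal (λ x → (p ^ d) ^ d * M ^ k ≤? ((3 * a * x) ^ k * q ^ d) ^ d) n deep-n
    least-thick = minimal (λ x → q ^ d * M ^ k ≤? p ^ d * ((27 * a * x) ^ k) ^ d) n thick-n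

    N  = proj₁ least-deep
    N′ = proj₁ least-thick
    N-deep   = proj₁ (proj₂ least-deep)
    N′-thick = proj₁ (proj₂ least-thick)

    9M≤θ : 9 * M ≤ θ
    9M≤θ = *-monoˡ-≤ M (m≤n+m 9 b)

    M≤θ : M ≤ θ
    M≤θ = ≤-trans (m≤n*m M 9) 9M≤θ

    b≤θ : b ≤ θ
    b≤θ = ≤-trans (m≤m+n b 9) (m≤m*n (b + 9) M {{>-nonZero 1≤M}})

    N-min : ∀ {box} → Node box → θ < arraySize out box → N ≤ Dims box out
    N-min {box} ν θ<size = proj₂ (proj₂ least-deep) (Dims box out) (deep (Dims box out ≟ n))
      where
      deep : Dec (Dims box out ≡ n) → Deep (Dims box out)
      deep (yes ≡n) = subst Deep (sym ≡n) deep-n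
      deep (no  ≢n) = begin
        (p ^ d) ^ d * M ^ k
          ≤⟨ *-monoʳ-≤ ((p ^ d) ^ d) (^-monoˡ-≤ k (≤-trans M≤θ (<⇒≤ θ<size))) ⟩
        (p ^ d) ^ d * arraySize out box ^ k
          ≤⟨ depth-bound-below (balanced ν) (≤-trans (s≤s (≤-trans 1≤M M≤θ)) θ<size) ≢n ⟩
        (3 ^ k * (Dims box out ^ k * q ^ d)) ^ d
          ≡⟨ cong (_^ d) (trans (sym (*-assoc (3 ^ k) (Dims box out ^ k) (q ^ d))) (cong (_* q ^ d) (sym (^-distribʳ-* 3 (Dims box out) k)))) ⟩
        ((3 * Dims box out) ^ k * q ^ d) ^ d
          ≤⟨ ^-monoˡ-≤ d (*-monoˡ-≤ (q ^ d) (^-monoˡ-≤ k (*-monoˡ-≤ (Dims box out) (m≤m*n 3 a {{>-nonZero 1≤a}})))) ⟩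
        ((3 * a * Dims box out) ^ k * q ^ d) ^ d         ∎

    N′-min : ∀ {box} → Node box → ∀ j → θ < arraySize j box → ∀ {l} → l ≢ out → ∀ x → Dims box l ≤ 3 * x → N′ ≤ x
    N′-min {box} ν j θ<size {l} l≢out x dim≤3x = proj₂ (proj₂ least-thick) x (begin
      q ^ d * M ^ k                                      ≤⟨ *-monoʳ-≤ (q ^ d) (^-monoˡ-≤ k (≤-trans M≤θ (<⇒≤ θ<size))) ⟩
      q ^ d * arraySize j box ^ k                        ≤⟨ size-bound (balanced ν) j l≢out ⟩
      p ^ d * ((9 * Dims box l) ^ k) ^ d
        ≤⟨ *-monoʳ-≤ (p ^ d) (^-monoˡ-≤ d (^-monoˡ-≤ k (≤-trans (*-monoʳ-≤ 9 dim≤3x) (≤-trans (≤-reflexive (sym (*-assoc 9 3 x))) (*-monoˡ-≤ x (m≤m*n 27 a {{>-nonZero 1≤a}})))))) ⟩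
      p ^ d * ((27 * a * x) ^ k) ^ d                     ∎)

    -- Each of the k arrays takes up to θ entries and two extra lines, with 2 B ≤ 2 M; so b + 9
    -- becomes b + 11 in the bound on α.
    fits : ∀ x → x * B ≤ k * (θ + 2 * B) → x ≤ capacity
    fits x x*B≤ = subst (_≤ capacity) (m*n/n≡m x B) (/-monoˡ-≤ B (begin
      x * B                         ≤⟨ x*B≤ ⟩
      k * (θ + 2 * B)               ≤⟨ *-monoʳ-≤ k (+-monoʳ-≤ θ (*-monoʳ-≤ 2 B≤M)) ⟩
      k * ((b + 9) * M + 2 * M)     ≡⟨ cong (k *_) (*-distribʳ-+ M (b + 9) 2) ⟨
      k * ((b + 9 + 2) * M)         ≡⟨ cong (λ y → k * (y * M)) (+-assoc b 9 2) ⟩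
      k * ((b + 11) * M)            ≡⟨ *-assoc k (b + 11) M ⟨
      k * (b + 11) * M              ≤⟨ *-monoˡ-≤ M α-large ⟩
      α * M                         ∎))

    module U = UpperBound d′ ω-frac n 1≤n b B capacity

    B≤a*size : ∀ j → B ≤ a * arraySize j (wholeBox cube)
    B≤a*size j = ≤-trans B≤M (≤-trans M≤an (*-monoʳ-≤ a (begin
      n                                ≤⟨ m≤m^n n d ⟩
      n ^ d                            ≤⟨ product-of-n ⟩
      arraySize j (wholeBox cube)      ∎)))
      where
      product-of-n : n ^ d ≤ arraySize j (wholeBox cube)
      product-of-n = *-cancelˡ-≤ n {{>-nonZero 1≤n}} (≤-reflexive (trans (sym whole-volume)
        (trans (sym (dim*size j (wholeBox cube))) (cong (_* arraySize j (wholeBox cube)) (whole-dim j)))))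

    -- If arrays of the whole grid are already at most θ, there is no oversized parent to rely on;
    -- the size hypothesis takes its place through `deep-n`, `thick-n` and M ≤ a n.
    whole = U.process-box θ M a N N′ b≤θ (≤-trans 1≤M M≤θ) 9M≤θ 1≤a B≤M fits N-min N′-min cells-recursive root
      (λ _ → record { N≤dim   = subst (N ≤_) (sym (whole-dim out)) (proj₂ (proj₂ least-deep) n deep-n)
                    ; B≤asize = B≤a*size out })
      (λ _ → record { N′≤dim  = λ {l} _ → subst (N′ ≤_) (sym (whole-dim l)) (proj₂ (proj₂ least-thick) n thick-n)
                    ; B≤asize = λ {j} _ → B≤a*size j })

    open U.Processing whole

    run : Run [] cells (inputReads + outputReads) writes
    run = subst (λ t → Run [] t (inputReads + outputReads) writes) (List.++-identityʳ cells)
      (subst₂ (Run [] (cells ++ [])) (+-identityʳ (inputReads + outputReads)) (+-identityʳ writes) (steps (finish [])))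

  computes-with-bounds : ∀ {u v ℓ} → ComputesGrid u v ℓ cube cells ×
    CacheComplexityΘ (2 * 3 * 6 * α) (2 * 27 * a * c-read + 4 * 3 * a * c-write) ω n M B capacity cells
  computes-with-bounds {u} {v} {ℓ} =
    asymAlg-computesGrid u v ℓ ω b cube cube-positive , (λ r w run → lower-bound run) , upper-bound

theorem5p1 : ∀ {u v ℓ : Level} (d : ℕ) .{{_ : NonZero d}} (b a : ℕ) →
    let open Grid d in
    ∃ λ (α₀ : ℕ) → ∀ (α : ℕ) → α₀ ≤ α →
    ∃₂ λ (C₁ C₂ : ℕ) →
    ∀ (n M B : ℕ) .{{_ : NonZero B}} (ω : ℚ) → 1ℚ ℚ.≤ ω → B ≤ M → LargeSize a n M ω →
    ComputesGrid u v ℓ (replicate k n) (asymAlg ω b (replicate k n))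
    × CacheComplexityΘ C₁ C₂ ω n M B ((α * M) / B) (asymAlg ω b (replicate k n))
theorem5p1 (suc d′) b a = suc (suc d′) * (b + 11) , λ α α-large →
  2 * 3 * 6 * α , 2 * 27 * a * (suc d′ * (1 + 2 * a)) + 4 * 3 * a * (1 + 2 * a) ,
  λ n M B ω 1≤ω B≤M large → Bounds.computes-with-bounds d′ b a α n M B ω 1≤ω B≤M large α-large
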